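{- Let $f$ be a random multiplicative function in the sense of Wintner and let $\varepsilon>0$. There exists a positive constant $C_\varepsilon$ such that, almost surely, for all $x,y\geq 2$ with $y\geq C_\varepsilon\log x$, $$\Psi_f(x,y)\ll \Psi^*(x,y)^{1/2+\varepsilon}.$$
   Context: Random multiplicative function in the sense of Wintner: let $\{f(p)\}_{p\text{ prime}}$ be a sequence of independent random variables, each taking the values $+1$ and $-1$ with probability $1/2$; for $n\geq 1$ put $f(n):=\mu(n)^2\prod_{p\mid n}f(p)$, where $\mu$ is the Möbius function. $P^+(n)$ denotes the largest prime factor of $n$, with $P^+(1):=1$. $S(x,y)$ is the set of positive integers $n\leq x$ with $P^+(n)\leq y$. For an arithmetic function $g$, $\Psi_g(x,y):=\sum_{n\in S(x,y)}g(n)$. $\Psi^*(x,y):=\Psi_{\mu^2}(x,y)$ is the number of squarefree elements of $S(x,y)$. Here $x,y$ are real. $A\ll B$ means $|A|\leq CB$ for some constant $C>0$, uniformly for all $x,y$ in the indicated range. In an almost sure statement, the constant $C$ may depend on the realization of $f$ (and on $\varepsilon$), but not on $x,y$. -}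

module Defs where

open import Axiom.ExcludedMiddle using (ExcludedMiddle)
open import Data.Integer.Base as ℤ using (ℤ; +_; 0ℤ; 1ℤ; -1ℤ)
import Data.Integer.Properties as ℤ
open import Data.List.Base using (List; []; _∷_; foldr; map; filter; length; upTo)
open import Data.List.Relation.Unary.All using (All)
open import Data.List.Relation.Unary.Any using (any?)
open import Data.List.Relation.Unary.Unique.Propositional using (Unique)
open import Data.Nat.Base as ℕ using (ℕ; zero; suc; _!)
open import Data.Nat.Divisibility using (_∣?_)
open import Data.Nat.Primality using (Prime; prime?)
import Data.Nat.Properties as ℕ
open import Data.Product.Base using (∃; _×_; _,_; proj₁; proj₂)
open import Data.Rational.Base as ℚ using (ℚ; 0ℚ; 1ℚ; ½; *≤*; ↥_; mkℚ)
import Data.Rational.Literals as Literals using (fromℤ)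
import Data.Rational.Properties as ℚ
open import Data.Rational.Solver using (module +-*-Solver)
open import Data.Sign.Base using (Sign)
open import Level using (0ℓ)
open import Relation.Binary.PropositionalEquality
  using (_≡_; _≢_; refl; sym; trans; cong; cong₂; subst; subst₂)
open import Relation.Nullary using (Dec; yes; no)
open import Relation.Nullary.Decidable using (_×-dec_)
open import Relation.Unary using (Pred; _∈_; _⊆_; _≐_; U; ∁; _∩_; Empty)

infix  4 _≤_ _<_ _≃_ _⟶_
infixl 6 _+_ _-_
infixl 7 _*_
infix  8 -_
infixr 9 _^_ _^[_]_

-- Real numbers are Cauchy sequences of rationals, with the setoid
-- equality _≃_ ("the difference tends to 0").  The Cauchy proofs are abstract
-- to keep the type checker from unfolding them.

Eventually : Pred (Pred ℕ 0ℓ) 0ℓ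
Eventually P = ∃ λ N → ∀ n → N ℕ.≤ n → P n

IsCauchy : (ℕ → ℚ) → Set
IsCauchy a = ∀ ε → 0ℚ ℚ.< ε →
  ∃ λ N → ∀ m n → N ℕ.≤ m → N ℕ.≤ n → ℚ.∣ a m ℚ.- a n ∣ ℚ.≤ ε

record ℝ : Set where
  constructor mkℝ
  field
    seq    : ℕ → ℚ
    cauchy : IsCauchy seq

open ℝ public

_≃_ : ℝ → ℝ → Set
x ≃ y = ∀ ε → 0ℚ ℚ.< ε → Eventually λ n → ℚ.∣ seq x n ℚ.- seq y n ∣ ℚ.≤ ε

_≤_ : ℝ → ℝ → Set
x ≤ y = ∀ ε → 0ℚ ℚ.< ε → Eventually λ n → seq x n ℚ.≤ seq y n ℚ.+ ε

_<_ : ℝ → ℝ → Set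
x < y = ∃ λ ε → 0ℚ ℚ.< ε × Eventually λ n → seq x n ℚ.+ ε ℚ.≤ seq y n

private
  half : ℚ → ℚ
  half ε = ½ ℚ.* ε

  half-pos : ∀ {ε} → 0ℚ ℚ.< ε → 0ℚ ℚ.< half ε
  half-pos {ε} 0<ε =
    subst (ℚ._< half ε) (ℚ.*-zeroʳ ½) (ℚ.*-monoʳ-<-pos ½ 0<ε)

  half+half : ∀ ε → half ε ℚ.+ half ε ≡ ε
  half+half ε =
    trans (sym (ℚ.*-distribʳ-+ ε ½ ½)) (ℚ.*-identityˡ ε)

  abstract
    +-cauchy : ∀ a b → IsCauchy a → IsCauchy b →
               IsCauchy (λ n → a n ℚ.+ b n)
    +-cauchy a b ca cb ε 0<ε =
      let M , p = ca (half ε) (half-pos 0<ε)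
          N , q = cb (half ε) (half-pos 0<ε)
      in M ℕ.⊔ N , λ m n m≥ n≥ → estimate (a m) (b m) (a n) (b n)
           (p m n (ℕ.m⊔n≤o⇒m≤o M N m≥) (ℕ.m⊔n≤o⇒m≤o M N n≥))
           (q m n (ℕ.m⊔n≤o⇒n≤o M N m≥) (ℕ.m⊔n≤o⇒n≤o M N n≥))
      where
      open ℚ.≤-Reasoning
      regroup : ∀ u v w z → (u ℚ.+ v) ℚ.- (w ℚ.+ z) ≡ (u ℚ.- w) ℚ.+ (v ℚ.- z)
      regroup = solve 4 (λ u v w z → (u :+ v) :- (w :+ z) := (u :- w) :+ (v :- z)) refl
        where open +-*-Solver
      estimate : ∀ u v w z → ℚ.∣ u ℚ.- w ∣ ℚ.≤ half ε → ℚ.∣ v ℚ.- z ∣ ℚ.≤ half ε →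
                 ℚ.∣ (u ℚ.+ v) ℚ.- (w ℚ.+ z) ∣ ℚ.≤ ε
      estimate u v w z h₁ h₂ = begin
        ℚ.∣ (u ℚ.+ v) ℚ.- (w ℚ.+ z) ∣      ≡⟨ cong ℚ.∣_∣ (regroup u v w z) ⟩
        ℚ.∣ (u ℚ.- w) ℚ.+ (v ℚ.- z) ∣      ≤⟨ ℚ.∣p+q∣≤∣p∣+∣q∣ (u ℚ.- w) (v ℚ.- z) ⟩
        ℚ.∣ u ℚ.- w ∣ ℚ.+ ℚ.∣ v ℚ.- z ∣    ≤⟨ ℚ.+-mono-≤ h₁ h₂ ⟩
        half ε ℚ.+ half ε                  ≡⟨ half+half ε ⟩
        ε                                  ∎

    neg-cauchy : ∀ a → IsCauchy a → IsCauchy (λ n → ℚ.- a n)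
    neg-cauchy a ca ε 0<ε =
      let N , p = ca ε 0<ε in N , λ m n m≥ n≥ →
      subst (ℚ._≤ ε)
        (trans (sym (ℚ.∣-p∣≡∣p∣ (a m ℚ.- a n))) (cong ℚ.∣_∣ (regroup (a m) (a n))))
        (p m n m≥ n≥)
      where
      regroup : ∀ u v → ℚ.- (u ℚ.- v) ≡ (ℚ.- u) ℚ.- (ℚ.- v)
      regroup = solve 2 (λ u v → :- (u :- v) := (:- u) :- (:- v)) refl
        where open +-*-Solver

  split : ∀ u v → u ≡ v ℚ.+ (u ℚ.- v)
  split = solve 2 (λ u v → u := v :+ (u :- v)) refl
    where open +-*-Solver

  0<1 : 0ℚ ℚ.< 1ℚ
  0<1 = ℚ.positive⁻¹ 1ℚ

  eventually-bounded : ∀ a → IsCauchy a →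
    ∃ λ K → 0ℚ ℚ.< K × Eventually λ n → ℚ.∣ a n ∣ ℚ.≤ K
  eventually-bounded a ca =
    let N , p = ca 1ℚ 0<1 in
    ℚ.∣ a N ∣ ℚ.+ 1ℚ ,
    ℚ.+-mono-≤-< (ℚ.0≤∣p∣ (a N)) 0<1 ,
    N , λ n n≥ → begin
      ℚ.∣ a n ∣                         ≡⟨ cong ℚ.∣_∣ (split (a n) (a N)) ⟩
      ℚ.∣ a N ℚ.+ (a n ℚ.- a N) ∣       ≤⟨ ℚ.∣p+q∣≤∣p∣+∣q∣ (a N) (a n ℚ.- a N) ⟩
      ℚ.∣ a N ∣ ℚ.+ ℚ.∣ a n ℚ.- a N ∣   ≤⟨ ℚ.+-monoʳ-≤ ℚ.∣ a N ∣ (p n N n≥ ℕ.≤-refl) ⟩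
      ℚ.∣ a N ∣ ℚ.+ 1ℚ                  ∎
    where open ℚ.≤-Reasoning

  *-mono-≤-abs : ∀ p q {K δ} → 0ℚ ℚ.< K → ℚ.∣ p ∣ ℚ.≤ K → ℚ.∣ q ∣ ℚ.≤ δ →
                 ℚ.∣ p ℚ.* q ∣ ℚ.≤ K ℚ.* δ
  *-mono-≤-abs p q {K} {δ} 0<K p≤ q≤ = begin
    ℚ.∣ p ℚ.* q ∣        ≡⟨ ℚ.∣p*q∣≡∣p∣*∣q∣ p q ⟩
    ℚ.∣ p ∣ ℚ.* ℚ.∣ q ∣  ≤⟨ ℚ.*-monoʳ-≤-nonNeg ℚ.∣ q ∣ {{ℚ.∣-∣-nonNeg q}} p≤ ⟩
    K ℚ.* ℚ.∣ q ∣        ≤⟨ ℚ.*-monoˡ-≤-nonNeg K {{ℚ.nonNegative (ℚ.<⇒≤ 0<K)}} q≤ ⟩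
    K ℚ.* δ              ∎
    where open ℚ.≤-Reasoning

  -- ε / (2K)
  scaled : ∀ {K ε} → 0ℚ ℚ.< K → 0ℚ ℚ.< ε →
           ∃ λ δ → 0ℚ ℚ.< δ × K ℚ.* δ ≡ half ε
  scaled {K} {ε} 0<K 0<ε =
    (ℚ.1/ K) ℚ.* half ε ,
    subst (ℚ._< (ℚ.1/ K) ℚ.* half ε) (ℚ.*-zeroʳ (ℚ.1/ K))
      (ℚ.*-monoʳ-<-pos (ℚ.1/ K) {{ℚ.1/pos⇒pos K}} (half-pos 0<ε)) ,
    trans (sym (ℚ.*-assoc K (ℚ.1/ K) (half ε)))
      (trans (cong (ℚ._* half ε) (ℚ.*-inverseʳ K)) (ℚ.*-identityˡ (half ε)))
    where
    instance
      K-pos : ℚ.Positive K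
      K-pos = ℚ.positive 0<K
      K-nonZero : ℚ.NonZero K
      K-nonZero = ℚ.pos⇒nonZero K

  abstract
    *-cauchy : ∀ a b → IsCauchy a → IsCauchy b →
               IsCauchy (λ n → a n ℚ.* b n)
    *-cauchy a b ca cb ε 0<ε =
      let K , 0<K , A , a≤K = eventually-bounded a ca
          L , 0<L , B , b≤L = eventually-bounded b cb
          α , 0<α , Lα = scaled 0<L 0<ε
          β , 0<β , Kβ = scaled 0<K 0<ε
          M , p = ca α 0<α
          N , q = cb β 0<β
      in (A ℕ.⊔ B) ℕ.⊔ (M ℕ.⊔ N) , λ m n m≥ n≥ →
      let AB≤m = ℕ.m⊔n≤o⇒m≤o (A ℕ.⊔ B) (M ℕ.⊔ N) m≥
          MN≤m = ℕ.m⊔n≤o⇒n≤o (A ℕ.⊔ B) (M ℕ.⊔ N) m≥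
          AB≤n = ℕ.m⊔n≤o⇒m≤o (A ℕ.⊔ B) (M ℕ.⊔ N) n≥
          MN≤n = ℕ.m⊔n≤o⇒n≤o (A ℕ.⊔ B) (M ℕ.⊔ N) n≥
      in estimate (a m) (b m) (a n) (b n) K L α β 0<K 0<L Kβ Lα
           (a≤K m (ℕ.m⊔n≤o⇒m≤o A B AB≤m))
           (q m n (ℕ.m⊔n≤o⇒n≤o M N MN≤m) (ℕ.m⊔n≤o⇒n≤o M N MN≤n))
           (b≤L n (ℕ.m⊔n≤o⇒n≤o A B AB≤n))
           (p m n (ℕ.m⊔n≤o⇒m≤o M N MN≤m) (ℕ.m⊔n≤o⇒m≤o M N MN≤n))
      where
      open ℚ.≤-Reasoning
      regroup : ∀ u v w z →
        u ℚ.* v ℚ.- w ℚ.* z ≡ u ℚ.* (v ℚ.- z) ℚ.+ z ℚ.* (u ℚ.- w)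
      regroup = solve 4 (λ u v w z →
        u :* v :- w :* z := u :* (v :- z) :+ z :* (u :- w)) refl
        where open +-*-Solver
      estimate : ∀ u v w z K L α β → 0ℚ ℚ.< K → 0ℚ ℚ.< L →
        K ℚ.* β ≡ half ε → L ℚ.* α ≡ half ε →
        ℚ.∣ u ∣ ℚ.≤ K → ℚ.∣ v ℚ.- z ∣ ℚ.≤ β →
        ℚ.∣ z ∣ ℚ.≤ L → ℚ.∣ u ℚ.- w ∣ ℚ.≤ α →
        ℚ.∣ u ℚ.* v ℚ.- w ℚ.* z ∣ ℚ.≤ ε
      estimate u v w z K L α β 0<K 0<L Kβ Lα h₁ h₂ h₃ h₄ = begin
        ℚ.∣ u ℚ.* v ℚ.- w ℚ.* z ∣
          ≡⟨ cong ℚ.∣_∣ (regroup u v w z) ⟩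
        ℚ.∣ u ℚ.* (v ℚ.- z) ℚ.+ z ℚ.* (u ℚ.- w) ∣
          ≤⟨ ℚ.∣p+q∣≤∣p∣+∣q∣ (u ℚ.* (v ℚ.- z)) (z ℚ.* (u ℚ.- w)) ⟩
        ℚ.∣ u ℚ.* (v ℚ.- z) ∣ ℚ.+ ℚ.∣ z ℚ.* (u ℚ.- w) ∣
          ≤⟨ ℚ.+-mono-≤ (*-mono-≤-abs u (v ℚ.- z) 0<K h₁ h₂)
                        (*-mono-≤-abs z (u ℚ.- w) 0<L h₃ h₄) ⟩
        K ℚ.* β ℚ.+ L ℚ.* α    ≡⟨ cong₂ ℚ._+_ Kβ Lα ⟩
        half ε ℚ.+ half ε      ≡⟨ half+half ε ⟩
        ε                      ∎

    const-cauchy : ∀ q → IsCauchy (λ _ → q)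
    const-cauchy q ε 0<ε = 0 , λ _ _ _ _ →
      subst (ℚ._≤ ε) (sym (cong ℚ.∣_∣ (ℚ.+-inverseʳ q))) (ℚ.<⇒≤ 0<ε)

fromℚ : ℚ → ℝ
fromℚ q = mkℝ (λ _ → q) (const-cauchy q)

fromℤ : ℤ → ℝ
fromℤ i = fromℚ (Literals.fromℤ i)

fromℕ : ℕ → ℝ
fromℕ n = fromℤ (+ n)

_+_ : ℝ → ℝ → ℝ
x + y = mkℝ (λ n → seq x n ℚ.+ seq y n) (+-cauchy (seq x) (seq y) (cauchy x) (cauchy y))

_*_ : ℝ → ℝ → ℝ
x * y = mkℝ (λ n → seq x n ℚ.* seq y n) (*-cauchy (seq x) (seq y) (cauchy x) (cauchy y))

-_ : ℝ → ℝ
- x = mkℝ (λ n → ℚ.- seq x n) (neg-cauchy (seq x) (cauchy x))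

_-_ : ℝ → ℝ → ℝ
x - y = x + (- y)

_^_ : ℝ → ℕ → ℝ
x ^ zero  = fromℕ 1
x ^ suc n = x * x ^ n

∏ : List ℝ → ℝ
∏ []       = fromℕ 1
∏ (x ∷ xs) = x * ∏ xs

∑ : ℕ → (ℕ → ℝ) → ℝ
∑ zero    s = fromℕ 0
∑ (suc n) s = ∑ n s + s n

_⟶_ : (ℕ → ℝ) → ℝ → Set
s ⟶ L = ∀ ε → fromℕ 0 < ε →
  Eventually λ n → (L - ε ≤ s n) × (s n ≤ L + ε)

-- Classical mathematics enters through an explicit excluded middle.
-- the em P is a real number satisfying P, or 0 if there is none; below it
-- is applied to predicates with at most one solution up to _≃_.
the : ExcludedMiddle 0ℓ → Pred ℝ 0ℓ → ℝ
the em P = witness (em {∃ P})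
  where
  witness : Dec (∃ P) → ℝ
  witness (yes (x , _)) = x
  witness (no _)        = fromℕ 0

lim : ExcludedMiddle 0ℓ → (ℕ → ℝ) → ℝ
lim em s = the em (s ⟶_)

exp : ExcludedMiddle 0ℓ → ℝ → ℝ
exp em x = lim em λ n → ∑ n λ k → x ^ k * fromℚ ((+ 1 ℚ./ (k !)) {{k ℕ.!≢0}})

log : ExcludedMiddle 0ℓ → ℝ → ℝ
log em x = the em λ l → exp em l ≃ x

-- For b > 0.
_^[_]_ : ℝ → ExcludedMiddle 0ℓ → ℝ → ℝ
b ^[ em ] a = exp em (a * log em b)

primeDivisors : ℕ → List ℕ
primeDivisors n = filter (λ p → prime? p ×-dec (p ∣? n)) (upTo (suc n))

-- The foldr gives P⁺ 1 = 1.
P⁺ : ℕ → ℕ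
P⁺ n = foldr ℕ._⊔_ 1 (primeDivisors n)

μ : ℕ → ℤ
μ n with any? (λ p → (p ℕ.* p) ∣? n) (primeDivisors n)
... | yes _ = 0ℤ
... | no  _ = -1ℤ ℤ.^ length (primeDivisors n)

μ² : ℕ → ℤ
μ² n = μ n ℤ.^ 2

S : ℝ → ℝ → Pred ℕ 0ℓ
S x y n = (1 ℕ.≤ n) × (fromℕ n ≤ x) × (fromℕ (P⁺ n) ≤ y)

-- A natural number above x, used only to make the search for elements
-- of S x y finite; see ≤-bound.
bound : ℝ → ℕ
bound x = ℤ.∣ ↥ seq x (proj₁ (cauchy x 1ℚ 0<1)) ∣ ℕ.+ 2

private
  p≤∣p∣ : ∀ p → p ℚ.≤ ℚ.∣ p ∣
  p≤∣p∣ (mkℚ (+ _) _ _) = ℚ.≤-refl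
  p≤∣p∣ (mkℚ ℤ.-[1+ _ ] _ _) = *≤* ℤ.-≤+

  ≤∣↥∣ : ∀ q → q ℚ.≤ Literals.fromℤ (+ ℤ.∣ ↥ q ∣)
  ≤∣↥∣ (mkℚ (+ n) d _) = *≤* (ℤ.*-monoˡ-≤-nonNeg (+ n) (ℤ.+≤+ (ℕ.s≤s ℕ.z≤n)))
  ≤∣↥∣ (mkℚ ℤ.-[1+ n ] d _) = *≤* ℤ.-≤+

  fromℤ-+ : ∀ i j → Literals.fromℤ i ℚ.+ Literals.fromℤ j ≡ Literals.fromℤ (i ℤ.+ j)
  fromℤ-+ i j =
    trans (cong (λ k → k ℚ./ 1) (cong₂ ℤ._+_ (ℤ.*-identityʳ i) (ℤ.*-identityʳ j)))
          (ℚ.↥p/↧p≡p (Literals.fromℤ (i ℤ.+ j)))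

  ≤-bound′ : ∀ n a b → Literals.fromℤ (+ n) ℚ.≤ b ℚ.+ 1ℚ → ℚ.∣ b ℚ.- a ∣ ℚ.≤ 1ℚ →
             Literals.fromℤ (+ n) ℚ.≤ Literals.fromℤ (+ (ℤ.∣ ↥ a ∣ ℕ.+ 2))
  ≤-bound′ n a b n≤b+1 b-a≤1 = begin
    Literals.fromℤ (+ n)                ≤⟨ n≤b+1 ⟩
    b ℚ.+ 1ℚ                            ≡⟨ cong (ℚ._+ 1ℚ) (split b a) ⟩
    a ℚ.+ (b ℚ.- a) ℚ.+ 1ℚ              ≤⟨ ℚ.+-monoˡ-≤ 1ℚ (ℚ.+-mono-≤ (≤∣↥∣ a) (ℚ.≤-trans (p≤∣p∣ (b ℚ.- a)) b-a≤1)) ⟩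
    Literals.fromℤ (+ ∣a∣) ℚ.+ 1ℚ ℚ.+ 1ℚ
      ≡⟨ ℚ.+-assoc (Literals.fromℤ (+ ∣a∣)) 1ℚ 1ℚ ⟩
    Literals.fromℤ (+ ∣a∣) ℚ.+ (1ℚ ℚ.+ 1ℚ)
      ≡⟨ cong (Literals.fromℤ (+ ∣a∣) ℚ.+_) 1+1≡2 ⟩
    Literals.fromℤ (+ ∣a∣) ℚ.+ Literals.fromℤ (+ 2)
      ≡⟨ fromℤ-+ (+ ∣a∣) (+ 2) ⟩
    Literals.fromℤ (+ (∣a∣ ℕ.+ 2))      ∎
    where
    open ℚ.≤-Reasoning
    ∣a∣ : ℕ
    ∣a∣ = ℤ.∣ ↥ a ∣
    1+1≡2 : 1ℚ ℚ.+ 1ℚ ≡ Literals.fromℤ (+ 2)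
    1+1≡2 = refl

≤-bound : ∀ n x → fromℕ n ≤ x → n ℕ.≤ bound x
≤-bound n x n≤x =
  let M , p = cauchy x 1ℚ 0<1
      N , q = n≤x 1ℚ 0<1
      k = M ℕ.⊔ N
  in ℤ.drop‿+≤+ (subst₂ ℤ._≤_ (ℤ.*-identityʳ _) (ℤ.*-identityʳ _)
       (ℚ.drop-*≤* (≤-bound′ n (seq x M) (seq x k)
         (q k (ℕ.m≤n⊔m M N)) (p k M (ℕ.m≤m⊔n M N) ℕ.≤-refl))))

-- Ψ_g(x,y) for an integer-valued arithmetic function g.
Ψ : ExcludedMiddle 0ℓ → (ℕ → ℤ) → ℝ → ℝ → ℤ
Ψ em g x y = foldr ℤ._+_ 0ℤ (map g (filter (λ n → em {n ∈ S x y}) (upTo (suc (bound x)))))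

Ψ* : ExcludedMiddle 0ℓ → ℝ → ℝ → ℤ
Ψ* em = Ψ em μ²

-- ℙ is total for convenience; its values off the σ-algebra are
-- unconstrained and never used.
record ProbabilitySpace : Set₂ where
  field
    Ω          : Set
    Measurable : Pred Ω 0ℓ → Set₁
    ℙ          : Pred Ω 0ℓ → ℝ

    measurable-resp : ∀ {A B} → A ≐ B → Measurable A → Measurable B
    measurable-U    : Measurable U
    measurable-∁    : ∀ {A} → Measurable A → Measurable (∁ A)
    measurable-⋃    : ∀ (A : ℕ → Pred Ω 0ℓ) → (∀ i → Measurable (A i)) →
                      Measurable (λ ω → ∃ λ i → A i ω)

    ℙ-resp : ∀ {A B} → A ≐ B → Measurable A → ℙ A ≃ ℙ B
    ℙ-nonneg : ∀ {A} → Measurable A → fromℕ 0 ≤ ℙ A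
    ℙ-U : ℙ U ≃ fromℕ 1
    ℙ-⋃ : ∀ (A : ℕ → Pred Ω 0ℓ) → (∀ i → Measurable (A i)) →
          (∀ i j → i ≢ j → Empty (A i ∩ A j)) →
          (λ n → ∑ n λ k → ℙ (A k)) ⟶ ℙ (λ ω → ∃ λ i → A i ω)

AlmostSurely : (𝒫 : ProbabilitySpace) → Pred (ProbabilitySpace.Ω 𝒫) 0ℓ → Set₁
AlmostSurely 𝒫 Q = ∃ λ E → Measurable E × (ℙ E ≃ fromℕ 1) × (E ⊆ Q)
  where open ProbabilitySpace 𝒫

-- Independent Rademacher variables attached to the primes; the values of
-- the family X at non-primes are irrelevant.
record IsRademacher (𝒫 : ProbabilitySpace)
                    (X : ℕ → ProbabilitySpace.Ω 𝒫 → Sign) : Set₁ where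
  open ProbabilitySpace 𝒫
  field
    measurable  : ∀ {p} → Prime p → ∀ s → Measurable (λ ω → X p ω ≡ s)
    fair        : ∀ {p} → Prime p → ∀ s → ℙ (λ ω → X p ω ≡ s) ≃ fromℚ ½
    independent : ∀ (ps : List ℕ) → All Prime ps → Unique ps → ∀ (s : ℕ → Sign) →
                  ℙ (λ ω → All (λ p → X p ω ≡ s p) ps)
                  ≃ ∏ (map (λ p → ℙ (λ ω → X p ω ≡ s p)) ps)

wintner : {Ω : Set} → (ℕ → Ω → Sign) → Ω → ℕ → ℤ
wintner X ω n =
  μ² n ℤ.* foldr ℤ._*_ 1ℤ (map (λ p → X p ω ℤ.◃ 1) (primeDivisors n))

{-# OPTIONS --safe #-}
module Submission where

-- Fix y and let v = Ψ*(x,y).  As a function of the signs f(p), p ≤ y, the sum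
-- Ψ_f(x,y) is a multilinear polynomial with v coefficients, all equal to 1, so its
-- second moment is v.  If no integer counted has more than d prime factors, then
-- by the (2,4)-hypercontractive inequality, iterated, its moment of order
-- 2k = 2 ^ (r + 1) is at most K ^ d * v ^ k, where K depends only on r
-- (hypercontractive, moment-bound).
--
-- The arithmetic input is K ^ d ≤ v when y ≥ C log x and C is large in terms of K
-- (K^degree≤).  Let y ^ j ≤ x < y ^ (j + 1).  Chebyshev's bound
-- 2 ^ (y - 1) ≤ y ^ π(y) turns the hypothesis into π(y) ≥ B j with B as large as
-- desired, and choosing one prime from each of j blocks of B primes shows
-- v ≥ B ^ j (productCount-≥).  When y is at most j ^ 4, only O(j) distinct primes can
-- have a product below y ^ (j + 1), so d ≤ 9 j and B = K ^ 9 suffices.  When y is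
-- larger, larger blocks give v ≥ x ^ (1/16), whereas K ^ d is smaller than this for
-- large x, since the product of d distinct integers grows faster than any
-- exponential in d (degreeBound-≤).
--
-- By Markov's inequality |Ψ_f| ^ 2k exceeds v ^ (k + 13) with probability at most
-- v ^ (-12).  For fixed y the sum Ψ_f changes, as x grows, only when v changes
-- (signSum-cong), so there is one event for each pair (v, y), rather than for each
-- pair (x, y).  Moreover y < (v + 1) ^ 4, so the union over y of the events with given v
-- has probability O(v ^ (-8)), and the Borel-Cantelli lemma applies to the sequence
-- indexed by v.  As (k + 13) / 2k ≤ 1/2 + ε for large k, almost surely the desired
-- bound holds for all v beyond some random index, while for the remaining v the
-- trivial bound |Ψ_f| ≤ v is absorbed in the constant.  For y > x one replaces y by
-- x, which leaves both sums unchanged.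
--
-- The real exponential enters through its functional equation, obtained from a
-- bound for the difference of the partial sums, and through the existence of
-- logarithms of reals x ≥ 1, obtained by bisection.

-- Moments of polynomials in independent signs

module Hypercontractivity where

  open import Data.Integer.Base as ℤ using (ℤ; +_; 0ℤ; 1ℤ; _+_; _*_; -_; _-_; _≤_; +≤+; ∣_∣; _◃_; nonNegative; Positive; positive)
  open import Data.Integer.Properties
  open import Data.Integer.Solver using (module +-*-Solver)
  open import Data.Nat.Base as ℕ using (ℕ; zero; suc)
  import Data.Nat.Properties as ℕ
  import Data.Nat.Solver
  module NS = Data.Nat.Solver.+-*-Solver
  open import Data.Product.Base using (∃₂; _×_; _,_; proj₁; proj₂)
  open import Data.Sign.Base as Sign using (Sign)
  open import Data.Unit.Base using (⊤; tt)
  open import Data.Vec.Base using (Vec; []; _∷_)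
  open import Relation.Binary.PropositionalEquality
  open import Relation.Nullary using (yes; no; Dec)

  private variable
    m : ℕ

  ^-distribʳ-* : ∀ d a b → (a ℕ.* b) ℕ.^ d ≡ a ℕ.^ d ℕ.* b ℕ.^ d
  ^-distribʳ-* zero a b = refl
  ^-distribʳ-* (suc d) a b = trans (cong (a ℕ.* b ℕ.*_) (^-distribʳ-* d a b))
    (NS.solve 4 (λ a b x y → (a NS.:* b) NS.:* (x NS.:* y) NS.:= (a NS.:* x) NS.:* (b NS.:* y)) refl a b (a ℕ.^ d) (b ℕ.^ d))

  -- The sum of a function over the 2 ^ m sign vectors of length m.
  ∑± : ∀ m → (Vec Sign m → ℤ) → ℤ
  ∑± zero    g = g []
  ∑± (suc m) g = ∑± m (λ σ → g (Sign.+ ∷ σ)) + ∑± m (λ σ → g (Sign.- ∷ σ))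

  ∑±-cong : ∀ m {f g : Vec Sign m → ℤ} → (∀ σ → f σ ≡ g σ) → ∑± m f ≡ ∑± m g
  ∑±-cong zero    h = h []
  ∑±-cong (suc m) h = cong₂ _+_ (∑±-cong m (λ σ → h (Sign.+ ∷ σ))) (∑±-cong m (λ σ → h (Sign.- ∷ σ)))

  ∑±-mono : ∀ m {f g : Vec Sign m → ℤ} → (∀ σ → f σ ≤ g σ) → ∑± m f ≤ ∑± m g
  ∑±-mono zero    h = h []
  ∑±-mono (suc m) h = +-mono-≤ (∑±-mono m (λ σ → h (Sign.+ ∷ σ))) (∑±-mono m (λ σ → h (Sign.- ∷ σ)))

  ∑±-+ : ∀ m (f g : Vec Sign m → ℤ) → ∑± m (λ σ → f σ + g σ) ≡ ∑± m f + ∑± m g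
  ∑±-+ zero    f g = refl
  ∑±-+ (suc m) f g =
    trans (cong₂ _+_ (∑±-+ m _ _) (∑±-+ m _ _))
          (solve 4 (λ a b c d → (a :+ b) :+ (c :+ d) := (a :+ c) :+ (b :+ d)) refl
             (∑± m (λ σ → f (Sign.+ ∷ σ))) (∑± m (λ σ → g (Sign.+ ∷ σ)))
             (∑± m (λ σ → f (Sign.- ∷ σ))) (∑± m (λ σ → g (Sign.- ∷ σ))))
    where open +-*-Solver

  ∑±-* : ∀ m c (f : Vec Sign m → ℤ) → ∑± m (λ σ → c * f σ) ≡ c * ∑± m f
  ∑±-* zero    c f = refl
  ∑±-* (suc m) c f = trans (cong₂ _+_ (∑±-* m c _) (∑±-* m c _)) (sym (*-distribˡ-+ c _ _))

  ∑±-0 : ∀ m → ∑± m (λ _ → 0ℤ) ≡ 0ℤ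
  ∑±-0 zero = refl
  ∑±-0 (suc m) = cong₂ _+_ (∑±-0 m) (∑±-0 m)

  ∑±-nonNeg : ∀ m {f : Vec Sign m → ℤ} → (∀ σ → 0ℤ ≤ f σ) → 0ℤ ≤ ∑± m f
  ∑±-nonNeg m {f} h = subst (_≤ ∑± m f) (∑±-0 m) (∑±-mono m h)

  *-nonNeg : ∀ {a b} → 0ℤ ≤ a → 0ℤ ≤ b → 0ℤ ≤ a * b
  *-nonNeg {a} {b} p q =
    subst (_≤ a * b) (*-zeroʳ a) (*-monoˡ-≤-nonNeg a {{nonNegative p}} q)

  *-mono-≤ : ∀ {a b c d} → 0ℤ ≤ a → 0ℤ ≤ d → a ≤ b → c ≤ d → a * c ≤ b * d
  *-mono-≤ {a} {b} {c} {d} 0≤a 0≤d a≤b c≤d =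
    ≤-trans (*-monoˡ-≤-nonNeg a {{nonNegative 0≤a}} c≤d) (*-monoʳ-≤-nonNeg d {{nonNegative 0≤d}} a≤b)

  square-nonNeg : ∀ a → 0ℤ ≤ a * a
  square-nonNeg a = subst (0ℤ ≤_) (trans (sym (cong +_ (abs-* a a))) (0≤i⇒+∣i∣≡i (square a))) (+≤+ ℕ.z≤n)
    where
    square : ∀ a → 0ℤ ≤ a * a
    square (+ zero) = +≤+ ℕ.z≤n
    square (+ suc n) = +≤+ ℕ.z≤n
    square (ℤ.-[1+ n ]) = +≤+ ℕ.z≤n

  -- All terms are non-negative, so the diagonal is at most the full product.
  ∑±-*-≤ : ∀ m {f g : Vec Sign m → ℤ} → (∀ σ → 0ℤ ≤ f σ) → (∀ σ → 0ℤ ≤ g σ) →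
           ∑± m (λ σ → f σ * g σ) ≤ ∑± m f * ∑± m g
  ∑±-*-≤ zero f≥0 g≥0 = ≤-refl
  ∑±-*-≤ (suc m) {f} {g} f≥0 g≥0 = begin
    ∑± m (λ σ → f₁ σ * g₁ σ) + ∑± m (λ σ → f₂ σ * g₂ σ)
      ≤⟨ +-mono-≤ (∑±-*-≤ m (λ σ → f≥0 (Sign.+ ∷ σ)) (λ σ → g≥0 (Sign.+ ∷ σ)))
                   (∑±-*-≤ m (λ σ → f≥0 (Sign.- ∷ σ)) (λ σ → g≥0 (Sign.- ∷ σ))) ⟩
    a * c + b * d
      ≡⟨ +-identityʳ (a * c + b * d) ⟨
    (a * c + b * d) + 0ℤ
      ≤⟨ +-monoʳ-≤ (a * c + b * d) (+-mono-≤ (*-nonNeg 0≤a 0≤d) (*-nonNeg 0≤b 0≤c)) ⟩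
    (a * c + b * d) + (a * d + b * c)
      ≡⟨ solve 4 (λ a b c d → (a :* c :+ b :* d) :+ (a :* d :+ b :* c) := (a :+ b) :* (c :+ d)) refl a b c d ⟩
    (a + b) * (c + d) ∎
    where
    open ≤-Reasoning
    open +-*-Solver
    f₁ f₂ g₁ g₂ : Vec Sign m → ℤ
    f₁ σ = f (Sign.+ ∷ σ)
    f₂ σ = f (Sign.- ∷ σ)
    g₁ σ = g (Sign.+ ∷ σ)
    g₂ σ = g (Sign.- ∷ σ)
    a b c d : ℤ
    a = ∑± m f₁
    b = ∑± m f₂
    c = ∑± m g₁
    d = ∑± m g₂
    0≤a : 0ℤ ≤ a
    0≤a = ∑±-nonNeg m (λ σ → f≥0 (Sign.+ ∷ σ))
    0≤b : 0ℤ ≤ b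
    0≤b = ∑±-nonNeg m (λ σ → f≥0 (Sign.- ∷ σ))
    0≤c : 0ℤ ≤ c
    0≤c = ∑±-nonNeg m (λ σ → g≥0 (Sign.+ ∷ σ))
    0≤d : 0ℤ ≤ d
    0≤d = ∑±-nonNeg m (λ σ → g≥0 (Sign.- ∷ σ))

  -- Multiplication by a sign.
  infix 7 _·_
  _·_ : Sign → ℤ → ℤ
  s · a = (s ◃ 1) * a

  -- Deg< d g says that, as a multilinear polynomial in the signs, g has degree
  -- less than d; degree less than 0 means that g vanishes.  A function of a non-empty
  -- sign vector is split as A + s · B, where s is the first sign, A has degree less
  -- than d and B has degree less than d - 1.
  Deg< : ∀ {m} → ℕ → (Vec Sign m → ℤ) → Set
  Deg< zero g = ∀ σ → g σ ≡ 0ℤ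
  Deg< {zero} (suc d) g = ⊤
  Deg< {suc m} (suc d) g =
    ∃₂ λ A B → (∀ s σ → g (s ∷ σ) ≡ A σ + s · B σ) × Deg< {m} (suc d) A × Deg< {m} d B

  deg-0 : ∀ d {g : Vec Sign m → ℤ} → (∀ σ → g σ ≡ 0ℤ) → Deg< d g
  deg-0 zero h = h
  deg-0 {zero} (suc d) h = tt
  deg-0 {suc m} (suc d) h =
    (λ _ → 0ℤ) , (λ _ → 0ℤ) , (λ s σ → trans (h _) (sym (trans (+-identityˡ (s · 0ℤ)) (*-zeroʳ (s ◃ 1))))) ,
    deg-0 (suc d) (λ _ → refl) , deg-0 d (λ _ → refl)

  deg-mono : ∀ {d e} {g : Vec Sign m → ℤ} → d ℕ.≤ e → Deg< d g → Deg< e g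
  deg-mono {e = e} ℕ.z≤n h = deg-0 e h
  deg-mono {zero} (ℕ.s≤s d≤e) h = tt
  deg-mono {suc m} (ℕ.s≤s d≤e) (A , B , h , degA , degB) =
    A , B , h , deg-mono (ℕ.s≤s d≤e) degA , deg-mono d≤e degB

  deg-+ : ∀ d {f g : Vec Sign m → ℤ} → Deg< d f → Deg< d g → Deg< d (λ σ → f σ + g σ)
  deg-+ zero p q σ = cong₂ _+_ (p σ) (q σ)
  deg-+ {zero} (suc d) p q = tt
  deg-+ {suc m} (suc d) {f} {g} (A , B , p , degA , degB) (C , D , q , degC , degD) =
    (λ σ → A σ + C σ) , (λ σ → B σ + D σ) ,
    (λ s σ → trans (cong₂ _+_ (p s σ) (q s σ))
       (solve 5 (λ s a b c d → (a :+ s :* b) :+ (c :+ s :* d) := (a :+ c) :+ s :* (b :+ d)) refl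
          (s ◃ 1) (A σ) (B σ) (C σ) (D σ))) ,
    deg-+ (suc d) degA degC , deg-+ d degB degD
    where open +-*-Solver

  ◃1-square : ∀ s → (s ◃ 1) * (s ◃ 1) ≡ 1ℤ
  ◃1-square Sign.+ = refl
  ◃1-square Sign.- = refl

  deg-* : ∀ a b {f g : Vec Sign m → ℤ} → Deg< (suc a) f → Deg< (suc b) g →
          Deg< (suc (a ℕ.+ b)) (λ σ → f σ * g σ)
  deg-* {zero} a b p q = tt
  deg-* {suc m} a b {f} {g} (A , B , p , degA , degB) (C , D , q , degC , degD) =
    (λ σ → A σ * C σ + B σ * D σ) , (λ σ → A σ * D σ + B σ * C σ) ,
    expand , deg-+ (suc (a ℕ.+ b)) (deg-* a b degA degC) (degBD a b degB degD) ,
    deg-+ (a ℕ.+ b) (degAD b degD) (degBC a degB)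
    where
    open +-*-Solver
    expand : ∀ s σ → f (s ∷ σ) * g (s ∷ σ) ≡ A σ * C σ + B σ * D σ + s · (A σ * D σ + B σ * C σ)
    expand s σ = begin
      f (s ∷ σ) * g (s ∷ σ)
        ≡⟨ cong₂ _*_ (p s σ) (q s σ) ⟩
      (A σ + s · B σ) * (C σ + s · D σ)
        ≡⟨ solve 5 (λ s a b c d → (a :+ s :* b) :* (c :+ s :* d) :=
                    a :* c :+ (s :* s) :* (b :* d) :+ s :* (a :* d :+ b :* c)) refl
             (s ◃ 1) (A σ) (B σ) (C σ) (D σ) ⟩
      A σ * C σ + (s ◃ 1) * (s ◃ 1) * (B σ * D σ) + s · (A σ * D σ + B σ * C σ)
        ≡⟨ cong (λ x → A σ * C σ + x + s · (A σ * D σ + B σ * C σ))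
             (trans (cong (_* (B σ * D σ)) (◃1-square s)) (*-identityˡ _)) ⟩
      A σ * C σ + B σ * D σ + s · (A σ * D σ + B σ * C σ) ∎
      where open ≡-Reasoning
    degBD : ∀ a b → Deg< a B → Deg< b D → Deg< (suc (a ℕ.+ b)) (λ σ → B σ * D σ)
    degBD zero b B≡0 _ = deg-0 (suc b) (λ σ → cong (_* D σ) (B≡0 σ))
    degBD (suc a) zero _ D≡0 = deg-0 (suc (suc a ℕ.+ zero)) (λ σ → trans (cong (B σ *_) (D≡0 σ)) (*-zeroʳ (B σ)))
    degBD (suc a) (suc b) degB degD =
      deg-mono (ℕ.s≤s (ℕ.+-mono-≤ (ℕ.n≤1+n a) (ℕ.n≤1+n b))) (deg-* a b degB degD)
    degAD : ∀ b → Deg< b D → Deg< (a ℕ.+ b) (λ σ → A σ * D σ)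
    degAD zero D≡0 = deg-0 (a ℕ.+ zero) (λ σ → trans (cong (A σ *_) (D≡0 σ)) (*-zeroʳ (A σ)))
    degAD (suc b) degD = subst (λ k → Deg< k (λ σ → A σ * D σ)) (sym (ℕ.+-suc a b)) (deg-* a b degA degD)
    degBC : ∀ a → Deg< a B → Deg< (a ℕ.+ b) (λ σ → B σ * C σ)
    degBC zero B≡0 = deg-0 b (λ σ → cong (_* C σ) (B≡0 σ))
    degBC (suc a) degB = deg-* a b degB degC

  private
    -- The fourth and second powers of a + s b, summed over the two signs s.
    fourth : ∀ a b → (a + b) * (a + b) * ((a + b) * (a + b)) + (a - b) * (a - b) * ((a - b) * (a - b))
             ≡ + 2 * (a * a * (a * a) + + 6 * (a * a * (b * b)) + b * b * (b * b))
    fourth = solve 2 (λ a b →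
      (a :+ b) :* (a :+ b) :* ((a :+ b) :* (a :+ b)) :+ (a :- b) :* (a :- b) :* ((a :- b) :* (a :- b))
      := con (+ 2) :* (a :* a :* (a :* a) :+ con (+ 6) :* (a :* a :* (b :* b)) :+ b :* b :* (b :* b))) refl
      where open +-*-Solver

    second : ∀ a b → (a + b) * (a + b) + (a - b) * (a - b) ≡ + 2 * (a * a + b * b)
    second = solve 2 (λ a b → (a :+ b) :* (a :+ b) :+ (a :- b) :* (a :- b) := con (+ 2) :* (a :* a :+ b :* b)) refl
      where open +-*-Solver

  infixr 8 _^²
  _^² : ∀ {A : Set} → (A → ℤ) → A → ℤ
  (g ^²) σ = g σ * g σ

  -- The power c ^ d, as an integer.
  pow : ℕ → ℕ → ℤ
  pow c d = + (c ℕ.^ d)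

  pow-suc : ∀ c d → pow c (suc d) ≡ + c * pow c d
  pow-suc c d = pos-* c (c ℕ.^ d)

  pow-nonNeg : ∀ c d → 0ℤ ≤ pow c d
  pow-nonNeg c d = +≤+ ℕ.z≤n

  private
    split± : ∀ (g : Vec Sign (suc m) → ℤ) (A B : Vec Sign m → ℤ) → (∀ s σ → g (s ∷ σ) ≡ A σ + s · B σ) →
             (∀ σ → g (Sign.+ ∷ σ) ≡ A σ + B σ) × (∀ σ → g (Sign.- ∷ σ) ≡ A σ - B σ)
    split± g A B h =
      (λ σ → trans (h Sign.+ σ) (cong (_+_ (A σ)) (*-identityˡ (B σ)))) ,
      (λ σ → trans (h Sign.- σ) (cong (_+_ (A σ)) (-1*i≡-i (B σ))))

  second-moment : ∀ m (g : Vec Sign (suc m) → ℤ) (A B : Vec Sign m → ℤ) → (∀ s σ → g (s ∷ σ) ≡ A σ + s · B σ) →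
                  ∑± (suc m) (g ^²) ≡ + 2 * (∑± m (A ^²) + ∑± m (B ^²))
  second-moment m g A B h = begin
    ∑± m (λ σ → (g ^²) (Sign.+ ∷ σ)) + ∑± m (λ σ → (g ^²) (Sign.- ∷ σ))
      ≡⟨ ∑±-+ m _ _ ⟨
    ∑± m (λ σ → (g ^²) (Sign.+ ∷ σ) + (g ^²) (Sign.- ∷ σ))
      ≡⟨ ∑±-cong m (λ σ → trans (cong₂ (λ x y → x * x + y * y) (p σ) (q σ)) (second (A σ) (B σ))) ⟩
    ∑± m (λ σ → + 2 * ((A ^²) σ + (B ^²) σ))
      ≡⟨ trans (∑±-* m (+ 2) _) (cong (+ 2 *_) (∑±-+ m _ _)) ⟩
    + 2 * (∑± m (A ^²) + ∑± m (B ^²)) ∎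
    where
    open ≡-Reasoning
    p = proj₁ (split± g A B h)
    q = proj₂ (split± g A B h)

  fourth-moment : ∀ m (g : Vec Sign (suc m) → ℤ) (A B : Vec Sign m → ℤ) → (∀ s σ → g (s ∷ σ) ≡ A σ + s · B σ) →
                  ∑± (suc m) (g ^² ^²) ≡
                  + 2 * (∑± m (A ^² ^²) + + 6 * ∑± m (λ σ → (A ^²) σ * (B ^²) σ) + ∑± m (B ^² ^²))
  fourth-moment m g A B h = begin
    ∑± m (λ σ → (g ^² ^²) (Sign.+ ∷ σ)) + ∑± m (λ σ → (g ^² ^²) (Sign.- ∷ σ))
      ≡⟨ ∑±-+ m _ _ ⟨
    ∑± m (λ σ → (g ^² ^²) (Sign.+ ∷ σ) + (g ^² ^²) (Sign.- ∷ σ))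
      ≡⟨ ∑±-cong m (λ σ → trans (cong₂ (λ x y → x * x * (x * x) + y * y * (y * y)) (p σ) (q σ)) (fourth (A σ) (B σ))) ⟩
    ∑± m (λ σ → + 2 * ((A ^² ^²) σ + + 6 * ((A ^²) σ * (B ^²) σ) + (B ^² ^²) σ))
      ≡⟨ ∑±-* m (+ 2) _ ⟩
    + 2 * ∑± m (λ σ → (A ^² ^²) σ + + 6 * ((A ^²) σ * (B ^²) σ) + (B ^² ^²) σ)
      ≡⟨ cong (+ 2 *_) (trans (∑±-+ m _ _) (cong (_+ ∑± m (B ^² ^²)) (trans (∑±-+ m _ _)
           (cong (_+_ (∑± m (A ^² ^²))) (∑±-* m (+ 6) _))))) ⟩
    + 2 * (∑± m (A ^² ^²) + + 6 * ∑± m (λ σ → (A ^²) σ * (B ^²) σ) + ∑± m (B ^² ^²)) ∎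
    where
    open ≡-Reasoning
    p = proj₁ (split± g A B h)
    q = proj₂ (split± g A B h)

  -- The fourth moment A₄ + 6 X + B₄ of A + s B, in terms of the second moments a and b
  -- of A and B.  All moments are sums over M = 2 ^ m sign vectors.
  module FourthMoment (m : ℕ) (A B : Vec Sign m → ℤ) where

    a b A₄ B₄ X M : ℤ
    a = ∑± m (A ^²)
    b = ∑± m (B ^²)
    A₄ = ∑± m (A ^² ^²)
    B₄ = ∑± m (B ^² ^²)
    X = ∑± m (λ σ → (A ^²) σ * (B ^²) σ)
    M = + (2 ℕ.^ m)

    private
      0≤a : 0ℤ ≤ a
      0≤a = ∑±-nonNeg m (λ σ → square-nonNeg (A σ))

      0≤b : 0ℤ ≤ b
      0≤b = ∑±-nonNeg m (λ σ → square-nonNeg (B σ))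

      0≤M : 0ℤ ≤ M
      0≤M = +≤+ ℕ.z≤n

      X≤ab : X ≤ a * b
      X≤ab = ∑±-*-≤ m (λ σ → square-nonNeg (A σ)) (λ σ → square-nonNeg (B σ))

    module _ (w : ℤ) (0≤w : 0ℤ ≤ w)
      (hA : M * A₄ ≤ + 9 * w * (a * a)) (hB : M * B₄ ≤ w * (b * b)) where

      open ≤-Reasoning
      open +-*-Solver

      -- The mixed term X is estimated by summing (b A² - 3 a B²)² ≥ 0, which bounds
      -- it by the two fourth moments, and dividing by a b.
      mixed : + 3 * (M * X) ≤ + 9 * w * (a * b)
      mixed = conclude (a * b) refl (*-nonNeg 0≤a 0≤b)
        where
        quadratic : ∀ x y → + 6 * (a * b) * (x * y) ≤ b * b * (x * x) + + 9 * (a * a) * (y * y)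
        quadratic x y = begin
          + 6 * (a * b) * (x * y)
            ≡⟨ +-identityˡ _ ⟨
          0ℤ + + 6 * (a * b) * (x * y)
            ≤⟨ +-monoˡ-≤ (+ 6 * (a * b) * (x * y)) (square-nonNeg (b * x - + 3 * a * y)) ⟩
          (b * x - + 3 * a * y) * (b * x - + 3 * a * y) + + 6 * (a * b) * (x * y)
            ≡⟨ solve 4 (λ a b x y → (b :* x :- con (+ 3) :* a :* y) :* (b :* x :- con (+ 3) :* a :* y)
                 :+ con (+ 6) :* (a :* b) :* (x :* y)
                 := b :* b :* (x :* x) :+ con (+ 9) :* (a :* a) :* (y :* y)) refl a b x y ⟩
          b * b * (x * x) + + 9 * (a * a) * (y * y) ∎
        summed : + 6 * (a * b) * X ≤ b * b * A₄ + + 9 * (a * a) * B₄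
        summed = begin
          + 6 * (a * b) * X
            ≡⟨ ∑±-* m (+ 6 * (a * b)) _ ⟨
          ∑± m (λ σ → + 6 * (a * b) * ((A ^²) σ * (B ^²) σ))
            ≤⟨ ∑±-mono m (λ σ → quadratic ((A ^²) σ) ((B ^²) σ)) ⟩
          ∑± m (λ σ → b * b * (A ^² ^²) σ + + 9 * (a * a) * (B ^² ^²) σ)
            ≡⟨ trans (∑±-+ m _ _) (cong₂ _+_ (∑±-* m (b * b) _) (∑±-* m (+ 9 * (a * a)) _)) ⟩
          b * b * A₄ + + 9 * (a * a) * B₄ ∎
        scaled : + 2 * (a * b) * (+ 3 * (M * X)) ≤ + 2 * (a * b) * (+ 9 * w * (a * b))
        scaled = begin
          + 2 * (a * b) * (+ 3 * (M * X))
            ≡⟨ solve 4 (λ a b M X → con (+ 2) :* (a :* b) :* (con (+ 3) :* (M :* X)) := M :* (con (+ 6) :* (a :* b) :* X)) refl a b M X ⟩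
          M * (+ 6 * (a * b) * X)
            ≤⟨ *-monoˡ-≤-nonNeg M {{nonNegative 0≤M}} summed ⟩
          M * (b * b * A₄ + + 9 * (a * a) * B₄)
            ≡⟨ solve 5 (λ a b M A₄ B₄ → M :* (b :* b :* A₄ :+ con (+ 9) :* (a :* a) :* B₄)
                 := b :* b :* (M :* A₄) :+ con (+ 9) :* (a :* a) :* (M :* B₄)) refl a b M A₄ B₄ ⟩
          b * b * (M * A₄) + + 9 * (a * a) * (M * B₄)
            ≤⟨ +-mono-≤ (*-monoˡ-≤-nonNeg (b * b) {{nonNegative (*-nonNeg 0≤b 0≤b)}} hA)
                        (*-monoˡ-≤-nonNeg (+ 9 * (a * a)) {{nonNegative (*-nonNeg {+ 9} (+≤+ ℕ.z≤n) (*-nonNeg 0≤a 0≤a))}} hB) ⟩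
          b * b * (+ 9 * w * (a * a)) + + 9 * (a * a) * (w * (b * b))
            ≡⟨ solve 3 (λ a b w → b :* b :* (con (+ 9) :* w :* (a :* a)) :+ con (+ 9) :* (a :* a) :* (w :* (b :* b))
                 := con (+ 2) :* (a :* b) :* (con (+ 9) :* w :* (a :* b))) refl a b w ⟩
          + 2 * (a * b) * (+ 9 * w * (a * b)) ∎
        conclude : ∀ c → a * b ≡ c → 0ℤ ≤ c → + 3 * (M * X) ≤ + 9 * w * (a * b)
        conclude (+ suc c) ab≡ _ =
          *-cancelˡ-≤-pos (+ 3 * (M * X)) (+ 9 * w * (a * b)) (+ 2 * (a * b))
            {{subst (λ z → Positive (+ 2 * z)) (sym ab≡) _}} scaled
        conclude (+ zero) ab≡0 _ = begin
          + 3 * (M * X)        ≤⟨ *-monoˡ-≤-nonNeg (+ 3) (*-monoˡ-≤-nonNeg M {{nonNegative 0≤M}} X≤ab) ⟩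
          + 3 * (M * (a * b))  ≡⟨ trans (cong (λ z → + 3 * (M * z)) ab≡0) (cong (+ 3 *_) (*-zeroʳ M)) ⟩
          0ℤ                   ≡⟨ trans (cong (+ 9 * w *_) ab≡0) (*-zeroʳ (+ 9 * w)) ⟨
          + 9 * w * (a * b)    ∎

      fourth-≤ : M * (A₄ + + 6 * X + B₄) ≤ + 9 * w * ((a + b) * (a + b))
      fourth-≤ = begin
        M * (A₄ + + 6 * X + B₄)
          ≡⟨ solve 4 (λ M A X B → M :* (A :+ con (+ 6) :* X :+ B) := M :* A :+ con (+ 2) :* (con (+ 3) :* (M :* X)) :+ M :* B) refl M A₄ X B₄ ⟩
        M * A₄ + + 2 * (+ 3 * (M * X)) + M * B₄
          ≤⟨ +-mono-≤ (+-mono-≤ hA (*-monoˡ-≤-nonNeg (+ 2) mixed)) (≤-trans hB 9w) ⟩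
        + 9 * w * (a * a) + + 2 * (+ 9 * w * (a * b)) + + 9 * w * (b * b)
          ≡⟨ solve 3 (λ a b w → con (+ 9) :* w :* (a :* a) :+ con (+ 2) :* (con (+ 9) :* w :* (a :* b)) :+ con (+ 9) :* w :* (b :* b)
               := con (+ 9) :* w :* ((a :+ b) :* (a :+ b))) refl a b w ⟩
        + 9 * w * ((a + b) * (a + b)) ∎
        where
        9w : w * (b * b) ≤ + 9 * w * (b * b)
        9w = *-monoʳ-≤-nonNeg (b * b) {{nonNegative (square-nonNeg b)}}
               (subst (_≤ + 9 * w) (*-identityˡ w)
                 (*-monoʳ-≤-nonNeg w {{nonNegative 0≤w}} (+≤+ {1} {9} (ℕ.s≤s ℕ.z≤n))))

  -- Bonami's (2,4)-hypercontractive inequality for polynomials of degree at most d,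
  -- with both moments multiplied by 2 ^ m.
  hypercontractive : ∀ m d (g : Vec Sign m → ℤ) → Deg< (suc d) g →
    + (2 ℕ.^ m) * ∑± m (g ^² ^²) ≤ pow 9 d * (∑± m (g ^²) * ∑± m (g ^²))
  hypercontractive zero d g _ =
    *-monoʳ-≤-nonNeg (g [] * g [] * (g [] * g [])) {{nonNegative (square-nonNeg (g [] * g []))}}
      (+≤+ (ℕ.m^n>0 9 d))
  hypercontractive (suc m) d g (A , B , h , degA , degB) = begin
    + (2 ℕ.* 2 ℕ.^ m) * ∑± (suc m) (g ^² ^²)
      ≡⟨ cong₂ _*_ (pos-* 2 (2 ℕ.^ m)) (fourth-moment m g A B h) ⟩
    + 2 * M * (+ 2 * Q)
      ≡⟨ solve 2 (λ M Q → con (+ 2) :* M :* (con (+ 2) :* Q) := con (+ 4) :* (M :* Q)) refl M Q ⟩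
    + 4 * (M * Q)
      ≤⟨ *-monoˡ-≤-nonNeg (+ 4) (bound d degA degB) ⟩
    + 4 * (pow 9 d * ((a + b) * (a + b)))
      ≡⟨ solve 3 (λ w a b → con (+ 4) :* (w :* ((a :+ b) :* (a :+ b))) := w :* (con (+ 2) :* (a :+ b) :* (con (+ 2) :* (a :+ b)))) refl (pow 9 d) a b ⟩
    pow 9 d * (+ 2 * (a + b) * (+ 2 * (a + b)))
      ≡⟨ cong (λ z → pow 9 d * (z * z)) (second-moment m g A B h) ⟨
    pow 9 d * (∑± (suc m) (g ^²) * ∑± (suc m) (g ^²)) ∎
    where
    open ≤-Reasoning
    open +-*-Solver
    open FourthMoment m A B
    Q : ℤ
    Q = A₄ + + 6 * X + B₄
    bound : ∀ d → Deg< (suc d) A → Deg< d B → M * Q ≤ pow 9 d * ((a + b) * (a + b))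
    bound zero degA B≡0 = begin
      M * Q
        ≡⟨ cong (M *_) (cong₂ (λ x y → ∑± m (A ^² ^²) + + 6 * x + y)
             (vanish (λ σ → (A ^²) σ * (B ^²) σ) (λ σ → trans (cong (λ z → (A ^²) σ * (z * z)) (B≡0 σ)) (*-zeroʳ ((A ^²) σ))))
             (vanish (B ^² ^²) (λ σ → cong (λ z → z * z * (z * z)) (B≡0 σ)))) ⟩
      M * (∑± m (A ^² ^²) + 0ℤ + 0ℤ)
        ≡⟨ cong (M *_) (trans (+-identityʳ _) (+-identityʳ _)) ⟩
      M * ∑± m (A ^² ^²)
        ≤⟨ hypercontractive m zero A degA ⟩
      pow 9 0 * (a * a)
        ≡⟨ cong (λ z → pow 9 0 * (z * z)) (trans (cong (_+_ a) (vanish (B ^²) (λ σ → cong (λ z → z * z) (B≡0 σ)))) (+-identityʳ a)) ⟨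
      pow 9 0 * ((a + b) * (a + b)) ∎
      where
      vanish : ∀ f → (∀ σ → f σ ≡ 0ℤ) → ∑± m f ≡ 0ℤ
      vanish f f≡0 = trans (∑±-cong m f≡0) (∑±-0 m)
    bound (suc d) degA degB =
      subst (λ w → M * Q ≤ w * ((a + b) * (a + b))) (sym (pow-suc 9 d))
        (fourth-≤ (pow 9 d) (pow-nonNeg 9 d)
          (subst (λ w → M * A₄ ≤ w * (a * a)) (pow-suc 9 d) (hypercontractive m (suc d) A degA))
          (hypercontractive m d B degB))

  -- power r g is g ^ (2 ^ r).
  power : ℕ → (Vec Sign m → ℤ) → Vec Sign m → ℤ
  power zero    g = g
  power (suc r) g = power r g ^²

  deg-power : ∀ r d {m} {g : Vec Sign m → ℤ} → Deg< (suc d) g → Deg< (suc (2 ℕ.^ r ℕ.* d)) (power r g)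
  deg-power zero d deg = subst (λ k → Deg< (suc k) _) (sym (ℕ.*-identityˡ d)) deg
  deg-power (suc r) d {m} {g} deg =
    subst (λ k → Deg< (suc k) (power (suc r) g)) double (deg-* (2 ℕ.^ r ℕ.* d) (2 ℕ.^ r ℕ.* d) (deg-power r d deg) (deg-power r d deg))
    where
    double : 2 ℕ.^ r ℕ.* d ℕ.+ 2 ℕ.^ r ℕ.* d ≡ 2 ℕ.^ suc r ℕ.* d
    double = trans (sym (ℕ.*-distribʳ-+ d (2 ℕ.^ r) (2 ℕ.^ r)))
                   (cong (λ k → (2 ℕ.^ r ℕ.+ k) ℕ.* d) (sym (ℕ.+-identityʳ (2 ℕ.^ r))))

  -- The moment of order 2 ^ (r + 1) of a polynomial of degree at most d is bounded by
  -- momentConstant r ^ d times the 2 ^ r-th power of its second moment.  The step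
  -- from r to r + 1 applies the (2,4)-inequality to the 2 ^ r-th power of the
  -- polynomial, which has degree at most 2 ^ r * d.
  momentConstant : ℕ → ℕ
  momentConstant zero    = 1
  momentConstant (suc r) = 9 ℕ.^ (2 ℕ.^ r) ℕ.* (momentConstant r ℕ.* momentConstant r)

  moment-bound : ∀ m r d v (g : Vec Sign m → ℤ) → Deg< (suc d) g →
    ∑± m (g ^²) ≡ + (2 ℕ.^ m ℕ.* v) →
    ∑± m (power (suc r) g) ≤ + (momentConstant r ℕ.^ d ℕ.* (2 ℕ.^ m ℕ.* v ℕ.^ (2 ℕ.^ r)))
  moment-bound m zero d v g deg second =
    ≤-reflexive (trans second (cong +_ (sym (trans (cong (ℕ._* (2 ℕ.^ m ℕ.* (v ℕ.* 1))) (ℕ.^-zeroˡ d))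
      (trans (ℕ.*-identityˡ _) (cong (2 ℕ.^ m ℕ.*_) (ℕ.*-identityʳ v)))))))
  moment-bound m (suc r) d v g deg second =
    *-cancelˡ-≤-pos _ _ (+ (2 ℕ.^ m)) {{positive (ℤ.+<+ (ℕ.m^n>0 2 m))}} (begin
      + (2 ℕ.^ m) * ∑± m (power r g ^² ^²)
        ≤⟨ hypercontractive m (2 ℕ.^ r ℕ.* d) (power r g) (deg-power r d deg) ⟩
      pow 9 (2 ℕ.^ r ℕ.* d) * (∑± m (power (suc r) g) * ∑± m (power (suc r) g))
        ≤⟨ *-monoˡ-≤-nonNeg (pow 9 (2 ℕ.^ r ℕ.* d)) (*-mono-≤ S≥0 (+≤+ ℕ.z≤n) IH IH) ⟩
      pow 9 (2 ℕ.^ r ℕ.* d) * (+ U * + U)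
        ≡⟨ trans (cong (pow 9 (2 ℕ.^ r ℕ.* d) *_) (sym (pos-* U U))) (sym (pos-* (9 ℕ.^ (2 ℕ.^ r ℕ.* d)) (U ℕ.* U))) ⟩
      + (9 ℕ.^ (2 ℕ.^ r ℕ.* d) ℕ.* (U ℕ.* U))
        ≡⟨ cong +_ arithmetic ⟩
      + (2 ℕ.^ m ℕ.* (momentConstant (suc r) ℕ.^ d ℕ.* (2 ℕ.^ m ℕ.* v ℕ.^ (2 ℕ.^ suc r))))
        ≡⟨ pos-* (2 ℕ.^ m) _ ⟩
      + (2 ℕ.^ m) * + (momentConstant (suc r) ℕ.^ d ℕ.* (2 ℕ.^ m ℕ.* v ℕ.^ (2 ℕ.^ suc r))) ∎)
    where
    open ≤-Reasoning
    U : ℕ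
    U = momentConstant r ℕ.^ d ℕ.* (2 ℕ.^ m ℕ.* v ℕ.^ (2 ℕ.^ r))
    IH : ∑± m (power (suc r) g) ≤ + U
    IH = moment-bound m r d v g deg second
    S≥0 : 0ℤ ≤ ∑± m (power (suc r) g)
    S≥0 = ∑±-nonNeg m (λ σ → square-nonNeg (power r g σ))
    regroup : ∀ w k M x → w ℕ.* ((k ℕ.* (M ℕ.* x)) ℕ.* (k ℕ.* (M ℕ.* x))) ≡ M ℕ.* ((w ℕ.* (k ℕ.* k)) ℕ.* (M ℕ.* (x ℕ.* x)))
    regroup = NS.solve 4 (λ w k M x → w NS.:* ((k NS.:* (M NS.:* x)) NS.:* (k NS.:* (M NS.:* x)))
                         NS.:= M NS.:* ((w NS.:* (k NS.:* k)) NS.:* (M NS.:* (x NS.:* x)))) refl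
    arithmetic : 9 ℕ.^ (2 ℕ.^ r ℕ.* d) ℕ.* (U ℕ.* U) ≡
                 2 ℕ.^ m ℕ.* (momentConstant (suc r) ℕ.^ d ℕ.* (2 ℕ.^ m ℕ.* v ℕ.^ (2 ℕ.^ suc r)))
    arithmetic =
      trans (regroup (9 ℕ.^ (2 ℕ.^ r ℕ.* d)) (momentConstant r ℕ.^ d) (2 ℕ.^ m) (v ℕ.^ (2 ℕ.^ r)))
        (cong₂ (λ k x → 2 ℕ.^ m ℕ.* (k ℕ.* (2 ℕ.^ m ℕ.* x)))
          (trans (cong₂ ℕ._*_ (sym (ℕ.^-*-assoc 9 (2 ℕ.^ r) d)) (sym (^-distribʳ-* d (momentConstant r) (momentConstant r))))
                 (sym (^-distribʳ-* d (9 ℕ.^ (2 ℕ.^ r)) (momentConstant r ℕ.* momentConstant r))))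
          (trans (sym (ℕ.^-distribˡ-+-* v (2 ℕ.^ r) (2 ℕ.^ r))) (cong (λ k → v ℕ.^ (2 ℕ.^ r ℕ.+ k)) (sym (ℕ.+-identityʳ (2 ℕ.^ r))))))

  -- The number of sign vectors with a given property.
  count : ∀ m {P : Vec Sign m → Set} → (∀ σ → Dec (P σ)) → ℕ
  count zero P? with P? []
  ... | yes _ = 1
  ... | no  _ = 0
  count (suc m) P? = count m (λ σ → P? (Sign.+ ∷ σ)) ℕ.+ count m (λ σ → P? (Sign.- ∷ σ))

  -- Markov's inequality.
  count-* : ∀ m {P : Vec Sign m → Set} (P? : ∀ σ → Dec (P σ)) T {g : Vec Sign m → ℤ} →
            (∀ σ → 0ℤ ≤ g σ) → (∀ σ → P σ → + T ≤ g σ) → + (count m P? ℕ.* T) ≤ ∑± m g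
  count-* zero P? T g≥0 T≤g with P? []
  ... | yes p = ≤-trans (≤-reflexive (cong +_ (ℕ.*-identityˡ T))) (T≤g [] p)
  ... | no  _ = g≥0 []
  count-* (suc m) P? T {g} g≥0 T≤g = begin
    + ((a ℕ.+ b) ℕ.* T)            ≡⟨ cong +_ (ℕ.*-distribʳ-+ T a b) ⟩
    + (a ℕ.* T ℕ.+ b ℕ.* T)        ≡⟨ pos-+ (a ℕ.* T) (b ℕ.* T) ⟩
    + (a ℕ.* T) + + (b ℕ.* T)      ≤⟨ +-mono-≤ (count-* m _ T (λ σ → g≥0 (Sign.+ ∷ σ)) (λ σ → T≤g (Sign.+ ∷ σ)))
                                               (count-* m _ T (λ σ → g≥0 (Sign.- ∷ σ)) (λ σ → T≤g (Sign.- ∷ σ))) ⟩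
    ∑± (suc m) g                   ∎
    where
    open ≤-Reasoning
    a b : ℕ
    a = count m (λ σ → P? (Sign.+ ∷ σ))
    b = count m (λ σ → P? (Sign.- ∷ σ))

  power-abs : ∀ r (g : Vec Sign m → ℤ) σ → power (suc r) g σ ≡ + (∣ g σ ∣ ℕ.^ (2 ℕ.^ suc r))
  power-abs r g σ = begin
    power r g σ * power r g σ                                    ≡⟨ 0≤i⇒+∣i∣≡i (square-nonNeg (power r g σ)) ⟨
    + ∣ power r g σ * power r g σ ∣                              ≡⟨ cong +_ (abs-* (power r g σ) (power r g σ)) ⟩
    + (∣ power r g σ ∣ ℕ.* ∣ power r g σ ∣)                      ≡⟨ cong (λ k → + (k ℕ.* k)) (abs-power r) ⟩
    + (∣ g σ ∣ ℕ.^ (2 ℕ.^ r) ℕ.* ∣ g σ ∣ ℕ.^ (2 ℕ.^ r))          ≡⟨ cong +_ (double r) ⟩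
    + (∣ g σ ∣ ℕ.^ (2 ℕ.^ suc r))                                ∎
    where
    open ≡-Reasoning
    double : ∀ r → ∣ g σ ∣ ℕ.^ (2 ℕ.^ r) ℕ.* ∣ g σ ∣ ℕ.^ (2 ℕ.^ r) ≡ ∣ g σ ∣ ℕ.^ (2 ℕ.^ suc r)
    double r = trans (sym (ℕ.^-distribˡ-+-* ∣ g σ ∣ (2 ℕ.^ r) (2 ℕ.^ r)))
                     (cong (λ k → ∣ g σ ∣ ℕ.^ (2 ℕ.^ r ℕ.+ k)) (sym (ℕ.+-identityʳ (2 ℕ.^ r))))
    abs-power : ∀ r → ∣ power r g σ ∣ ≡ ∣ g σ ∣ ℕ.^ (2 ℕ.^ r)
    abs-power zero = sym (ℕ.^-identityʳ ∣ g σ ∣)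
    abs-power (suc r) = trans (abs-* (power r g σ) (power r g σ))
                              (trans (cong (λ k → k ℕ.* k) (abs-power r)) (double r))

-- Sums over products of distinct integers

module RestrictedProducts where

  open Hypercontractivity using (∑±; _^²; Deg<; deg-mono; second-moment; _·_)
  open import Data.Integer.Base as ℤ using (ℤ; +_; 0ℤ; 1ℤ; ∣_∣; _◃_)
  import Data.Integer.Properties as ℤ
  open import Data.List.Base using (List; []; _∷_; length)
  open import Data.List.Relation.Unary.All using (All; []; _∷_)
  open import Data.Nat.Base hiding (∣_-_∣)
  open import Data.Nat.Properties
  open import Data.Nat.DivMod using (_/_; 0/n≡0; m/n*n≤m; m*n/n≡m; /-monoˡ-≤)
  open import Data.Nat.Solver using (module +-*-Solver)
  open import Data.Product.Base using (_×_; _,_)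
  open import Data.Sign.Base as Sign using (Sign)
  open import Data.Sum.Base using (inj₁; inj₂)
  open import Data.Unit.Base using (tt)
  open import Data.Vec.Base using (Vec; []; _∷_)
  open import Relation.Binary.PropositionalEquality
  open import Relation.Nullary using (yes; no)

  -- Integer division, with value 0 for the divisor 0.
  infixl 7 _÷_
  _÷_ : ℕ → ℕ → ℕ
  n ÷ zero  = 0
  n ÷ suc p = n / suc p

  0÷ : ∀ p → 0 ÷ p ≡ 0
  0÷ zero = refl
  0÷ (suc p) = 0/n≡0 (suc p)

  ÷-mono : ∀ p {m n} → m ≤ n → m ÷ p ≤ n ÷ p
  ÷-mono zero    m≤n = z≤n
  ÷-mono (suc p) m≤n = /-monoˡ-≤ (suc p) m≤n

  ÷-* : ∀ n p → p * (n ÷ p) ≤ n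
  ÷-* n zero = z≤n
  ÷-* n (suc p) = subst (_≤ n) (*-comm (n / suc p) (suc p)) (m/n*n≤m n (suc p))

  *-≤-÷ : ∀ {n p k} → 1 ≤ p → p * k ≤ n → k ≤ n ÷ p
  *-≤-÷ {n} {suc p} {k} _ pk≤n =
    subst (_≤ n / suc p) (m*n/n≡m k (suc p)) (/-monoˡ-≤ (suc p) (subst (_≤ n) (*-comm (suc p) k) pk≤n))

  -- The sum, over the choices of distinct entries of ps with product at most N, of the
  -- product of the signs attached to the chosen entries.
  signSum : ∀ (ps : List ℕ) → ℕ → Vec Sign (length ps) → ℤ
  signSum []       zero    []      = 0ℤ
  signSum []       (suc N) []      = 1ℤ
  signSum (p ∷ ps) N       (s ∷ σ) = signSum ps N σ ℤ.+ s · signSum ps (N ÷ p) σ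

  -- The number of these choices.
  productCount : List ℕ → ℕ → ℕ
  productCount []       zero    = 0
  productCount []       (suc N) = 1
  productCount (p ∷ ps) N       = productCount ps N + productCount ps (N ÷ p)

  signSum-0 : ∀ ps (σ : Vec Sign (length ps)) → signSum ps 0 σ ≡ 0ℤ
  signSum-0 [] [] = refl
  signSum-0 (p ∷ ps) (s ∷ σ) rewrite 0÷ p | signSum-0 ps σ = trans (ℤ.+-identityˡ _) (ℤ.*-zeroʳ (s ◃ 1))

  ∣s·a∣ : ∀ s a → ∣ s · a ∣ ≡ ∣ a ∣
  ∣s·a∣ Sign.+ a = cong ∣_∣ (ℤ.*-identityˡ a)
  ∣s·a∣ Sign.- a = trans (cong ∣_∣ (ℤ.-1*i≡-i a)) (ℤ.∣-i∣≡∣i∣ a)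

  ∣signSum∣≤ : ∀ ps N (σ : Vec Sign (length ps)) → ∣ signSum ps N σ ∣ ≤ productCount ps N
  ∣signSum∣≤ [] zero [] = z≤n
  ∣signSum∣≤ [] (suc N) [] = ≤-refl
  ∣signSum∣≤ (p ∷ ps) N (s ∷ σ) =
    ≤-trans (ℤ.∣i+j∣≤∣i∣+∣j∣ (signSum ps N σ) _)
      (+-mono-≤ (∣signSum∣≤ ps N σ)
        (subst (_≤ _) (sym (∣s·a∣ s (signSum ps (N ÷ p) σ))) (∣signSum∣≤ ps (N ÷ p) σ)))

  signSum-second-moment : ∀ ps N →
    ∑± (length ps) (signSum ps N ^²) ≡ + (2 ^ length ps * productCount ps N)
  signSum-second-moment [] zero = refl
  signSum-second-moment [] (suc N) = refl
  signSum-second-moment (p ∷ ps) N = begin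
    ∑± (suc m) (signSum (p ∷ ps) N ^²)
      ≡⟨ second-moment m (signSum (p ∷ ps) N) (signSum ps N) (signSum ps (N ÷ p)) (λ s σ → refl) ⟩
    + 2 ℤ.* (∑± m (signSum ps N ^²) ℤ.+ ∑± m (signSum ps (N ÷ p) ^²))
      ≡⟨ cong (λ z → + 2 ℤ.* z) (cong₂ ℤ._+_ (signSum-second-moment ps N) (signSum-second-moment ps (N ÷ p))) ⟩
    + 2 ℤ.* (+ (2 ^ m * a) ℤ.+ + (2 ^ m * b))
      ≡⟨ cong (λ z → + 2 ℤ.* z) (ℤ.pos-+ (2 ^ m * a) (2 ^ m * b)) ⟨
    + 2 ℤ.* + (2 ^ m * a + 2 ^ m * b)
      ≡⟨ ℤ.pos-* 2 (2 ^ m * a + 2 ^ m * b) ⟨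
    + (2 * (2 ^ m * a + 2 ^ m * b))
      ≡⟨ cong +_ (solve 3 (λ M a b → con 2 :* (M :* a :+ M :* b) := con 2 :* M :* (a :+ b)) refl (2 ^ m) a b) ⟩
    + (2 * 2 ^ m * (a + b)) ∎
    where
    open ≡-Reasoning
    open +-*-Solver
    m a b : ℕ
    m = length ps
    a = productCount ps N
    b = productCount ps (N ÷ p)

  productCount-mono : ∀ ps {M N} → M ≤ N → productCount ps M ≤ productCount ps N
  productCount-mono [] {zero} _ = z≤n
  productCount-mono [] {suc M} {suc N} _ = ≤-refl
  productCount-mono (p ∷ ps) M≤N = +-mono-≤ (productCount-mono ps M≤N) (productCount-mono ps (÷-mono p M≤N))

  productCount-pos : ∀ ps {N} → 1 ≤ N → 1 ≤ productCount ps N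
  productCount-pos [] {suc N} _ = ≤-refl
  productCount-pos (p ∷ ps) 1≤N = ≤-trans (productCount-pos ps 1≤N) (m≤m+n _ _)

  productCount-≤ : ∀ ps N → productCount ps N ≤ 2 ^ length ps
  productCount-≤ [] zero = z≤n
  productCount-≤ [] (suc N) = ≤-refl
  productCount-≤ (p ∷ ps) N =
    ≤-trans (+-mono-≤ (productCount-≤ ps N) (productCount-≤ ps (N ÷ p)))
            (≤-reflexive (cong (_+_ (2 ^ length ps)) (sym (+-identityʳ _))))

  private
    +-tight : ∀ {a b c d} → a ≤ c → b ≤ d → a + b ≡ c + d → a ≡ c × b ≡ d
    +-tight {a} {b} {c} {d} a≤c b≤d e =
      ≤-antisym a≤c (+-cancelʳ-≤ b c a (≤-trans (+-monoʳ-≤ c b≤d) (≤-reflexive (sym e)))) ,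
      ≤-antisym b≤d (+-cancelˡ-≤ a d b (≤-trans (+-monoˡ-≤ d a≤c) (≤-reflexive (sym e))))

    signSum-cong-≤ : ∀ ps {M N} → M ≤ N → productCount ps M ≡ productCount ps N →
                     ∀ (σ : Vec Sign (length ps)) → signSum ps M σ ≡ signSum ps N σ
    signSum-cong-≤ [] {zero} {zero} _ _ [] = refl
    signSum-cong-≤ [] {suc M} {suc N} _ _ [] = refl
    signSum-cong-≤ (p ∷ ps) M≤N e (s ∷ σ) =
      let e₁ , e₂ = +-tight (productCount-mono ps M≤N) (productCount-mono ps (÷-mono p M≤N)) e
      in cong₂ (λ a b → a ℤ.+ s · b) (signSum-cong-≤ ps M≤N e₁ σ) (signSum-cong-≤ ps (÷-mono p M≤N) e₂ σ)

  -- As N grows, the sum changes only when the number of its terms does.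
  signSum-cong : ∀ ps M N → productCount ps M ≡ productCount ps N →
                 ∀ (σ : Vec Sign (length ps)) → signSum ps M σ ≡ signSum ps N σ
  signSum-cong ps M N e σ with ≤-total M N
  ... | inj₁ M≤N = signSum-cong-≤ ps M≤N e σ
  ... | inj₂ N≤M = sym (signSum-cong-≤ ps N≤M (sym e) σ)

  -- One more than the largest number of distinct entries of ps with product at
  -- most N, and 0 when N is 0.
  degreeBound : List ℕ → ℕ → ℕ
  degreeBound []       zero    = 0
  degreeBound (_ ∷ _)  zero    = 0
  degreeBound []       (suc N) = 1
  degreeBound (p ∷ ps) (suc N) = degreeBound ps (suc N) ⊔ suc (degreeBound ps (suc N ÷ p))

  degreeBound-0 : ∀ ps → degreeBound ps 0 ≡ 0
  degreeBound-0 [] = refl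
  degreeBound-0 (_ ∷ _) = refl

  degreeBound-pos : ∀ ps {N} → 1 ≤ N → 1 ≤ degreeBound ps N
  degreeBound-pos [] {suc N} _ = ≤-refl
  degreeBound-pos (p ∷ ps) {suc N} _ = ≤-trans (s≤s z≤n) (m≤n⊔m (degreeBound ps (suc N)) _)

  deg-signSum : ∀ ps N → Deg< (degreeBound ps N) (signSum ps N)
  deg-signSum ps zero = subst (λ d → Deg< d (signSum ps 0)) (sym (degreeBound-0 ps)) (signSum-0 ps)
  deg-signSum [] (suc N) = tt
  deg-signSum (p ∷ ps) (suc N) = deg _ (m≤m⊔n (degreeBound ps (suc N)) _) (m≤n⊔m (degreeBound ps (suc N)) _)
    where
    deg : ∀ d → degreeBound ps (suc N) ≤ d → suc (degreeBound ps (suc N ÷ p)) ≤ d →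
          Deg< d (signSum (p ∷ ps) (suc N))
    deg (suc d) a≤d (s≤s b≤d) =
      signSum ps (suc N) , signSum ps (suc N ÷ p) , (λ s σ → refl) ,
      deg-mono a≤d (deg-signSum ps (suc N)) , deg-mono b≤d (deg-signSum ps (suc N ÷ p))

  -- Strictly increasing lists with all entries at least a.
  data Ascending : ℕ → List ℕ → Set where
    []  : ∀ {a} → Ascending a []
    _∷_ : ∀ {a p ps} → a ≤ p → Ascending (suc p) ps → Ascending a (p ∷ ps)

  private
    ≤-power : ∀ t k → 1 ≤ t → t ≤ t ^ suc k
    ≤-power t k 1≤t = subst (_≤ t ^ suc k) (*-identityʳ t) (*-monoʳ-≤ t (m^n>0 t {{>-nonZero 1≤t}} k))

  -- Among distinct positive integers fewer than t are below t; each of the others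
  -- contributes a factor of at least t to their product.
  degreeBound-≤ : ∀ {ps a} t N → Ascending a ps → 1 ≤ t → 1 ≤ a → 1 ≤ N →
                  t ^ degreeBound ps N ≤ t ^ suc (t ∸ a) * N
  degreeBound-≤ {[]} {a} t N@(suc _) _ 1≤t _ 1≤N = *-mono-≤ (≤-power t (t ∸ a) 1≤t) 1≤N
  degreeBound-≤ {p ∷ ps} {a} t N@(suc _) (a≤p ∷ asc) 1≤t 1≤a 1≤N
    with ⊔-sel (degreeBound ps N) (suc (degreeBound ps (N ÷ p)))
  ... | inj₁ e rewrite e =
    ≤-trans (degreeBound-≤ t N asc 1≤t (s≤s z≤n) 1≤N)
      (*-monoˡ-≤ N (^-monoʳ-≤ t {{>-nonZero 1≤t}} (s≤s (∸-monoʳ-≤ t (≤-trans a≤p (n≤1+n p))))))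
  ... | inj₂ e rewrite e = taken (N ÷ p) refl
    where
    open ≤-Reasoning
    instance
      t≢0 : NonZero t
      t≢0 = >-nonZero 1≤t
    taken : ∀ M → N ÷ p ≡ M → t * t ^ degreeBound ps M ≤ t ^ suc (t ∸ a) * N
    taken zero _ rewrite degreeBound-0 ps =
      *-mono-≤ (≤-power t (t ∸ a) 1≤t) 1≤N
    taken M@(suc _) e′ with p <? t
    ... | yes p<t = begin
      t * t ^ degreeBound ps M              ≤⟨ *-monoʳ-≤ t (degreeBound-≤ t M asc 1≤t (s≤s z≤n) (s≤s z≤n)) ⟩
      t * (t ^ suc (t ∸ suc p) * M)         ≡⟨ cong (λ k → t * (t ^ k * M)) (sym (+-∸-assoc 1 p<t)) ⟩
      t * (t ^ (t ∸ p) * M)                 ≡⟨ *-assoc t (t ^ (t ∸ p)) M ⟨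
      t ^ suc (t ∸ p) * M                   ≤⟨ *-mono-≤ (^-monoʳ-≤ t (s≤s (∸-monoʳ-≤ t a≤p))) M≤N ⟩
      t ^ suc (t ∸ a) * N                   ∎
      where
      M≤N : M ≤ N
      M≤N = ≤-trans (m≤n*m M p {{>-nonZero (≤-trans 1≤a a≤p)}}) (subst (λ M → p * M ≤ N) e′ (÷-* N p))
    ... | no p≮t = begin
      t * t ^ degreeBound ps M              ≤⟨ *-monoʳ-≤ t (degreeBound-≤ t M asc 1≤t (s≤s z≤n) (s≤s z≤n)) ⟩
      t * (t ^ suc (t ∸ suc p) * M)         ≡⟨ cong (λ k → t * (t ^ suc k * M)) (m≤n⇒m∸n≡0 (≤-trans (≮⇒≥ p≮t) (n≤1+n p))) ⟩
      t * (t * 1 * M)                       ≡⟨ solve 2 (λ t M → t :* (t :* con 1 :* M) := t :* (t :* M)) refl t M ⟩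
      t * (t * M)                           ≤⟨ *-monoʳ-≤ t (*-monoˡ-≤ M (≮⇒≥ p≮t)) ⟩
      t * (p * M)                           ≤⟨ *-monoʳ-≤ t (subst (λ M → p * M ≤ N) e′ (÷-* N p)) ⟩
      t * N                                 ≤⟨ *-monoˡ-≤ N (≤-power t (t ∸ a) 1≤t) ⟩
      t ^ suc (t ∸ a) * N                   ∎
      where open +-*-Solver

  -- Cut ps into j blocks of g entries.  Every choice of one entry from each block
  -- has product at most Y ^ j.
  productCount-≥ : ∀ g j {Y} ps {N} → All (1 ≤_) ps → All (_≤ Y) ps → g * j ≤ length ps → Y ^ j ≤ N →
                   g ^ j ≤ productCount ps N
  productCount-≥ g zero ps _ _ _ 1≤N = productCount-pos ps 1≤N
  productCount-≥ g (suc j) {Y} ps {N} pos ≤Y len Y^j≤N =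
    block g ps pos ≤Y (subst (_≤ length ps) (*-suc g j) len)
    where
    block : ∀ i ps → All (1 ≤_) ps → All (_≤ Y) ps → i + g * j ≤ length ps → i * g ^ j ≤ productCount ps N
    block zero ps _ _ _ = z≤n
    block (suc i) (p ∷ ps) (1≤p ∷ pos) (p≤Y ∷ ≤Y) (s≤s len) =
      subst (_≤ productCount (p ∷ ps) N) (+-comm (i * g ^ j) (g ^ j))
        (+-mono-≤ (block i ps pos ≤Y len)
          (productCount-≥ g j ps pos ≤Y (≤-trans (m≤n+m (g * j) i) len)
            (*-≤-÷ 1≤p (≤-trans (*-monoˡ-≤ (Y ^ j) p≤Y) Y^j≤N))))

-- Primes and the lower bound of Chebyshev

module Chebyshev where

  open RestrictedProducts using (Ascending; []; _∷_)
  open import Data.List.Base using (List; []; _∷_; length; filter; upTo; applyUpTo)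
  open import Data.List.Membership.Propositional using (_∈_)
  open import Data.List.Membership.Propositional.Properties using (∈-filter⁺; ∈-filter⁻; ∈-upTo⁺; ∈-upTo⁻)
  open import Data.List.Properties using (length-filter; length-upTo)
  open import Data.List.Relation.Unary.All as All using (All; []; _∷_)
  open import Data.List.Relation.Unary.Any using (here; there)
  open import Data.Nat.Base
  open import Data.Nat.Combinatorics using (_C_; nCk+nC[k+1]≡[n+1]C[k+1]; k>n⇒nCk≡0; nC1≡n; nCk≡nC[n∸k]; nCn≡1)
  open import Data.Nat.Divisibility hiding (quotient)
  open import Data.Nat.Primality using (Prime; prime?; prime⇒nonTrivial)
  open import Data.Nat.Primality.Factorisation using (factorise)
  open import Data.Nat.Properties
  open import Data.Nat.Solver using (module +-*-Solver)
  open import Data.Product.Base using (∃; ∃₂; _×_; _,_; proj₁; proj₂)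
  open import Level using (0ℓ)
  open import Function.Base using (_∘_)
  open import Relation.Binary.PropositionalEquality
  open import Relation.Nullary using (¬_; yes; no; contradiction)
  open import Relation.Unary using (Pred; Decidable)

  nC0≡1 : ∀ n → n C 0 ≡ 1
  nC0≡1 n = trans (nCk≡nC[n∸k] {0} {n} z≤n) (nCn≡1 n)

  absorption : ∀ n k → suc n * (n C k) ≡ suc k * (suc n C suc k)
  absorption n zero = begin
    suc n * (n C 0)       ≡⟨ cong (suc n *_) (nC0≡1 n) ⟩
    suc n * 1             ≡⟨ *-comm (suc n) 1 ⟩
    1 * suc n             ≡⟨ cong (1 *_) (nC1≡n (suc n)) ⟨
    1 * (suc n C 1)       ∎
    where open ≡-Reasoning
  absorption zero (suc k) = begin
    1 * (0 C suc k)                    ≡⟨ cong (1 *_) (k>n⇒nCk≡0 {0} {suc k} (s≤s z≤n)) ⟩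
    0                                  ≡⟨ *-zeroʳ (suc (suc k)) ⟨
    suc (suc k) * 0                    ≡⟨ cong (suc (suc k) *_) (k>n⇒nCk≡0 {1} {suc (suc k)} (s≤s (s≤s z≤n))) ⟨
    suc (suc k) * (1 C suc (suc k))    ∎
    where open ≡-Reasoning
  absorption (suc n) (suc k) = begin
    suc (suc n) * (suc n C suc k)
      ≡⟨ cong (suc (suc n) *_) (nCk+nC[k+1]≡[n+1]C[k+1] n k) ⟨
    suc (suc n) * (P + Q)
      ≡⟨ solve 3 (λ n P Q → (con 1 :+ n) :* (P :+ Q) := P :+ Q :+ n :* P :+ n :* Q) refl (suc n) P Q ⟩
    P + Q + suc n * P + suc n * Q
      ≡⟨ cong₂ (λ x y → P + Q + x + y) (trans (absorption n k) (cong (suc k *_) (sym (nCk+nC[k+1]≡[n+1]C[k+1] n k)))) (absorption n (suc k)) ⟩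
    P + Q + suc k * (P + Q) + suc (suc k) * R
      ≡⟨ solve 3 (λ k x R → x :+ (con 1 :+ k) :* x :+ (con 1 :+ (con 1 :+ k)) :* R := (con 1 :+ (con 1 :+ k)) :* (x :+ R)) refl k (P + Q) R ⟩
    suc (suc k) * (P + Q + R)
      ≡⟨ cong (λ x → suc (suc k) * (x + R)) (nCk+nC[k+1]≡[n+1]C[k+1] n k) ⟩
    suc (suc k) * ((suc n C suc k) + R)
      ≡⟨ cong (suc (suc k) *_) (nCk+nC[k+1]≡[n+1]C[k+1] (suc n) (suc k)) ⟩
    suc (suc k) * (suc (suc n) C suc (suc k)) ∎
    where
    open ≡-Reasoning
    open +-*-Solver
    P Q R : ℕ
    P = n C k
    Q = n C suc k
    R = suc n C suc (suc k)

  -- The denominators of Leibniz's harmonic triangle divide every common multiple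
  -- of 1, ..., n + 1, because each entry is a difference of two earlier ones:
  -- 1 / (n C(n-1,k)) = 1 / ((n+1) C(n,k)) + 1 / ((n+1) C(n,k+1)).
  leibniz-∣ : ∀ k {n} D → k ≤ n → (∀ i → 1 ≤ i → i ≤ suc n → i ∣ D) → suc n * (n C k) ∣ D
  leibniz-∣ zero {n} D _ mult =
    subst (_∣ D) (sym (trans (cong (suc n *_) (nC0≡1 n)) (*-identityʳ (suc n)))) (mult (suc n) (s≤s z≤n) ≤-refl)
  leibniz-∣ (suc k) {suc n} D (s≤s k≤n) mult
    with leibniz-∣ k {suc n} D (≤-trans k≤n (n≤1+n n)) mult
       | leibniz-∣ k {n} D k≤n (λ i 1≤i i≤ → mult i 1≤i (≤-trans i≤ (n≤1+n (suc n))))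
  ... | divides a D≡au | divides b D≡bw = quotient (suc n * (n C k)) refl
    where
    open ≡-Reasoning
    open +-*-Solver
    α β : ℕ
    α = suc n C k
    β = suc n C suc k
    u≡ : suc (suc n) * α ≡ suc k * α + suc k * β
    u≡ = trans (absorption (suc n) k)
           (trans (cong (suc k *_) (sym (nCk+nC[k+1]≡[n+1]C[k+1] (suc n) k))) (*-distribˡ-+ (suc k) α β))
    w≡ : suc n * (n C k) ≡ suc k * β
    w≡ = absorption n k
    -- If w is 0 then so is D; otherwise w is cancelled at the end.
    quotient : ∀ w → suc n * (n C k) ≡ w → suc (suc n) * β ∣ D
    quotient zero w≡0 = subst (suc (suc n) * β ∣_) (sym (trans D≡bw (trans (cong (b *_) w≡0) (*-zeroʳ b)))) (_ ∣0)
    quotient w@(suc _) w≡w = divides (b ∸ a) (*-cancelʳ-≡ D ((b ∸ a) * (suc (suc n) * β)) w (sym (begin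
      (b ∸ a) * (suc (suc n) * β) * w
        ≡⟨ solve 3 (λ c z w → c :* z :* w := c :* w :* z) refl (b ∸ a) (suc (suc n) * β) w ⟩
      (b ∸ a) * w * (suc (suc n) * β)
        ≡⟨ cong (_* (suc (suc n) * β)) difference ⟩
      a * (suc k * α) * (suc (suc n) * β)
        ≡⟨ solve 5 (λ a k α n β → a :* (k :* α) :* (n :* β) := a :* (n :* α) :* (k :* β)) refl a (suc k) α (suc (suc n)) β ⟩
      a * (suc (suc n) * α) * (suc k * β)
        ≡⟨ cong₂ _*_ (sym D≡au) (trans (sym w≡) w≡w) ⟩
      D * w ∎)))
      where
      difference : (b ∸ a) * w ≡ a * (suc k * α)
      difference = begin
        (b ∸ a) * w
          ≡⟨ *-distribʳ-∸ w b a ⟩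
        b * w ∸ a * w
          ≡⟨ cong (_∸ a * w) (trans (cong (b *_) (sym w≡w)) (trans (sym D≡bw) (trans D≡au (cong (a *_) u≡)))) ⟩
        a * (suc k * α + suc k * β) ∸ a * w
          ≡⟨ cong (λ x → a * (suc k * α + x) ∸ a * w) (trans (sym w≡) w≡w) ⟩
        a * (suc k * α + w) ∸ a * w
          ≡⟨ cong (_∸ a * w) (*-distribˡ-+ a (suc k * α) w) ⟩
        a * (suc k * α) + a * w ∸ a * w
          ≡⟨ m+n∸n≡m (a * (suc k * α)) (a * w) ⟩
        a * (suc k * α) ∎

  -- The sum of n C k over k < l.
  rowSum : ℕ → ℕ → ℕ
  rowSum n zero    = 0
  rowSum n (suc l) = rowSum n l + n C l

  rowSum-suc : ∀ n l → rowSum (suc n) (suc l) ≡ rowSum n (suc l) + rowSum n l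
  rowSum-suc n zero = trans (nC0≡1 (suc n)) (sym (trans (+-identityʳ (n C 0)) (nC0≡1 n)))
  rowSum-suc n (suc l) = begin
    rowSum (suc n) (suc l) + suc n C suc l
      ≡⟨ cong₂ _+_ (rowSum-suc n l) (sym (nCk+nC[k+1]≡[n+1]C[k+1] n l)) ⟩
    rowSum n l + n C l + rowSum n l + (n C l + n C suc l)
      ≡⟨ solve 3 (λ x y z → x :+ y :+ x :+ (y :+ z) := x :+ y :+ z :+ (x :+ y)) refl (rowSum n l) (n C l) (n C suc l) ⟩
    rowSum n l + n C l + n C suc l + (rowSum n l + n C l) ∎
    where
    open ≡-Reasoning
    open +-*-Solver

  rowSum-full : ∀ n j → rowSum n (suc (n + j)) ≡ 2 ^ n
  rowSum-full zero zero = refl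
  rowSum-full zero (suc j) = cong₂ _+_ (rowSum-full zero j) (k>n⇒nCk≡0 {0} {suc j} (s≤s z≤n))
  rowSum-full (suc n) j = begin
    rowSum (suc n) (suc (suc (n + j)))                   ≡⟨ rowSum-suc n (suc (n + j)) ⟩
    rowSum n (suc (suc (n + j))) + rowSum n (suc (n + j)) ≡⟨ cong₂ _+_ (trans (cong (rowSum n ∘ suc) (sym (+-suc n j))) (rowSum-full n (suc j))) (rowSum-full n j) ⟩
    2 ^ n + 2 ^ n                                        ≡⟨ cong (2 ^ n +_) (+-identityʳ (2 ^ n)) ⟨
    2 ^ suc n                                            ∎
    where open ≡-Reasoning

  -- Nair's bound: every positive common multiple of 1, ..., n + 1 is at least 2 ^ n.
  commonMultiple-≥ : ∀ n D → 1 ≤ D → (∀ i → 1 ≤ i → i ≤ suc n → i ∣ D) → 2 ^ n ≤ D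
  commonMultiple-≥ n D 1≤D mult =
    *-cancelˡ-≤ (suc n) (subst (λ x → suc n * x ≤ suc n * D) (rowSum-full n 0)
      (subst (λ l → suc n * rowSum n (suc l) ≤ suc n * D) (sym (+-identityʳ n)) (partial (suc n) ≤-refl)))
    where
    open ≤-Reasoning
    partial : ∀ l → l ≤ suc n → suc n * rowSum n l ≤ l * D
    partial zero _ = ≤-reflexive (*-zeroʳ (suc n))
    partial (suc l) (s≤s l≤n) = begin
      suc n * (rowSum n l + n C l)          ≡⟨ *-distribˡ-+ (suc n) (rowSum n l) (n C l) ⟩
      suc n * rowSum n l + suc n * (n C l)  ≤⟨ +-mono-≤ (partial l (≤-trans l≤n (n≤1+n n))) (∣⇒≤ {{>-nonZero 1≤D}} (leibniz-∣ l D l≤n mult)) ⟩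
      l * D + D                             ≡⟨ +-comm (l * D) D ⟩
      suc l * D                             ∎

  n<p^n : ∀ {p} n → 2 ≤ p → n < p ^ n
  n<p^n zero _ = s≤s z≤n
  n<p^n {p} (suc n) 2≤p = begin-strict
    suc n        ≤⟨ n<p^n n 2≤p ⟩
    p ^ n        <⟨ m<m+n (p ^ n) (m^n>0 p {{>-nonZero (≤-trans (s≤s z≤n) 2≤p)}} n) ⟩
    p ^ n + p ^ n ≡⟨ cong (p ^ n +_) (+-identityʳ (p ^ n)) ⟨
    2 * p ^ n    ≤⟨ *-monoˡ-≤ (p ^ n) 2≤p ⟩
    p * p ^ n    ∎
    where open ≤-Reasoning

  -- A decidable predicate that holds at 0 and fails at l has a last success before a
  -- failure.
  switch : ∀ {P : Pred ℕ 0ℓ} → Decidable P → P 0 → ∀ l → ¬ P l → ∃ λ e → P e × ¬ P (suc e)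
  switch P? p₀ zero ¬p = contradiction p₀ ¬p
  switch P? p₀ (suc l) ¬p with P? l
  ... | yes p = l , p , ¬p
  ... | no ¬p′ = switch P? p₀ l ¬p′

  floorLog : ∀ {p} N → 2 ≤ p → 1 ≤ N → ∃ λ e → p ^ e ≤ N × N < p ^ suc e
  floorLog {p} N 2≤p 1≤N =
    let e , le , gt = switch (λ e → p ^ e ≤? N) 1≤N N (<⇒≱ (n<p^n N 2≤p)) in e , le , ≰⇒> gt

  ^-cancelʳ-≤ : ∀ {p} a b → 2 ≤ p → p ^ a ≤ p ^ b → a ≤ b
  ^-cancelʳ-≤ {p} a b 2≤p h with a ≤? b
  ... | yes a≤b = a≤b
  ... | no a≰b = contradiction h (<⇒≱ (^-monoʳ-< p 2≤p (≰⇒> a≰b)))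

  -- The factor p ^ a of i, split off by induction on a bound l for i.
  removePrime : ∀ {p} → 2 ≤ p → ∀ l i → 1 ≤ i → i ≤ l → ∃₂ λ a j → i ≡ p ^ a * j × ¬ p ∣ j
  removePrime {p} 2≤p zero i 1≤i i≤0 = contradiction (≤-trans 1≤i i≤0) λ ()
  removePrime {p} 2≤p (suc l) i 1≤i i≤l with p ∣? i
  ... | no p∤i = 0 , i , sym (+-identityʳ i) , p∤i
  ... | yes (divides zero i≡0) = contradiction (subst (1 ≤_) i≡0 1≤i) λ ()
  ... | yes (divides q@(suc _) i≡qp) =
    let a , j , e , p∤j = removePrime 2≤p l q (s≤s z≤n) (s≤s⁻¹ (≤-trans q<i i≤l))
    in suc a , j , trans i≡qp (trans (*-comm q p) (trans (cong (p *_) e) (sym (*-assoc p (p ^ a) j)))) , p∤j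
    where
    q<i : q < i
    q<i = subst (q <_) (sym i≡qp) (m<m*n q p 2≤p)

  2≤prime : ∀ {p} → Prime p → 2 ≤ p
  2≤prime {p} pr = nonTrivial⇒n>1 p {{prime⇒nonTrivial pr}}

  primeDivisor : ∀ {n} → 2 ≤ n → ∃ λ p → Prime p × p ∣ n
  primeDivisor {n} 2≤n with factorise n {{>-nonZero (≤-trans (s≤s z≤n) 2≤n)}}
  ... | record { factors = [] ; isFactorisation = e } = contradiction (subst (2 ≤_) e 2≤n) λ { (s≤s ()) }
  ... | record { factors = p ∷ ps ; isFactorisation = e ; factorsPrime = pr ∷ _ } =
    p , pr , subst (p ∣_) (sym e) (m∣m*n _)

  noPrimeDivisor : ∀ {n} → 1 ≤ n → (∀ p → Prime p → ¬ p ∣ n) → n ≡ 1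
  noPrimeDivisor {suc zero} _ _ = refl
  noPrimeDivisor {suc (suc n)} _ none =
    let p , pr , p∣n = primeDivisor (s≤s (s≤s z≤n)) in contradiction p∣n (none p pr)

  -- The product D, over the primes p in ps, of the largest power of p not exceeding Y.
  -- It is divisible by every i ≤ Y with all prime divisors in ps.
  powerProduct : ∀ {Y} ps → 1 ≤ Y → All Prime ps →
    ∃ λ D → 1 ≤ D × D ≤ Y ^ length ps ×
      (∀ i → 1 ≤ i → i ≤ Y → (∀ q → Prime q → q ∣ i → q ∈ ps) → i ∣ D)
  powerProduct [] 1≤Y [] =
    1 , ≤-refl , ≤-refl , λ i 1≤i _ ∈ps →
      ∣-reflexive (noPrimeDivisor 1≤i (λ q pr q∣i → contradiction (∈ps q pr q∣i) λ ()))
  powerProduct {Y} (p ∷ ps) 1≤Y (pr ∷ prs) =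
    let 2≤p = 2≤prime pr
        e , p^e≤Y , Y<p^1+e = floorLog Y 2≤p 1≤Y
        D , 1≤D , D≤ , mult = powerProduct ps 1≤Y prs
    in p ^ e * D ,
       *-mono-≤ (m^n>0 p {{>-nonZero (≤-trans (s≤s z≤n) 2≤p)}} e) 1≤D ,
       *-mono-≤ p^e≤Y D≤ ,
       λ i 1≤i i≤Y ∈ps →
         let a , j , i≡ , p∤j = removePrime 2≤p i i 1≤i ≤-refl
             j∣i = subst (j ∣_) (sym i≡) (n∣m*n (p ^ a))
             p^a∣i = subst (p ^ a ∣_) (sym i≡) (m∣m*n j)
             i≢0 = >-nonZero 1≤i
             1≤j = nonZero-factor {x = p ^ a} i≡ 1≤i
             a≤e = s≤s⁻¹ (≰⇒> (λ 1+e≤a → <⇒≱ Y<p^1+e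
                     (≤-trans (^-monoʳ-≤ p {{>-nonZero (≤-trans (s≤s z≤n) 2≤p)}} 1+e≤a)
                       (≤-trans (∣⇒≤ {{i≢0}} p^a∣i) i≤Y))))
         in subst (_∣ p ^ e * D) (sym i≡)
              (*-pres-∣ (power-∣ {a} {e} a≤e)
                (mult j 1≤j (≤-trans (∣⇒≤ {{i≢0}} j∣i) i≤Y)
                  (λ q prq q∣j → tail p∤j q∣j (∈ps q prq (∣-trans q∣j j∣i)))))
    where
    power-∣ : ∀ {a e} → a ≤ e → p ^ a ∣ p ^ e
    power-∣ {a} {e} a≤e =
      subst (p ^ a ∣_) (trans (sym (^-distribˡ-+-* p a (e ∸ a))) (cong (p ^_) (m+[n∸m]≡n a≤e))) (m∣m*n (p ^ (e ∸ a)))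
    nonZero-factor : ∀ {i x j} → i ≡ x * j → 1 ≤ i → 1 ≤ j
    nonZero-factor {j = suc j} _ _ = s≤s z≤n
    nonZero-factor {x = x} {zero} i≡ 1≤i = contradiction (subst (1 ≤_) (trans i≡ (*-zeroʳ x)) 1≤i) λ ()
    tail : ∀ {q j} → ¬ p ∣ j → q ∣ j → q ∈ p ∷ ps → q ∈ ps
    tail p∤j q∣j (here refl) = contradiction q∣j p∤j
    tail p∤j q∣j (there q∈) = q∈

  -- The primes up to Y, in increasing order.
  primesUpTo : ℕ → List ℕ
  primesUpTo Y = filter prime? (upTo (suc Y))

  ∈-primesUpTo⁺ : ∀ {p Y} → Prime p → p ≤ Y → p ∈ primesUpTo Y
  ∈-primesUpTo⁺ pr p≤Y = ∈-filter⁺ prime? (∈-upTo⁺ (s≤s p≤Y)) pr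

  ∈-primesUpTo⁻ : ∀ {p Y} → p ∈ primesUpTo Y → Prime p × p ≤ Y
  ∈-primesUpTo⁻ {p} {Y} p∈ =
    let p∈upTo , pr = ∈-filter⁻ prime? {xs = upTo (suc Y)} p∈ in pr , s≤s⁻¹ (∈-upTo⁻ p∈upTo)

  primesUpTo-prime : ∀ Y → All Prime (primesUpTo Y)
  primesUpTo-prime Y = All.tabulate (proj₁ ∘ ∈-primesUpTo⁻ {Y = Y})

  primesUpTo-≤ : ∀ Y → All (_≤ Y) (primesUpTo Y)
  primesUpTo-≤ Y = All.tabulate (proj₂ ∘ ∈-primesUpTo⁻ {Y = Y})

  primesUpTo-length : ∀ Y → length (primesUpTo Y) ≤ suc Y
  primesUpTo-length Y = ≤-trans (length-filter prime? (upTo (suc Y))) (≤-reflexive (length-upTo (suc Y)))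

  ascending-weaken : ∀ {a b ps} → a ≤ b → Ascending b ps → Ascending a ps
  ascending-weaken a≤b [] = []
  ascending-weaken a≤b (b≤p ∷ asc) = ≤-trans a≤b b≤p ∷ asc

  ascending-filter : ∀ {P : Pred ℕ 0ℓ} (P? : Decidable P) a n (f : ℕ → ℕ) → (∀ i → f i ≡ a + i) →
                     Ascending a (filter P? (applyUpTo f n))
  ascending-filter P? a zero f f≡ = []
  ascending-filter P? a (suc n) f f≡ with P? (f 0)
  ... | yes _ = ≤-reflexive (sym f0) ∷ subst (λ b → Ascending b (filter P? (applyUpTo (f ∘ suc) n))) (cong suc (sym f0)) rest
    where
    f0 : f 0 ≡ a
    f0 = trans (f≡ 0) (+-identityʳ a)
    rest : Ascending (suc a) (filter P? (applyUpTo (f ∘ suc) n))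
    rest = ascending-filter P? (suc a) n (f ∘ suc) (λ i → trans (f≡ (suc i)) (+-suc a i))
  ... | no _ = ascending-weaken (n≤1+n a)
    (ascending-filter P? (suc a) n (f ∘ suc) (λ i → trans (f≡ (suc i)) (+-suc a i)))

  primesUpTo-ascending : ∀ Y → Ascending 1 (primesUpTo Y)
  primesUpTo-ascending Y = ascending-filter prime? 1 Y suc (λ i → refl)

  -- Chebyshev's lower bound for the number of primes up to Y.
  chebyshev : ∀ Y → 1 ≤ Y → 2 ^ (Y ∸ 1) ≤ Y ^ length (primesUpTo Y)
  chebyshev Y@(suc n) 1≤Y =
    let D , 1≤D , D≤ , mult = powerProduct (primesUpTo Y) 1≤Y (primesUpTo-prime Y)
    in ≤-trans (commonMultiple-≥ n D 1≤D (λ i 1≤i i≤Y → mult i 1≤i i≤Y (λ q pr q∣i →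
         ∈-primesUpTo⁺ pr (≤-trans (∣⇒≤ {{>-nonZero 1≤i}} q∣i) i≤Y)))) D≤

-- The number of prime factors against the number of smooth integers

module Counting where

  open RestrictedProducts
  open Chebyshev
  open import Data.List.Base using (List; length)
  open import Data.List.Relation.Unary.All as All using (All)
  open import Data.Nat.Base
  open import Data.Nat.Properties
  open import Data.Nat.Solver using (module +-*-Solver)
  open import Data.Product.Base using (∃; _×_; _,_; proj₁; proj₂)
  open import Data.Sum.Base using (_⊎_; inj₁; inj₂)
  open import Relation.Binary.PropositionalEquality
  open import Relation.Nullary using (yes; no; contradiction)

  ^-cancelˡ-≤ : ∀ {a b} n .{{_ : NonZero n}} → a ^ n ≤ b ^ n → a ≤ b
  ^-cancelˡ-≤ {a} {b} n h with a ≤? b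
  ... | yes a≤b = a≤b
  ... | no a≰b = contradiction h (<⇒≱ (^-monoˡ-< n (≰⇒> a≰b)))

  fourthRoot : ∀ Y → ∃ λ s → s ^ 4 ≤ Y × Y < suc s ^ 4
  fourthRoot Y =
    let s , le , gt = switch (λ s → s ^ 4 ≤? Y) z≤n (suc Y) (<⇒≱ Y<) in s , le , ≰⇒> gt
    where
    Y< : Y < suc Y ^ 4
    Y< = subst (_≤ suc Y ^ 4) (^-identityʳ (suc Y)) (^-monoʳ-≤ (suc Y) {1} {4} (s≤s z≤n))

  -- K ^ d is the loss in the moment inequality for sums over integers with at most d
  -- prime factors.  It is to be compared with the number of terms of such a sum.
  module Admissible (K : ℕ) (1≤K : 1 ≤ K) where

    -- B is chosen for the bound d ≤ 9 j, and A for 4 ^ (Y + 1) ≤ (2 ^ (Y - 1)) ^ 6.  The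
    -- constants L and Y₀ serve to show that L ^ d ≤ L ^ L * N ≤ N * N.
    abstract
      B A L Y₀ : ℕ
      B  = K ^ 9
      A  = 6 * B
      L  = K ^ 32
      Y₀ = 625 + L ^ L

      B≡ : B ≡ K ^ 9
      B≡ = refl

      A≡ : A ≡ 6 * B
      A≡ = refl

      1≤A : 1 ≤ A
      1≤A = *-mono-≤ {1} {6} {1} {B} (s≤s z≤n) (m^n>0 K {{>-nonZero 1≤K}} 9)

      L≡ : L ≡ K ^ 32
      L≡ = refl

      625≤Y₀ : 625 ≤ Y₀
      625≤Y₀ = m≤m+n 625 (L ^ L)

      L^L≤Y₀ : L ^ L ≤ Y₀
      L^L≤Y₀ = m≤n+m (L ^ L) 625

    -- The condition on N and Y under which the degree is controlled: either
    -- log N is at most a small multiple of Y, or Y is N.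
    Condition : ℕ → ℕ → Set
    Condition N Y = N ^ A ≤ 4 ^ suc Y ⊎ Y ≡ N

    private
      instance
        K≢0 : NonZero K
        K≢0 = >-nonZero 1≤K

    module _ {N Y : ℕ} (Y≤N : Y ≤ N) (condition : Condition N Y) (Y₀≤Y : Y₀ ≤ Y) where

      private
        ps : List ℕ
        ps = primesUpTo Y

        m V : ℕ
        m = length ps
        V = productCount ps N

        625≤Y : 625 ≤ Y
        625≤Y = ≤-trans 625≤Y₀ Y₀≤Y

        1≤Y : 1 ≤ Y
        1≤Y = ≤-trans (s≤s z≤n) 625≤Y

        2≤Y : 2 ≤ Y
        2≤Y = ≤-trans (s≤s (s≤s z≤n)) 625≤Y

        1≤N : 1 ≤ N
        1≤N = ≤-trans 1≤Y Y≤N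

        instance
          Y≢0 : NonZero Y
          Y≢0 = >-nonZero 1≤Y

        positive : All (1 ≤_) ps
        positive = All.map (λ pr → ≤-trans (s≤s z≤n) (2≤prime pr)) (primesUpTo-prime Y)

        s : ℕ
        s = proj₁ (fourthRoot Y)

        s⁴≤Y : s ^ 4 ≤ Y
        s⁴≤Y = proj₁ (proj₂ (fourthRoot Y))

        Y<[s+1]⁴ : Y < suc s ^ 4
        Y<[s+1]⁴ = proj₂ (proj₂ (fourthRoot Y))

        5≤s : 5 ≤ s
        5≤s = s≤s⁻¹ (≰⇒> λ 1+s≤5 → <⇒≱ Y<[s+1]⁴ (≤-trans (^-monoˡ-≤ 4 1+s≤5) 625≤Y))

        instance
          s≢0 : NonZero s
          s≢0 = >-nonZero (≤-trans (s≤s z≤n) 5≤s)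

        -- By Chebyshev's bound there are at least about Y ^ (1/2) primes up to Y.
        s²≤m : s * s ≤ m
        s²≤m with s * s ≤? m
        ... | yes h = h
        ... | no h = contradiction exponents (<⇒≱ exponents-<)
          where
          open ≤-Reasoning
          exponents : s ^ 4 ∸ 1 ≤ s * 4 * m
          exponents = ^-cancelʳ-≤ (s ^ 4 ∸ 1) (s * 4 * m) ≤-refl (begin
            2 ^ (s ^ 4 ∸ 1)    ≤⟨ ^-monoʳ-≤ 2 (∸-monoˡ-≤ 1 s⁴≤Y) ⟩
            2 ^ (Y ∸ 1)        ≤⟨ chebyshev Y 1≤Y ⟩
            Y ^ m              ≤⟨ ^-monoˡ-≤ m (<⇒≤ Y<[s+1]⁴) ⟩
            (suc s ^ 4) ^ m    ≤⟨ ^-monoˡ-≤ m (^-monoˡ-≤ 4 (n<p^n s ≤-refl)) ⟩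
            ((2 ^ s) ^ 4) ^ m  ≡⟨ trans (cong (_^ m) (^-*-assoc 2 s 4)) (^-*-assoc 2 (s * 4) m) ⟩
            2 ^ (s * 4 * m)    ∎)
          exponents-< : s * 4 * m < s ^ 4 ∸ 1
          exponents-< = m+n≤o⇒m≤o∸n (suc (s * 4 * m)) (begin
            suc (s * 4 * m) + 1      ≡⟨ +-comm (suc (s * 4 * m)) 1 ⟩
            2 + s * 4 * m            ≤⟨ +-monoˡ-≤ (s * 4 * m) (*-mono-≤ {1} {s} {2} {4} (≤-trans (s≤s z≤n) 5≤s) (s≤s (s≤s z≤n))) ⟩
            s * 4 + s * 4 * m        ≡⟨ *-suc (s * 4) m ⟨
            s * 4 * suc m            ≤⟨ *-monoʳ-≤ (s * 4) (≰⇒> h) ⟩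
            s * 4 * (s * s)          ≤⟨ *-monoˡ-≤ (s * s) (*-monoʳ-≤ s (≤-trans (n≤1+n 4) 5≤s)) ⟩
            s * s * (s * s)          ≡⟨ solve 1 (λ s → s :* s :* (s :* s) := s :^ 4) refl s ⟩
            s ^ 4                    ∎)
            where open +-*-Solver

        s²≤V : s * s ≤ V
        s²≤V = ≤-trans s²≤m (subst (_≤ V) (^-identityʳ m)
          (productCount-≥ m 1 ps positive (primesUpTo-≤ Y) (≤-reflexive (*-identityʳ m))
            (≤-trans (≤-reflexive (^-identityʳ Y)) Y≤N)))

        Y≤s⁸ : Y ≤ (s * s) ^ 4
        Y≤s⁸ = ≤-trans (<⇒≤ Y<[s+1]⁴) (^-monoˡ-≤ 4 (≤-trans (+-monoˡ-≤ s (≤-trans (s≤s z≤n) 5≤s))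
          (≤-trans (≤-reflexive (cong (_+_ s) (sym (+-identityʳ s)))) (*-monoˡ-≤ s (≤-trans (s≤s (s≤s z≤n)) 5≤s)))))

        j : ℕ
        j = proj₁ (floorLog N 2≤Y 1≤N)

        Y^j≤N : Y ^ j ≤ N
        Y^j≤N = proj₁ (proj₂ (floorLog N 2≤Y 1≤N))

        N<Y^[j+1] : N < Y ^ suc j
        N<Y^[j+1] = proj₂ (proj₂ (floorLog N 2≤Y 1≤N))

        1≤j : 1 ≤ j
        1≤j = s≤s⁻¹ (≰⇒> λ 1+j≤1 → <⇒≱ N<Y^[j+1]
                (≤-trans (^-monoʳ-≤ Y 1+j≤1) (≤-trans (≤-reflexive (^-identityʳ Y)) Y≤N)))

      Y<productCount^4 : Y < suc (productCount (primesUpTo Y) N) ^ 4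
      Y<productCount^4 = ≤-trans (s≤s Y≤s⁸) (≤-trans (s≤s (^-monoˡ-≤ 4 s²≤V)) (^-monoˡ-< 4 (n<1+n V)))

      private
        -- The case Y < j ^ 4.  Among d distinct primes at least d - j exceed j, while
        -- their product is at most N < Y ^ (j + 1) ≤ j ^ (4 (j + 1)).
        small : ∀ d → degreeBound ps N ≡ suc d → s < j → K ^ d ≤ V
        small d deg s<j = begin
          K ^ d          ≤⟨ ^-monoʳ-≤ K d≤9j ⟩
          K ^ (9 * j)    ≡⟨ trans (cong (_^ j) B≡) (^-*-assoc K 9 j) ⟨
          B ^ j          ≤⟨ productCount-≥ B j ps positive (primesUpTo-≤ Y) Bj≤m Y^j≤N ⟩
          V              ∎
          where
          open ≤-Reasoning
          2≤j : 2 ≤ j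
          2≤j = ≤-trans (s≤s (s≤s z≤n)) (≤-trans 5≤s (<⇒≤ s<j))
          instance
            j≢0 : NonZero j
            j≢0 = >-nonZero 1≤j
          Y≤j⁴ : Y ≤ j ^ 4
          Y≤j⁴ = ≤-trans (<⇒≤ Y<[s+1]⁴) (^-monoˡ-≤ 4 s<j)
          exponent-≤ : suc d ≤ suc (j ∸ 1) + 4 * suc j
          exponent-≤ = ^-cancelʳ-≤ (suc d) (suc (j ∸ 1) + 4 * suc j) 2≤j (begin
            j ^ suc d                              ≡⟨ cong (j ^_) deg ⟨
            j ^ degreeBound ps N                   ≤⟨ degreeBound-≤ j N (primesUpTo-ascending Y) 1≤j ≤-refl 1≤N ⟩
            j ^ suc (j ∸ 1) * N                    ≤⟨ *-monoʳ-≤ (j ^ suc (j ∸ 1)) (<⇒≤ N<Y^[j+1]) ⟩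
            j ^ suc (j ∸ 1) * Y ^ suc j            ≤⟨ *-monoʳ-≤ (j ^ suc (j ∸ 1)) (^-monoˡ-≤ (suc j) Y≤j⁴) ⟩
            j ^ suc (j ∸ 1) * (j ^ 4) ^ suc j      ≡⟨ cong (j ^ suc (j ∸ 1) *_) (^-*-assoc j 4 (suc j)) ⟩
            j ^ suc (j ∸ 1) * j ^ (4 * suc j)      ≡⟨ ^-distribˡ-+-* j (suc (j ∸ 1)) (4 * suc j) ⟨
            j ^ (suc (j ∸ 1) + 4 * suc j)          ∎)
          d≤9j : d ≤ 9 * j
          d≤9j = ≤-trans (n≤1+n d) (≤-trans exponent-≤ (begin
            suc (j ∸ 1) + 4 * suc j    ≡⟨ cong (_+ 4 * suc j) (m+[n∸m]≡n 1≤j) ⟩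
            j + 4 * suc j              ≡⟨ solve 1 (λ j → j :+ con 4 :* (con 1 :+ j) := con 5 :* j :+ con 4 :* con 1) refl j ⟩
            5 * j + 4 * 1              ≤⟨ +-monoʳ-≤ (5 * j) (*-monoʳ-≤ 4 1≤j) ⟩
            5 * j + 4 * j              ≡⟨ *-distribʳ-+ j 5 4 ⟨
            9 * j                      ∎))
            where open +-*-Solver
          -- 2 Y + 2 is at most 6 (Y - 1).
          4^≤ : 4 ^ suc Y ≤ Y ^ (m * 6)
          4^≤ = begin
            4 ^ suc Y             ≡⟨ ^-*-assoc 2 2 (suc Y) ⟩
            2 ^ (2 * suc Y)       ≤⟨ ^-monoʳ-≤ 2 (linear Y 2≤Y) ⟩
            2 ^ ((Y ∸ 1) * 6)     ≡⟨ ^-*-assoc 2 (Y ∸ 1) 6 ⟨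
            (2 ^ (Y ∸ 1)) ^ 6     ≤⟨ ^-monoˡ-≤ 6 (chebyshev Y 1≤Y) ⟩
            (Y ^ m) ^ 6           ≡⟨ ^-*-assoc Y m 6 ⟩
            Y ^ (m * 6)           ∎
            where
            linear : ∀ Y → 2 ≤ Y → 2 * suc Y ≤ (Y ∸ 1) * 6
            linear (suc (suc n)) _ = begin
              2 * (3 + n)        ≤⟨ m≤m+n (2 * (3 + n)) (4 * n) ⟩
              2 * (3 + n) + 4 * n ≡⟨ solve 1 (λ n → con 2 :* (con 3 :+ n) :+ con 4 :* n := (con 1 :+ n) :* con 6) refl n ⟩
              (1 + n) * 6        ∎
              where open +-*-Solver
            linear (suc zero) (s≤s ())
          block-length : Condition N Y → B * j ≤ m
          block-length (inj₁ N^A≤) = *-cancelʳ-≤ (B * j) m 6 (subst (_≤ m * 6) rearrange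
            (^-cancelʳ-≤ (j * A) (m * 6) 2≤Y (begin
              Y ^ (j * A)        ≡⟨ ^-*-assoc Y j A ⟨
              (Y ^ j) ^ A        ≤⟨ ^-monoˡ-≤ A Y^j≤N ⟩
              N ^ A              ≤⟨ N^A≤ ⟩
              4 ^ suc Y          ≤⟨ 4^≤ ⟩
              Y ^ (m * 6)        ∎)))
            where
            rearrange : j * A ≡ B * j * 6
            rearrange = trans (cong (j *_) A≡) (solve 2 (λ j B → j :* (con 6 :* B) := B :* j :* con 6) refl j B)
              where open +-*-Solver
          block-length (inj₂ Y≡N) = contradiction
            (^-cancelʳ-≤ j 1 2≤Y (≤-trans Y^j≤N (≤-reflexive (trans (sym Y≡N) (sym (^-identityʳ Y))))))
            (<⇒≱ 2≤j)
          Bj≤m : B * j ≤ m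
          Bj≤m = block-length condition

        -- The case j ^ 4 ≤ Y.  With blocks of s primes, V ≥ s ^ j ≥ N ^ (1/16).
        large : ∀ d → degreeBound ps N ≡ suc d → j ≤ s → K ^ d ≤ V
        large d deg j≤s = ^-cancelˡ-≤ 32 (begin
          (K ^ d) ^ 32           ≡⟨ trans (^-*-assoc K d 32) (trans (cong (K ^_) (*-comm d 32)) (trans (sym (^-*-assoc K 32 d)) (cong (_^ d) (sym L≡)))) ⟩
          L ^ d                  ≤⟨ ^-monoʳ-≤ L (n≤1+n d) ⟩
          L ^ suc d              ≡⟨ cong (L ^_) deg ⟨
          L ^ degreeBound ps N   ≤⟨ degreeBound-≤ L N (primesUpTo-ascending Y) 1≤L ≤-refl 1≤N ⟩
          L ^ suc (L ∸ 1) * N    ≡⟨ cong (λ k → L ^ k * N) (m+[n∸m]≡n 1≤L) ⟩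
          L ^ L * N              ≤⟨ *-monoˡ-≤ N (≤-trans L^L≤Y₀ (≤-trans Y₀≤Y Y≤N)) ⟩
          N * N                  ≤⟨ *-mono-≤ N≤V¹⁶ N≤V¹⁶ ⟩
          V ^ 16 * V ^ 16        ≡⟨ ^-distribˡ-+-* V 16 16 ⟨
          V ^ 32                 ∎)
          where
          open ≤-Reasoning
          1≤L : 1 ≤ L
          1≤L = subst (1 ≤_) (sym L≡) (m^n>0 K 32)
          instance
            L≢0 : NonZero L
            L≢0 = >-nonZero 1≤L
          s^j≤V : s ^ j ≤ V
          s^j≤V = productCount-≥ s j ps positive (primesUpTo-≤ Y) (≤-trans (*-monoʳ-≤ s j≤s) s²≤m) Y^j≤N
          N≤V¹⁶ : N ≤ V ^ 16
          N≤V¹⁶ = begin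
            N                          ≤⟨ <⇒≤ N<Y^[j+1] ⟩
            Y ^ suc j                  ≤⟨ ^-monoʳ-≤ Y (+-monoˡ-≤ j 1≤j) ⟩
            Y ^ (j + j)                ≤⟨ ^-monoˡ-≤ (j + j) Y≤s⁸ ⟩
            ((s * s) ^ 4) ^ (j + j)    ≡⟨ cong (λ x → (x ^ 4) ^ (j + j)) (cong (s *_) (^-identityʳ s)) ⟨
            ((s ^ 2) ^ 4) ^ (j + j)    ≡⟨ trans (cong (_^ (j + j)) (^-*-assoc s 2 4)) (^-*-assoc s 8 (j + j)) ⟩
            s ^ (8 * (j + j))          ≡⟨ cong (s ^_) (solve 1 (λ j → con 8 :* (j :+ j) := j :* con 16) refl j) ⟩
            s ^ (j * 16)               ≡⟨ ^-*-assoc s j 16 ⟨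
            (s ^ j) ^ 16               ≤⟨ ^-monoˡ-≤ 16 s^j≤V ⟩
            V ^ 16                     ∎
            where open +-*-Solver

      K^degree≤ : ∃ λ d → degreeBound (primesUpTo Y) N ≡ suc d × K ^ d ≤ productCount (primesUpTo Y) N
      K^degree≤ with degreeBound ps N in deg | degreeBound-pos ps 1≤N
      ... | suc d | _ with suc s ≤? j
      ...   | yes s<j = d , refl , small d deg s<j
      ...   | no s≮j = d , refl , large d deg (≮⇒≥ s≮j)

-- Rational sums and Cauchy products

module RationalSeries where

  open import Data.Integer.Base as ℤ using (ℤ; +_)
  import Data.Integer.Properties as ℤ
  open import Data.Nat.Base as ℕ using (ℕ; zero; suc)
  import Data.Nat.Properties as ℕ
  open import Data.Product.Base using (∃; _,_)
  open import Data.Rational.Base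
  open import Data.Rational.Literals using (fromℤ)
  open import Data.Rational.Properties
  open import Data.Rational.Solver using (module +-*-Solver)
  open import Data.Sum.Base using (inj₁; inj₂)
  open import Relation.Binary.PropositionalEquality

  -- The embedding of the natural numbers.
  ι : ℕ → ℚ
  ι n = fromℤ (+ n)

  fromℤ-+ : ∀ i j → fromℤ (i ℤ.+ j) ≡ fromℤ i + fromℤ j
  fromℤ-+ i j = sym (trans (cong (λ k → k / 1) (cong₂ ℤ._+_ (ℤ.*-identityʳ i) (ℤ.*-identityʳ j)))
                           (↥p/↧p≡p (fromℤ (i ℤ.+ j))))

  fromℤ-* : ∀ i j → fromℤ (i ℤ.* j) ≡ fromℤ i * fromℤ j
  fromℤ-* i j = sym (↥p/↧p≡p (fromℤ (i ℤ.* j)))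

  ι-+ : ∀ m n → ι (m ℕ.+ n) ≡ ι m + ι n
  ι-+ m n = trans (cong fromℤ (ℤ.pos-+ m n)) (fromℤ-+ (+ m) (+ n))

  ι-* : ∀ m n → ι (m ℕ.* n) ≡ ι m * ι n
  ι-* m n = trans (cong fromℤ (ℤ.pos-* m n)) (fromℤ-* (+ m) (+ n))

  fromℤ-mono : ∀ {i j} → i ℤ.≤ j → fromℤ i ≤ fromℤ j
  fromℤ-mono {i} {j} i≤j = *≤* (subst₂ ℤ._≤_ (sym (ℤ.*-identityʳ i)) (sym (ℤ.*-identityʳ j)) i≤j)

  ι-mono : ∀ {m n} → m ℕ.≤ n → ι m ≤ ι n
  ι-mono m≤n = fromℤ-mono (ℤ.+≤+ m≤n)

  ι-cancel : ∀ {m n} → ι m ≤ ι n → m ℕ.≤ n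
  ι-cancel h = ℤ.drop‿+≤+ (subst₂ ℤ._≤_ (ℤ.*-identityʳ _) (ℤ.*-identityʳ _) (drop-*≤* h))

  0≤ι : ∀ n → 0ℚ ≤ ι n
  0≤ι n = ι-mono ℕ.z≤n

  archimedean : ∀ q → ∃ λ n → q ≤ ι n
  archimedean (mkℚ (+ n) d _) = n , *≤* (ℤ.*-monoˡ-≤-nonNeg (+ n) (ℤ.+≤+ (ℕ.s≤s ℕ.z≤n)))
  archimedean (mkℚ ℤ.-[1+ n ] d _) = 0 , *≤* ℤ.-≤+

  -- A natural number n with c ≤ n ε.
  archimedean-* : ∀ c {ε} → 0ℚ < ε → ∃ λ n → c ≤ ι n * ε
  archimedean-* c {ε} 0<ε =
    let n , h = archimedean (c * (1/ ε)) in n , (begin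
      c                   ≡⟨ *-identityʳ c ⟨
      c * 1ℚ              ≡⟨ cong (c *_) (*-inverseˡ ε) ⟨
      c * (1/ ε * ε)      ≡⟨ *-assoc c (1/ ε) ε ⟨
      c * 1/ ε * ε        ≤⟨ *-monoʳ-≤-nonNeg ε h ⟩
      ι n * ε             ∎)
    where
    open ≤-Reasoning
    instance
      ε-pos : Positive ε
      ε-pos = positive 0<ε
      ε≢0 : NonZero ε
      ε≢0 = pos⇒nonZero ε
      ε-nonNeg : NonNegative ε
      ε-nonNeg = pos⇒nonNeg ε

  p≤∣p∣ : ∀ p → p ≤ ∣ p ∣
  p≤∣p∣ (mkℚ (+ _) _ _) = ≤-refl
  p≤∣p∣ (mkℚ ℤ.-[1+ _ ] _ _) = *≤* ℤ.-≤+

  ∣p∣≤ : ∀ {p q} → p ≤ q → - p ≤ q → ∣ p ∣ ≤ q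
  ∣p∣≤ {p} p≤q -p≤q with ∣p∣≡p∨∣p∣≡-p p
  ... | inj₁ e = subst (_≤ _) (sym e) p≤q
  ... | inj₂ e = subst (_≤ _) (sym e) -p≤q

  p-q≤r⇒p≤q+r : ∀ {p q r} → p - q ≤ r → p ≤ q + r
  p-q≤r⇒p≤q+r {p} {q} h = subst (_≤ _) (solve 2 (λ p q → q :+ (p :- q) := p) refl p q) (+-monoʳ-≤ q h)
    where open +-*-Solver

  p≤q+r⇒p-q≤r : ∀ {p q r} → p ≤ q + r → p - q ≤ r
  p≤q+r⇒p-q≤r {p} {q} {r} h = subst (p - q ≤_) (solve 2 (λ q r → (q :+ r) :- q := r) refl q r) (+-monoˡ-≤ (- q) h)
    where open +-*-Solver

  -- Closeness of two rationals, as a pair of inequalities.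
  close⇒≤ : ∀ p q {ε} → ∣ p - q ∣ ≤ ε → p ≤ q + ε
  close⇒≤ p q h = p-q≤r⇒p≤q+r (≤-trans (p≤∣p∣ (p - q)) h)

  close-sym : ∀ p q → ∣ p - q ∣ ≡ ∣ q - p ∣
  close-sym p q = trans (sym (∣-p∣≡∣p∣ (p - q))) (cong ∣_∣ (solve 2 (λ p q → :- (p :- q) := q :- p) refl p q))
    where open +-*-Solver

  close⇒≥ : ∀ p q {ε} → ∣ p - q ∣ ≤ ε → q ≤ p + ε
  close⇒≥ p q h = close⇒≤ q p (subst (_≤ _) (close-sym p q) h)

  ≤⇒close : ∀ p q {ε} → p ≤ q + ε → q ≤ p + ε → ∣ p - q ∣ ≤ ε
  ≤⇒close p q p≤ q≤ =
    ∣p∣≤ (p≤q+r⇒p-q≤r p≤) (subst (_≤ _) (solve 2 (λ p q → q :- p := :- (p :- q)) refl p q) (p≤q+r⇒p-q≤r q≤))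
    where open +-*-Solver

  triangle : ∀ p q r → ∣ p - r ∣ ≤ ∣ p - q ∣ + ∣ q - r ∣
  triangle p q r =
    subst (λ z → ∣ z ∣ ≤ ∣ p - q ∣ + ∣ q - r ∣) (solve 3 (λ p q r → (p :- q) :+ (q :- r) := p :- r) refl p q r)
      (∣p+q∣≤∣p∣+∣q∣ (p - q) (q - r))
    where open +-*-Solver

  0≤p*q : ∀ {p q} → 0ℚ ≤ p → 0ℚ ≤ q → 0ℚ ≤ p * q
  0≤p*q {p} {q} 0≤p 0≤q = subst (_≤ p * q) (*-zeroʳ p) (*-monoˡ-≤-nonNeg p {{nonNegative 0≤p}} 0≤q)

  *-mono-≤ : ∀ {p q r s} → 0ℚ ≤ q → 0ℚ ≤ r → p ≤ q → r ≤ s → p * r ≤ q * s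
  *-mono-≤ {p} {q} {r} {s} 0≤q 0≤r p≤q r≤s =
    ≤-trans (*-monoʳ-≤-nonNeg r {{nonNegative 0≤r}} p≤q) (*-monoˡ-≤-nonNeg q {{nonNegative 0≤q}} r≤s)

  ∣p*q∣≤ : ∀ {p q r s} → ∣ p ∣ ≤ r → ∣ q ∣ ≤ s → ∣ p * q ∣ ≤ r * s
  ∣p*q∣≤ {p} {q} p≤r q≤s =
    subst (_≤ _) (sym (∣p*q∣≡∣p∣*∣q∣ p q)) (*-mono-≤ (≤-trans (0≤∣p∣ p) p≤r) (0≤∣p∣ q) p≤r q≤s)

  0≤p+q : ∀ {p q} → 0ℚ ≤ p → 0ℚ ≤ q → 0ℚ ≤ p + q
  0≤p+q = +-mono-≤ {0ℚ} {_} {0ℚ}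

  p≤p+q : ∀ p {q} → 0ℚ ≤ q → p ≤ p + q
  p≤p+q p 0≤q = subst (_≤ p + _) (+-identityʳ p) (+-monoʳ-≤ p 0≤q)

  0≤q-p : ∀ {p q} → p ≤ q → 0ℚ ≤ q - p
  0≤q-p {p} {q} p≤q = subst (_≤ q - p) (+-inverseʳ p) (+-monoˡ-≤ (- p) p≤q)

  half-pos : ∀ {ε} → 0ℚ < ε → 0ℚ < ½ * ε
  half-pos {ε} 0<ε = subst (_< ½ * ε) (*-zeroʳ ½) (*-monoʳ-<-pos ½ 0<ε)

  half+half : ∀ ε → ½ * ε + ½ * ε ≡ ε
  half+half ε = trans (sym (*-distribʳ-+ ε ½ ½)) (*-identityˡ ε)

  -- The sum of f k over k < n.
  Σ< : ℕ → (ℕ → ℚ) → ℚ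
  Σ< zero    f = 0ℚ
  Σ< (suc n) f = Σ< n f + f n

  Σ<-cong : ∀ n {f g} → (∀ k → f k ≡ g k) → Σ< n f ≡ Σ< n g
  Σ<-cong zero h = refl
  Σ<-cong (suc n) h = cong₂ _+_ (Σ<-cong n h) (h n)

  Σ<-shift : ∀ n f → Σ< (suc n) f ≡ f 0 + Σ< n (λ k → f (suc k))
  Σ<-shift zero f = +-comm 0ℚ (f 0)
  Σ<-shift (suc n) f = trans (cong (_+ f (suc n)) (Σ<-shift n f)) (+-assoc (f 0) _ (f (suc n)))

  -- If |f| ≤ g then the increments of the partial sums of f are dominated by those
  -- of g.
  Σ<-dominated : ∀ {f g} → (∀ k → ∣ f k ∣ ≤ g k) → ∀ n i →
                 ∣ Σ< (i ℕ.+ n) f - Σ< n f ∣ ≤ Σ< (i ℕ.+ n) g - Σ< n g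
  Σ<-dominated {f} {g} h n zero =
    ≤-reflexive (trans (cong ∣_∣ (+-inverseʳ (Σ< n f))) (sym (+-inverseʳ (Σ< n g))))
  Σ<-dominated {f} {g} h n (suc i) = begin
    ∣ F + f (i ℕ.+ n) - Σ< n f ∣
      ≡⟨ cong ∣_∣ (solve 3 (λ a b c → a :+ b :- c := (a :- c) :+ b) refl F (f (i ℕ.+ n)) (Σ< n f)) ⟩
    ∣ (F - Σ< n f) + f (i ℕ.+ n) ∣
      ≤⟨ ∣p+q∣≤∣p∣+∣q∣ (F - Σ< n f) (f (i ℕ.+ n)) ⟩
    ∣ F - Σ< n f ∣ + ∣ f (i ℕ.+ n) ∣
      ≤⟨ +-mono-≤ (Σ<-dominated h n i) (h (i ℕ.+ n)) ⟩
    G - Σ< n g + g (i ℕ.+ n)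
      ≡⟨ solve 3 (λ a b c → (a :- c) :+ b := a :+ b :- c) refl G (g (i ℕ.+ n)) (Σ< n g) ⟩
    G + g (i ℕ.+ n) - Σ< n g ∎
    where
    open ≤-Reasoning
    open +-*-Solver
    F G : ℚ
    F = Σ< (i ℕ.+ n) f
    G = Σ< (i ℕ.+ n) g

  -- The n-th coefficient of the Cauchy product.
  conv : (ℕ → ℚ) → (ℕ → ℚ) → ℕ → ℚ
  conv f g zero    = f 0 * g 0
  conv f g (suc n) = f 0 * g (suc n) + conv (λ k → f (suc k)) g n

  conv-congˡ : ∀ n {f f′} g → (∀ k → f k ≡ f′ k) → conv f g n ≡ conv f′ g n
  conv-congˡ zero g h = cong (_* g 0) (h 0)
  conv-congˡ (suc n) g h = cong₂ _+_ (cong (_* g (suc n)) (h 0)) (conv-congˡ n g (λ k → h (suc k)))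

  conv-congʳ : ∀ n f {g g′} → (∀ k → g k ≡ g′ k) → conv f g n ≡ conv f g′ n
  conv-congʳ zero f h = cong (f 0 *_) (h 0)
  conv-congʳ (suc n) f h = cong₂ _+_ (cong (f 0 *_) (h (suc n))) (conv-congʳ n (λ k → f (suc k)) h)

  conv-+ˡ : ∀ n f f′ g → conv (λ k → f k + f′ k) g n ≡ conv f g n + conv f′ g n
  conv-+ˡ zero f f′ g = *-distribʳ-+ (g 0) (f 0) (f′ 0)
  conv-+ˡ (suc n) f f′ g =
    trans (cong₂ _+_ (*-distribʳ-+ (g (suc n)) (f 0) (f′ 0)) (conv-+ˡ n _ _ g))
          (solve 4 (λ a b c d → (a :+ b) :+ (c :+ d) := (a :+ c) :+ (b :+ d)) refl
             (f 0 * g (suc n)) (f′ 0 * g (suc n)) _ _)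
    where open +-*-Solver

  conv-*ˡ : ∀ n c f g → conv (λ k → c * f k) g n ≡ c * conv f g n
  conv-*ˡ zero c f g = *-assoc c (f 0) (g 0)
  conv-*ˡ (suc n) c f g =
    trans (cong₂ _+_ (*-assoc c (f 0) (g (suc n))) (conv-*ˡ n c _ g)) (sym (*-distribˡ-+ c _ _))

  conv-*ʳ : ∀ n c f g → conv f (λ k → c * g k) n ≡ c * conv f g n
  conv-*ʳ zero c f g = solve 3 (λ c f g → f :* (c :* g) := c :* (f :* g)) refl c (f 0) (g 0)
    where open +-*-Solver
  conv-*ʳ (suc n) c f g =
    trans (cong₂ _+_ (solve 3 (λ c f g → f :* (c :* g) := c :* (f :* g)) refl c (f 0) (g (suc n))) (conv-*ʳ n c _ g))
          (sym (*-distribˡ-+ c _ _))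
    where open +-*-Solver

  conv-last : ∀ n f g → conv f g (suc n) ≡ conv f (λ k → g (suc k)) n + f (suc n) * g 0
  conv-last zero f g = refl
  conv-last (suc n) f g =
    trans (cong (_+_ (f 0 * g (suc (suc n)))) (conv-last n (λ k → f (suc k)) g)) (sym (+-assoc (f 0 * g (suc (suc n))) _ _))

  -- The product rule for the operator multiplying the k-th coefficient by k.
  conv-weight : ∀ n f g → ι n * conv f g n ≡ conv (λ k → ι k * f k) g n + conv f (λ k → ι k * g k) n
  conv-weight zero f g = solve 2 (λ x y → con 0ℚ :* (x :* y) := con 0ℚ :* x :* y :+ x :* (con 0ℚ :* y)) refl (f 0) (g 0)
    where open +-*-Solver
  conv-weight (suc n) f g = begin
    ι (suc n) * (a + conv f′ g n)
      ≡⟨ *-distribˡ-+ (ι (suc n)) a (conv f′ g n) ⟩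
    ι (suc n) * a + ι (suc n) * conv f′ g n
      ≡⟨ cong (λ z → ι (suc n) * a + z * conv f′ g n) (ι-+ 1 n) ⟩
    ι (suc n) * a + (1ℚ + ι n) * conv f′ g n
      ≡⟨ cong (λ z → ι (suc n) * a + z) (trans (*-distribʳ-+ (conv f′ g n) 1ℚ (ι n))
           (cong₂ _+_ (*-identityˡ (conv f′ g n)) (conv-weight n f′ g))) ⟩
    ι (suc n) * a + (conv f′ g n + (conv θf′ g n + conv f′ θg n))
      ≡⟨ solve 6 (λ i x y c p q → i :* (x :* y) :+ (c :+ (p :+ q)) := con 0ℚ :* x :* y :+ (c :+ p) :+ (x :* (i :* y) :+ q)) refl
           (ι (suc n)) (f 0) (g (suc n)) (conv f′ g n) (conv θf′ g n) (conv f′ θg n) ⟩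
    0ℚ * f 0 * g (suc n) + (conv f′ g n + conv θf′ g n) + (f 0 * (ι (suc n) * g (suc n)) + conv f′ θg n)
      ≡⟨ cong (λ z → 0ℚ * f 0 * g (suc n) + z + (f 0 * (ι (suc n) * g (suc n)) + conv f′ θg n))
           (trans (sym (conv-+ˡ n f′ θf′ g)) (conv-congˡ n g (λ k → sym (shifted k)))) ⟩
    0ℚ * f 0 * g (suc n) + conv (λ k → ι (suc k) * f (suc k)) g n + (f 0 * (ι (suc n) * g (suc n)) + conv f′ θg n) ∎
    where
    open ≡-Reasoning
    open +-*-Solver
    f′ θf′ θg : ℕ → ℚ
    f′ k = f (suc k)
    θf′ k = ι k * f′ k
    θg k = ι k * g k
    a : ℚ
    a = f 0 * g (suc n)
    shifted : ∀ k → ι (suc k) * f (suc k) ≡ f′ k + θf′ k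
    shifted k = trans (cong (_* f (suc k)) (ι-+ 1 k))
      (trans (*-distribʳ-+ (f (suc k)) 1ℚ (ι k)) (cong (_+ ι k * f (suc k)) (*-identityˡ (f (suc k)))))

  -- Partial sums of the Cauchy product against the product of partial sums.
  Σconv : (ℕ → ℚ) → (ℕ → ℚ) → ℕ → ℚ
  Σconv f g n = Σ< n (conv f g)

  Σconv-suc : ∀ n f g → Σconv f g (suc n) ≡ f 0 * Σ< (suc n) g + Σconv (λ k → f (suc k)) g n
  Σconv-suc zero f g = solve 2 (λ x y → con 0ℚ :+ x :* y := x :* (con 0ℚ :+ y) :+ con 0ℚ) refl (f 0) (g 0)
    where open +-*-Solver
  Σconv-suc (suc n) f g =
    trans (cong (_+ conv f g (suc n)) (Σconv-suc n f g))
          (solve 5 (λ x s y c d → x :* s :+ c :+ (x :* y :+ d) := x :* (s :+ y) :+ (c :+ d)) refl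
             (f 0) (Σ< (suc n) g) (g (suc n)) (Σconv (λ k → f (suc k)) g n) (conv (λ k → f (suc k)) g n))
    where open +-*-Solver

  -- For l ≤ n, the sum of f i * g k over i < l and k < n with i + k ≥ l.
  defect : (ℕ → ℚ) → (ℕ → ℚ) → ℕ → ℕ → ℚ
  defect f g l n = Σ< l f * Σ< n g - Σconv f g l

  defect-suc : ∀ f g l n → defect f g (suc l) n ≡ f 0 * (Σ< n g - Σ< (suc l) g) + defect (λ k → f (suc k)) g l n
  defect-suc f g l n =
    trans (cong₂ (λ x y → x * Σ< n g - y) (Σ<-shift l f) (Σconv-suc l f g))
          (solve 5 (λ x s t u c → (x :+ s) :* t :- (x :* u :+ c) := x :* (t :- u) :+ (s :* t :- c)) refl
             (f 0) (Σ< l (λ k → f (suc k))) (Σ< n g) (Σ< (suc l) g) (Σconv (λ k → f (suc k)) g l))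
    where open +-*-Solver

  defect-dominated : ∀ l i {f f′ g g′} → (∀ k → ∣ f k ∣ ≤ f′ k) → (∀ k → ∣ g k ∣ ≤ g′ k) →
                     ∣ defect f g l (i ℕ.+ l) ∣ ≤ defect f′ g′ l (i ℕ.+ l)
  defect-dominated zero i {f} {f′} {g} {g′} hf hg =
    ≤-reflexive (trans (cong ∣_∣ (zero-defect (Σ< (i ℕ.+ 0) g))) (sym (zero-defect (Σ< (i ℕ.+ 0) g′))))
    where
    open +-*-Solver
    zero-defect : ∀ x → 0ℚ * x - 0ℚ ≡ 0ℚ
    zero-defect = solve 1 (λ x → con 0ℚ :* x :- con 0ℚ := con 0ℚ) refl
  defect-dominated (suc l) i {f} {f′} {g} {g′} hf hg = begin
    ∣ defect f g (suc l) n ∣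
      ≡⟨ cong ∣_∣ (defect-suc f g l n) ⟩
    ∣ f 0 * (Σ< n g - Σ< (suc l) g) + defect (λ k → f (suc k)) g l n ∣
      ≤⟨ ∣p+q∣≤∣p∣+∣q∣ (f 0 * (Σ< n g - Σ< (suc l) g)) _ ⟩
    ∣ f 0 * (Σ< n g - Σ< (suc l) g) ∣ + ∣ defect (λ k → f (suc k)) g l n ∣
      ≤⟨ +-mono-≤ (∣p*q∣≤ {f 0} (hf 0) (Σ<-dominated hg (suc l) i))
           (subst (λ n → ∣ defect (λ k → f (suc k)) g l n ∣ ≤ defect (λ k → f′ (suc k)) g′ l n) (sym (ℕ.+-suc i l))
             (defect-dominated l (suc i) (λ k → hf (suc k)) hg)) ⟩
    f′ 0 * (Σ< n g′ - Σ< (suc l) g′) + defect (λ k → f′ (suc k)) g′ l n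
      ≡⟨ defect-suc f′ g′ l n ⟨
    defect f′ g′ (suc l) n ∎
    where
    open ≤-Reasoning
    n : ℕ
    n = i ℕ.+ suc l

  Σ<-mono : ∀ {g} → (∀ k → 0ℚ ≤ g k) → ∀ n i → Σ< n g ≤ Σ< (i ℕ.+ n) g
  Σ<-mono h n zero = ≤-refl
  Σ<-mono h n (suc i) = ≤-trans (Σ<-mono h n i) (p≤p+q _ (h (i ℕ.+ n)))

  conv-nonNeg : ∀ n {f g} → (∀ k → 0ℚ ≤ f k) → (∀ k → 0ℚ ≤ g k) → 0ℚ ≤ conv f g n
  conv-nonNeg zero hf hg = 0≤p*q (hf 0) (hg 0)
  conv-nonNeg (suc n) hf hg = 0≤p+q (0≤p*q (hf 0) (hg (suc n))) (conv-nonNeg n (λ k → hf (suc k)) hg)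

  product-≤-Σconv : ∀ l n {f g} → (∀ k → 0ℚ ≤ f k) → (∀ k → 0ℚ ≤ g k) → Σ< l f * Σ< n g ≤ Σconv f g (l ℕ.+ n)
  product-≤-Σconv zero n {f} {g} hf hg =
    subst (_≤ Σconv f g n) (sym (*-zeroˡ (Σ< n g)))
      (subst (λ k → 0ℚ ≤ Σconv f g k) (ℕ.+-identityʳ n) (Σ<-mono (λ k → conv-nonNeg k hf hg) 0 n))
  product-≤-Σconv (suc l) n {f} {g} hf hg = begin
    Σ< (suc l) f * Σ< n g
      ≡⟨ trans (cong (_* Σ< n g) (Σ<-shift l f)) (*-distribʳ-+ (Σ< n g) (f 0) _) ⟩
    f 0 * Σ< n g + Σ< l (λ k → f (suc k)) * Σ< n g
      ≤⟨ +-mono-≤ (*-monoˡ-≤-nonNeg (f 0) {{nonNegative (hf 0)}} (Σ<-mono hg n (suc l)))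
                  (product-≤-Σconv l n (λ k → hf (suc k)) hg) ⟩
    f 0 * Σ< (suc l ℕ.+ n) g + Σconv (λ k → f (suc k)) g (l ℕ.+ n)
      ≡⟨ Σconv-suc (l ℕ.+ n) f g ⟨
    Σconv f g (suc l ℕ.+ n) ∎
    where open ≤-Reasoning

-- Partial sums of the exponential series

module ExponentialSums where

  open RationalSeries
  open import Data.Integer.Base using (+_)
  open import Data.Nat.Base as ℕ using (ℕ; zero; suc; _!)
  import Data.Nat.Properties as ℕ
  open import Data.Product.Base using (∃; _×_; _,_)
  open import Data.Rational.Base
  open import Data.Rational.Properties
  open import Data.Rational.Solver using (module +-*-Solver)
  open import Data.Sum.Base using (inj₁; inj₂)
  open import Relation.Binary.PropositionalEquality

  infixr 8 _^ℚ_
  _^ℚ_ : ℚ → ℕ → ℚ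
  q ^ℚ zero  = 1ℚ
  q ^ℚ suc k = q * q ^ℚ k

  1/! : ℕ → ℚ
  1/! k = (+ 1 / (k !)) {{k ℕ.!≢0}}

  -- The terms and the partial sums of the exponential series.
  term : ℚ → ℕ → ℚ
  term q k = q ^ℚ k * 1/! k

  expSum : ℕ → ℚ → ℚ
  expSum n q = Σ< n (term q)

  private
    1/-ι : ∀ n .{{_ : ℕ.NonZero n}} → ι n * (+ 1 / n) ≡ 1ℚ
    1/-ι (suc n) = trans (cong (ι (suc n) *_) (↥p/↧p≡p (1/ ι (suc n)))) (*-inverseʳ (ι (suc n)))

  1/!-suc : ∀ k → ι (suc k) * 1/! (suc k) ≡ 1/! k
  1/!-suc k = begin
    ι (suc k) * 1/! (suc k)                            ≡⟨ *-identityʳ _ ⟨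
    ι (suc k) * 1/! (suc k) * 1ℚ                       ≡⟨ cong (ι (suc k) * 1/! (suc k) *_) (1/-ι (k !) {{k ℕ.!≢0}}) ⟨
    ι (suc k) * 1/! (suc k) * (ι (k !) * 1/! k)        ≡⟨ solve 4 (λ a b c d → a :* b :* (c :* d) := a :* c :* b :* d) refl (ι (suc k)) (1/! (suc k)) (ι (k !)) (1/! k) ⟩
    ι (suc k) * ι (k !) * 1/! (suc k) * 1/! k          ≡⟨ cong (λ z → z * 1/! (suc k) * 1/! k) (ι-* (suc k) (k !)) ⟨
    ι (suc k !) * 1/! (suc k) * 1/! k                  ≡⟨ cong (_* 1/! k) (1/-ι (suc k !) {{suc k ℕ.!≢0}}) ⟩
    1ℚ * 1/! k                                         ≡⟨ *-identityˡ (1/! k) ⟩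
    1/! k                                              ∎
    where
    open ≡-Reasoning
    open +-*-Solver

  term-suc : ∀ q k → ι (suc k) * term q (suc k) ≡ q * term q k
  term-suc q k = begin
    ι (suc k) * (q * q ^ℚ k * 1/! (suc k))    ≡⟨ solve 4 (λ i q p r → i :* (q :* p :* r) := q :* (p :* (i :* r))) refl (ι (suc k)) q (q ^ℚ k) (1/! (suc k)) ⟩
    q * (q ^ℚ k * (ι (suc k) * 1/! (suc k)))  ≡⟨ cong (λ z → q * (q ^ℚ k * z)) (1/!-suc k) ⟩
    q * (q ^ℚ k * 1/! k)                      ∎
    where
    open ≡-Reasoning
    open +-*-Solver

  ι-cancelˡ : ∀ k {p q} → ι (suc k) * p ≡ ι (suc k) * q → p ≡ q
  ι-cancelˡ k h = ≤-antisym (*-cancelˡ-≤-pos (ι (suc k)) (≤-reflexive h)) (*-cancelˡ-≤-pos (ι (suc k)) (≤-reflexive (sym h)))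

  -- The binomial theorem: both sides satisfy (n + 1) c (n + 1) = (a + b) c n.
  conv-term : ∀ n a b → conv (term a) (term b) n ≡ term (a + b) n
  conv-term zero a b = refl
  conv-term (suc n) a b = ι-cancelˡ n (begin
    ι (suc n) * conv (term a) (term b) (suc n)
      ≡⟨ conv-weight (suc n) (term a) (term b) ⟩
    conv (λ k → ι k * term a k) (term b) (suc n) + conv (term a) (λ k → ι k * term b k) (suc n)
      ≡⟨ cong₂ _+_
           (trans (cong₂ _+_ (zero-term a b) (trans (conv-congˡ n (term b) (term-suc a)) (conv-*ˡ n a (term a) (term b))))
                  (+-identityˡ (a * conv (term a) (term b) n)))
           (trans (conv-last n (term a) (λ k → ι k * term b k))
             (trans (cong₂ _+_ (trans (conv-congʳ n (term a) (term-suc b)) (conv-*ʳ n b (term a) (term b)))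
                               (zero-last (term a (suc n)) (term b 0)))
                    (+-identityʳ (b * conv (term a) (term b) n)))) ⟩
    a * conv (term a) (term b) n + b * conv (term a) (term b) n
      ≡⟨ *-distribʳ-+ (conv (term a) (term b) n) a b ⟨
    (a + b) * conv (term a) (term b) n
      ≡⟨ cong ((a + b) *_) (conv-term n a b) ⟩
    (a + b) * term (a + b) n
      ≡⟨ term-suc (a + b) n ⟨
    ι (suc n) * term (a + b) (suc n) ∎)
    where
    open ≡-Reasoning
    zero-term : ∀ a b → ι 0 * term a 0 * term b (suc n) ≡ 0ℚ
    zero-term a b = trans (cong (_* term b (suc n)) (*-zeroˡ (term a 0))) (*-zeroˡ (term b (suc n)))
    zero-last : ∀ x y → x * (ι 0 * y) ≡ 0ℚ
    zero-last x y = trans (cong (x *_) (*-zeroˡ y)) (*-zeroʳ x)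

  ^ℚ-nonNeg : ∀ {q} → 0ℚ ≤ q → ∀ k → 0ℚ ≤ q ^ℚ k
  ^ℚ-nonNeg 0≤q zero = nonNegative⁻¹ 1ℚ
  ^ℚ-nonNeg 0≤q (suc k) = 0≤p*q 0≤q (^ℚ-nonNeg 0≤q k)

  1/!-nonNeg : ∀ k → 0ℚ ≤ 1/! k
  1/!-nonNeg k = nonNegative⁻¹ (1/! k) {{normalize-nonNeg 1 (k !) {{k ℕ.!≢0}}}}

  ∣^ℚ∣ : ∀ {q r} → ∣ q ∣ ≤ r → ∀ k → ∣ q ^ℚ k ∣ ≤ r ^ℚ k
  ∣^ℚ∣ h zero = ≤-refl
  ∣^ℚ∣ {q} h (suc k) = ∣p*q∣≤ {q} h (∣^ℚ∣ h k)

  term-nonNeg : ∀ {q} → 0ℚ ≤ q → ∀ k → 0ℚ ≤ term q k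
  term-nonNeg 0≤q k = 0≤p*q (^ℚ-nonNeg 0≤q k) (1/!-nonNeg k)

  ∣term∣≤ : ∀ {q r} → ∣ q ∣ ≤ r → ∀ k → ∣ term q k ∣ ≤ term r k
  ∣term∣≤ {q} h k = ∣p*q∣≤ {q ^ℚ k} (∣^ℚ∣ h k) (≤-reflexive (0≤p⇒∣p∣≡p (1/!-nonNeg k)))

  expSum-increment : ∀ {q r} → ∣ q ∣ ≤ r → ∀ n i →
    ∣ expSum (i ℕ.+ n) q - expSum n q ∣ ≤ expSum (i ℕ.+ n) r - expSum n r
  expSum-increment h = Σ<-dominated (∣term∣≤ h)

  expSum-mono : ∀ {r} → 0ℚ ≤ r → ∀ n i → expSum n r ≤ expSum (i ℕ.+ n) r
  expSum-mono 0≤r = Σ<-mono (term-nonNeg 0≤r)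

  expSum-nonNeg : ∀ {r} → 0ℚ ≤ r → ∀ n → 0ℚ ≤ expSum n r
  expSum-nonNeg 0≤r n = subst (λ k → 0ℚ ≤ expSum k _) (ℕ.+-identityʳ n) (expSum-mono 0≤r 0 n)

  -- Past index 2 M the terms at M at least halve at each step.
  term-halves : ∀ M .{{_ : ℕ.NonZero M}} k → 2 ℕ.* M ℕ.≤ suc k → ι 2 * term (ι M) (suc k) ≤ term (ι M) k
  term-halves M@(suc _) k h = *-cancelˡ-≤-pos (ι M) (begin
    ι M * (ι 2 * term (ι M) (suc k))
      ≡⟨ trans (solve 3 (λ m t x → m :* (t :* x) := t :* m :* x) refl (ι M) (ι 2) (term (ι M) (suc k)))
               (cong (_* term (ι M) (suc k)) (sym (ι-* 2 M))) ⟩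
    ι (2 ℕ.* M) * term (ι M) (suc k)
      ≤⟨ *-monoʳ-≤-nonNeg (term (ι M) (suc k)) {{nonNegative (term-nonNeg (0≤ι M) (suc k))}} (ι-mono h) ⟩
    ι (suc k) * term (ι M) (suc k)
      ≡⟨ term-suc (ι M) k ⟩
    ι M * term (ι M) k ∎)
    where
    open ≤-Reasoning
    open +-*-Solver

  -- By the preceding lemma, expSum n + 2 * term n decreases.
  tail-bound : ∀ M .{{_ : ℕ.NonZero M}} n → 2 ℕ.* M ℕ.≤ suc n → ∀ i →
    expSum (i ℕ.+ n) (ι M) + ι 2 * term (ι M) (i ℕ.+ n) ≤ expSum n (ι M) + ι 2 * term (ι M) n
  tail-bound M n h zero = ≤-refl
  tail-bound M n h (suc i) = begin
    expSum (i ℕ.+ n) (ι M) + t + ι 2 * term (ι M) (suc i ℕ.+ n)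
      ≤⟨ +-monoʳ-≤ (expSum (i ℕ.+ n) (ι M) + t) (term-halves M (i ℕ.+ n) (ℕ.≤-trans h (ℕ.s≤s (ℕ.m≤n+m n i)))) ⟩
    expSum (i ℕ.+ n) (ι M) + t + t
      ≡⟨ solve 2 (λ e t → e :+ t :+ t := e :+ con (ι 2) :* t) refl (expSum (i ℕ.+ n) (ι M)) t ⟩
    expSum (i ℕ.+ n) (ι M) + ι 2 * t
      ≤⟨ tail-bound M n h i ⟩
    expSum n (ι M) + ι 2 * term (ι M) n ∎
    where
    open ≤-Reasoning
    open +-*-Solver
    t : ℚ
    t = term (ι M) (i ℕ.+ n)

  private
    term-decreasing : ∀ M .{{_ : ℕ.NonZero M}} n → 2 ℕ.* M ℕ.≤ suc n → ∀ i → term (ι M) (i ℕ.+ n) ≤ term (ι M) n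
    term-decreasing M n h zero = ≤-refl
    term-decreasing M n h (suc i) = begin
      term (ι M) (suc i ℕ.+ n)                            ≡⟨ *-identityˡ _ ⟨
      1ℚ * term (ι M) (suc i ℕ.+ n)                       ≤⟨ *-monoʳ-≤-nonNeg (term (ι M) (suc i ℕ.+ n)) {{nonNegative (term-nonNeg (0≤ι M) (suc i ℕ.+ n))}} (ι-mono {1} {2} (ℕ.s≤s ℕ.z≤n)) ⟩
      ι 2 * term (ι M) (suc i ℕ.+ n)                      ≤⟨ term-halves M (i ℕ.+ n) (ℕ.≤-trans h (ℕ.s≤s (ℕ.m≤n+m n i))) ⟩
      term (ι M) (i ℕ.+ n)                                ≤⟨ term-decreasing M n h i ⟩
      term (ι M) n                                        ∎
      where open ≤-Reasoning

  -- The exponential series converges uniformly on bounded sets: the tail from index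
  -- k + 1 on is at most 2 * term (k + 1) = 2 M * term k / (k + 1).
  uniformTail : ∀ M .{{_ : ℕ.NonZero M}} ε → 0ℚ < ε →
    ∃ λ N → ∀ n i → N ℕ.≤ n → expSum (i ℕ.+ n) (ι M) - expSum n (ι M) ≤ ε
  uniformTail M ε 0<ε =
    let N₀ = 2 ℕ.* M
        c = ι 2 * (ι M * term (ι M) N₀)
        l , c≤lε = archimedean-* c 0<ε
    in suc (l ℕ.+ N₀) , bound l c≤lε
    where
    open ≤-Reasoning
    open +-*-Solver
    N₀ : ℕ
    N₀ = 2 ℕ.* M
    bound : ∀ l → ι 2 * (ι M * term (ι M) N₀) ≤ ι l * ε → ∀ n i → suc (l ℕ.+ N₀) ℕ.≤ n →
            expSum (i ℕ.+ n) (ι M) - expSum n (ι M) ≤ ε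
    bound l c≤lε (suc k) i (ℕ.s≤s l+N₀≤k) = p≤q+r⇒p-q≤r (begin
      expSum (i ℕ.+ suc k) (ι M)
        ≤⟨ p≤p+q _ (0≤p*q (0≤ι 2) (term-nonNeg (0≤ι M) (i ℕ.+ suc k))) ⟩
      expSum (i ℕ.+ suc k) (ι M) + ι 2 * term (ι M) (i ℕ.+ suc k)
        ≤⟨ tail-bound M (suc k) (ℕ.≤-trans N₀≤k (ℕ.≤-trans (ℕ.n≤1+n k) (ℕ.n≤1+n (suc k)))) i ⟩
      expSum (suc k) (ι M) + ι 2 * term (ι M) (suc k)
        ≤⟨ +-monoʳ-≤ (expSum (suc k) (ι M)) small ⟩
      expSum (suc k) (ι M) + ε ∎)
      where
      N₀≤k : N₀ ℕ.≤ k
      N₀≤k = ℕ.≤-trans (ℕ.m≤n+m N₀ l) l+N₀≤k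
      small : ι 2 * term (ι M) (suc k) ≤ ε
      small = *-cancelˡ-≤-pos (ι (suc k)) (begin
        ι (suc k) * (ι 2 * term (ι M) (suc k))
          ≡⟨ solve 3 (λ a b c → a :* (b :* c) := b :* (a :* c)) refl (ι (suc k)) (ι 2) (term (ι M) (suc k)) ⟩
        ι 2 * (ι (suc k) * term (ι M) (suc k))
          ≡⟨ cong (ι 2 *_) (term-suc (ι M) k) ⟩
        ι 2 * (ι M * term (ι M) k)
          ≤⟨ *-monoˡ-≤-nonNeg (ι 2) (*-monoˡ-≤-nonNeg (ι M)
               (subst (λ j → term (ι M) j ≤ term (ι M) N₀) (ℕ.m∸n+n≡m N₀≤k) (term-decreasing M N₀ (ℕ.n≤1+n N₀) (k ℕ.∸ N₀)))) ⟩
        ι 2 * (ι M * term (ι M) N₀)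
          ≤⟨ c≤lε ⟩
        ι l * ε
          ≤⟨ *-monoʳ-≤-nonNeg ε {{nonNegative (<⇒≤ 0<ε)}} (ι-mono (ℕ.≤-trans (ℕ.m≤m+n l N₀) (ℕ.≤-trans l+N₀≤k (ℕ.n≤1+n k)))) ⟩
        ι (suc k) * ε ∎)

  expSum-bounded : ∀ M .{{_ : ℕ.NonZero M}} → ∃ λ U → 0ℚ ≤ U × ∀ n → expSum n (ι M) ≤ U
  expSum-bounded M =
    let N , h = uniformTail M 1ℚ (positive⁻¹ 1ℚ)
    in expSum N (ι M) + 1ℚ ,
       0≤p+q (expSum-nonNeg (0≤ι M) N) (nonNegative⁻¹ 1ℚ) ,
       bound N h
    where
    bound : ∀ N → (∀ n i → N ℕ.≤ n → expSum (i ℕ.+ n) (ι M) - expSum n (ι M) ≤ 1ℚ) →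
            ∀ n → expSum n (ι M) ≤ expSum N (ι M) + 1ℚ
    bound N h n with ℕ.≤-total N n
    ... | inj₁ N≤n = p-q≤r⇒p≤q+r (subst (λ k → expSum k (ι M) - expSum N (ι M) ≤ 1ℚ) (ℕ.m∸n+n≡m N≤n) (h N (n ℕ.∸ N) ℕ.≤-refl))
    ... | inj₂ n≤N = ≤-trans (subst (λ k → expSum n (ι M) ≤ expSum k (ι M)) (ℕ.m∸n+n≡m n≤N) (expSum-mono (0≤ι M) n (N ℕ.∸ n)))
                             (p≤p+q _ (nonNegative⁻¹ 1ℚ))

  expSum-close : ∀ M .{{_ : ℕ.NonZero M}} ε → 0ℚ < ε →
    ∃ λ N → ∀ {q} → ∣ q ∣ ≤ ι M → ∀ m n → N ℕ.≤ m → N ℕ.≤ n → ∣ expSum m q - expSum n q ∣ ≤ ε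
  expSum-close M ε 0<ε = let N , h = uniformTail M ε 0<ε in N , close N h
    where
    close : ∀ N → (∀ n i → N ℕ.≤ n → expSum (i ℕ.+ n) (ι M) - expSum n (ι M) ≤ ε) →
            ∀ {q} → ∣ q ∣ ≤ ι M → ∀ m n → N ℕ.≤ m → N ℕ.≤ n → ∣ expSum m q - expSum n q ∣ ≤ ε
    close N h {q} q≤M m n N≤m N≤n with ℕ.≤-total n m
    ... | inj₁ n≤m = subst (λ k → ∣ expSum k q - expSum n q ∣ ≤ ε) (ℕ.m∸n+n≡m n≤m)
                       (≤-trans (expSum-increment q≤M n (m ℕ.∸ n)) (h n (m ℕ.∸ n) N≤n))
    ... | inj₂ m≤n = subst (_≤ ε) (close-sym (expSum n q) (expSum m q))
                       (subst (λ k → ∣ expSum k q - expSum m q ∣ ≤ ε) (ℕ.m∸n+n≡m m≤n)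
                         (≤-trans (expSum-increment q≤M m (n ℕ.∸ m)) (h m (n ℕ.∸ m) N≤m)))

  -- The derivative of each term is the preceding one.
  term-lipschitz : ∀ {p q r} → ∣ p ∣ ≤ r → ∣ q ∣ ≤ r → ∀ k →
                   ∣ term p (suc k) - term q (suc k) ∣ ≤ ∣ p - q ∣ * term r k
  term-lipschitz {p} {q} {r} hp hq zero = ≤-reflexive (begin
    ∣ p * 1ℚ * 1/! 1 - q * 1ℚ * 1/! 1 ∣   ≡⟨ cong ∣_∣ (solve 2 (λ p q → p :* con 1ℚ :* con 1ℚ :- q :* con 1ℚ :* con 1ℚ := p :- q) refl p q) ⟩
    ∣ p - q ∣                             ≡⟨ *-identityʳ ∣ p - q ∣ ⟨
    ∣ p - q ∣ * term r 0                  ∎)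
    where
    open ≡-Reasoning
    open +-*-Solver
  term-lipschitz {p} {q} {r} hp hq (suc k) = *-cancelˡ-≤-pos (ι (suc (suc k))) (begin
    ι (suc (suc k)) * ∣ term p (suc (suc k)) - term q (suc (suc k)) ∣
      ≡⟨ cong (_* ∣ term p (suc (suc k)) - term q (suc (suc k)) ∣) (0≤p⇒∣p∣≡p (0≤ι (suc (suc k)))) ⟨
    ∣ ι (suc (suc k)) ∣ * ∣ term p (suc (suc k)) - term q (suc (suc k)) ∣
      ≡⟨ ∣p*q∣≡∣p∣*∣q∣ (ι (suc (suc k))) (term p (suc (suc k)) - term q (suc (suc k))) ⟨
    ∣ ι (suc (suc k)) * (term p (suc (suc k)) - term q (suc (suc k))) ∣
      ≡⟨ cong ∣_∣ (solve 3 (λ i a b → i :* (a :- b) := i :* a :- i :* b) refl (ι (suc (suc k))) (term p (suc (suc k))) (term q (suc (suc k)))) ⟩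
    ∣ ι (suc (suc k)) * term p (suc (suc k)) - ι (suc (suc k)) * term q (suc (suc k)) ∣
      ≡⟨ cong₂ (λ x y → ∣ x - y ∣) (term-suc p (suc k)) (term-suc q (suc k)) ⟩
    ∣ p * a - q * b ∣
      ≡⟨ cong ∣_∣ (solve 4 (λ p q a b → p :* a :- q :* b := (p :- q) :* a :+ q :* (a :- b)) refl p q a b) ⟩
    ∣ (p - q) * a + q * (a - b) ∣
      ≤⟨ ∣p+q∣≤∣p∣+∣q∣ ((p - q) * a) (q * (a - b)) ⟩
    ∣ (p - q) * a ∣ + ∣ q * (a - b) ∣
      ≤⟨ +-mono-≤ (∣p*q∣≤ {p - q} ≤-refl (∣term∣≤ hp (suc k))) (∣p*q∣≤ {q} hq (term-lipschitz hp hq k)) ⟩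
    ∣ p - q ∣ * term r (suc k) + r * (∣ p - q ∣ * term r k)
      ≡⟨ cong (_+_ (∣ p - q ∣ * term r (suc k))) (solve 3 (λ h r t → r :* (h :* t) := h :* (r :* t)) refl (∣ p - q ∣) r (term r k)) ⟩
    ∣ p - q ∣ * term r (suc k) + ∣ p - q ∣ * (r * term r k)
      ≡⟨ cong (λ z → ∣ p - q ∣ * term r (suc k) + ∣ p - q ∣ * z) (term-suc r k) ⟨
    ∣ p - q ∣ * term r (suc k) + ∣ p - q ∣ * (ι (suc k) * term r (suc k))
      ≡⟨ solve 3 (λ h i t → h :* t :+ h :* (i :* t) := (con 1ℚ :+ i) :* (h :* t)) refl (∣ p - q ∣) (ι (suc k)) (term r (suc k)) ⟩
    (1ℚ + ι (suc k)) * (∣ p - q ∣ * term r (suc k))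
      ≡⟨ cong (_* (∣ p - q ∣ * term r (suc k))) (ι-+ 1 (suc k)) ⟨
    ι (suc (suc k)) * (∣ p - q ∣ * term r (suc k)) ∎)
    where
    open ≤-Reasoning
    open +-*-Solver
    a b : ℚ
    a = term p (suc k)
    b = term q (suc k)

  expSum-lipschitz : ∀ {p q r} → ∣ p ∣ ≤ r → ∣ q ∣ ≤ r → ∀ n →
                     ∣ expSum n p - expSum n q ∣ ≤ ∣ p - q ∣ * expSum n r
  expSum-lipschitz {p} {q} {r} hp hq zero = ≤-reflexive (sym (*-zeroʳ ∣ p - q ∣))
  expSum-lipschitz {p} {q} {r} hp hq (suc n) =
    ≤-trans (shifted n) (*-monoˡ-≤-nonNeg ∣ p - q ∣ {{∣-∣-nonNeg (p - q)}} (Σ<-mono (term-nonNeg (≤-trans (0≤∣p∣ p) hp)) n 1))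
    where
    open ≤-Reasoning
    open +-*-Solver
    shifted : ∀ n → ∣ expSum (suc n) p - expSum (suc n) q ∣ ≤ ∣ p - q ∣ * expSum n r
    shifted zero = ≤-reflexive (sym (*-zeroʳ ∣ p - q ∣))
    shifted (suc n) = begin
      ∣ expSum (suc n) p + term p (suc n) - (expSum (suc n) q + term q (suc n)) ∣
        ≡⟨ cong ∣_∣ (solve 4 (λ a b c d → (a :+ b) :- (c :+ d) := (a :- c) :+ (b :- d)) refl (expSum (suc n) p) (term p (suc n)) (expSum (suc n) q) (term q (suc n))) ⟩
      ∣ (expSum (suc n) p - expSum (suc n) q) + (term p (suc n) - term q (suc n)) ∣
        ≤⟨ ∣p+q∣≤∣p∣+∣q∣ (expSum (suc n) p - expSum (suc n) q) _ ⟩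
      ∣ expSum (suc n) p - expSum (suc n) q ∣ + ∣ term p (suc n) - term q (suc n) ∣
        ≤⟨ +-mono-≤ (shifted n) (term-lipschitz hp hq n) ⟩
      ∣ p - q ∣ * expSum n r + ∣ p - q ∣ * term r n
        ≡⟨ *-distribˡ-+ ∣ p - q ∣ (expSum n r) (term r n) ⟨
      ∣ p - q ∣ * expSum (suc n) r ∎

  -- The functional equation, up to a tail of the series at |a| + |b|.
  expSum-+ : ∀ {a b r s} → ∣ a ∣ ≤ r → ∣ b ∣ ≤ s → ∀ n →
             ∣ expSum n a * expSum n b - expSum n (a + b) ∣ ≤ expSum (n ℕ.+ n) (r + s) - expSum n (r + s)
  expSum-+ {a} {b} {r} {s} ha hb n = begin
    ∣ expSum n a * expSum n b - expSum n (a + b) ∣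
      ≡⟨ cong (λ z → ∣ expSum n a * expSum n b - z ∣) (Σ<-cong n (λ k → conv-term k a b)) ⟨
    ∣ defect (term a) (term b) n n ∣
      ≤⟨ defect-dominated n 0 (∣term∣≤ ha) (∣term∣≤ hb) ⟩
    defect (term r) (term s) n n
      ≤⟨ +-monoˡ-≤ (- Σconv (term r) (term s) n) (product-≤-Σconv n n (term-nonNeg 0≤r) (term-nonNeg 0≤s)) ⟩
    Σconv (term r) (term s) (n ℕ.+ n) - Σconv (term r) (term s) n
      ≡⟨ cong₂ _-_ (Σ<-cong (n ℕ.+ n) (λ k → conv-term k r s)) (Σ<-cong n (λ k → conv-term k r s)) ⟩
    expSum (n ℕ.+ n) (r + s) - expSum n (r + s) ∎
    where
    open ≤-Reasoning
    0≤r : 0ℚ ≤ r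
    0≤r = ≤-trans (0≤∣p∣ a) ha
    0≤s : 0ℚ ≤ s
    0≤s = ≤-trans (0≤∣p∣ b) hb

  1+q≤expSum : ∀ {q} → 0ℚ ≤ q → ∀ n → 1ℚ + q ≤ expSum (n ℕ.+ 2) q
  1+q≤expSum {q} 0≤q n =
    subst (_≤ expSum (n ℕ.+ 2) q) (solve 1 (λ q → con 0ℚ :+ con 1ℚ :* con 1ℚ :+ q :* con 1ℚ :* con 1ℚ := con 1ℚ :+ q) refl q)
      (expSum-mono 0≤q 2 n)
    where open +-*-Solver

  expSum-1 : ∀ n → expSum n 1ℚ ≤ ι 4
  expSum-1 n = begin
    expSum n 1ℚ                                       ≤⟨ expSum-mono (0≤ι 1) n 2 ⟩
    expSum (2 ℕ.+ n) 1ℚ                               ≡⟨ cong (λ k → expSum k 1ℚ) (ℕ.+-comm 2 n) ⟩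
    expSum (n ℕ.+ 2) 1ℚ                               ≤⟨ p≤p+q _ (0≤p*q (0≤ι 2) (term-nonNeg (0≤ι 1) (n ℕ.+ 2))) ⟩
    expSum (n ℕ.+ 2) 1ℚ + ι 2 * term 1ℚ (n ℕ.+ 2)     ≤⟨ tail-bound 1 2 (ℕ.n≤1+n 2) n ⟩
    expSum 2 1ℚ + ι 2 * term 1ℚ 2                     ≤⟨ ι-mono {3} {4} (ℕ.n≤1+n 3) ⟩
    ι 4                                               ∎
    where open ≤-Reasoning

-- Order and arithmetic of the real numbers

module RealOrder where

  open import Defs
  open RationalSeries hiding (*-mono-≤)
  open import Axiom.ExcludedMiddle using (ExcludedMiddle)
  open import Data.Nat.Base as ℕ using (ℕ; zero; suc)
  import Data.Nat.Properties as ℕ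
  open import Data.Product.Base using (∃; _×_; _,_; proj₁; proj₂)
  open import Data.Rational.Base as ℚ using (ℚ; 0ℚ; 1ℚ; ½)
  import Data.Rational.Properties as ℚ
  open import Data.Rational.Solver using (module +-*-Solver)
  open import Data.Sum.Base using (_⊎_; inj₁; inj₂)
  open import Level using (0ℓ)
  open import Relation.Binary.PropositionalEquality
  open import Relation.Binary.Structures using (IsPreorder)
  import Relation.Binary.Reasoning.Base.Double
  open import Relation.Nullary using (Dec; yes; no; contradiction)
  open import Relation.Unary using (Pred)

  private variable
    x y z w : ℝ

  -- Two eventual properties hold eventually together.
  infixl 4 _∧ᵉ_
  _∧ᵉ_ : ∀ {P Q : Pred ℕ 0ℓ} → Eventually P → Eventually Q → Eventually λ n → P n × Q n
  (M , p) ∧ᵉ (N , q) = M ℕ.⊔ N , λ n n≥ →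
    p n (ℕ.m⊔n≤o⇒m≤o M N n≥) , q n (ℕ.m⊔n≤o⇒n≤o M N n≥)

  mapᵉ : ∀ {P Q : Pred ℕ 0ℓ} → (∀ n → P n → Q n) → Eventually P → Eventually Q
  mapᵉ f (N , p) = N , λ n n≥ → f n (p n n≥)

  eventually-≤ : Eventually (λ n → seq x n ℚ.≤ seq y n) → x ≤ y
  eventually-≤ {x} {y} h ε 0<ε = mapᵉ (λ n x≤y → ℚ.≤-trans x≤y (p≤p+q (seq y n) (ℚ.<⇒≤ 0<ε))) h

  pointwise-≤ : (∀ n → seq x n ℚ.≤ seq y n) → x ≤ y
  pointwise-≤ {x} {y} h = eventually-≤ {x} {y} (0 , λ n _ → h n)

  pointwise-≃ : (∀ n → seq x n ≡ seq y n) → x ≃ y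
  pointwise-≃ {x} {y} h ε 0<ε = 0 , λ n _ →
    subst (ℚ._≤ ε) (sym (cong ℚ.∣_∣ (trans (cong (ℚ._- seq y n) (h n)) (ℚ.+-inverseʳ (seq y n))))) (ℚ.<⇒≤ 0<ε)

  ≃⇒≤ : x ≃ y → x ≤ y
  ≃⇒≤ {x} {y} h ε 0<ε = mapᵉ (λ n → close⇒≤ (seq x n) (seq y n)) (h ε 0<ε)

  ≃⇒≥ : x ≃ y → y ≤ x
  ≃⇒≥ {x} {y} h ε 0<ε = mapᵉ (λ n → close⇒≥ (seq x n) (seq y n)) (h ε 0<ε)

  ≤-antisym : x ≤ y → y ≤ x → x ≃ y
  ≤-antisym {x} {y} h k ε 0<ε = mapᵉ (λ n (p , q) → ≤⇒close (seq x n) (seq y n) p q) (h ε 0<ε ∧ᵉ k ε 0<ε)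

  ≤-trans : x ≤ y → y ≤ z → x ≤ z
  ≤-trans {x} {y} {z} h k ε 0<ε =
    mapᵉ (λ n (p , q) → ℚ.≤-trans p (ℚ.≤-trans (ℚ.+-monoˡ-≤ (½ ℚ.* ε) q)
      (ℚ.≤-reflexive (trans (ℚ.+-assoc (seq z n) _ _) (cong (seq z n ℚ.+_) (half+half ε))))))
      (h (½ ℚ.* ε) (half-pos 0<ε) ∧ᵉ k (½ ℚ.* ε) (half-pos 0<ε))

  ≃-sym : x ≃ y → y ≃ x
  ≃-sym {x} {y} h = ≤-antisym {y} {x} (≃⇒≥ {x} {y} h) (≃⇒≤ {x} {y} h)

  ≃-trans : x ≃ y → y ≃ z → x ≃ z
  ≃-trans {x} {y} {z} h k =
    ≤-antisym {x} {z} (≤-trans {x} {y} {z} (≃⇒≤ {x} {y} h) (≃⇒≤ {y} {z} k))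
                      (≤-trans {z} {y} {x} (≃⇒≥ {y} {z} k) (≃⇒≥ {x} {y} h))

  ≤-refl : ∀ x → x ≤ x
  ≤-refl x = pointwise-≤ {x} {x} (λ n → ℚ.≤-refl)

  ≃-refl : ∀ x → x ≃ x
  ≃-refl x = pointwise-≃ {x} {x} (λ n → refl)

  ≤-total : ExcludedMiddle 0ℓ → ∀ x y → x ≤ y ⊎ y ≤ x
  ≤-total em x y with em {y ≤ x}
  ... | yes y≤x = inj₂ y≤x
  ... | no y≰x = inj₁ λ ε 0<ε → x≤y ε 0<ε
    where
    -- If x ≤ y + δ fails infinitely often, then y ≤ x.
    x≤y : x ≤ y
    x≤y δ 0<δ with em {Eventually λ n → seq x n ℚ.≤ seq y n ℚ.+ δ}
    ... | yes h = h
    ... | no ¬h = contradiction (eventually-≤ {y} {x} (K , λ m K≤m → later m K≤m (em {∃ λ n → (K ℕ.≤ n) × (seq y n ℚ.+ δ ℚ.< seq x n)}))) y≰x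
      where
      cx = cauchy x (½ ℚ.* δ) (half-pos 0<δ)
      cy = cauchy y (½ ℚ.* δ) (half-pos 0<δ)
      K : ℕ
      K = proj₁ cx ℕ.⊔ proj₁ cy
      later : ∀ m → K ℕ.≤ m → Dec (∃ λ n → (K ℕ.≤ n) × (seq y n ℚ.+ δ ℚ.< seq x n)) → seq y m ℚ.≤ seq x m
      later m K≤m (no none) = contradiction (K , λ n K≤n → ℚ.≮⇒≥ (λ lt → none (n , K≤n , lt))) ¬h
      later m K≤m (yes (n , K≤n , lt)) = subst₂ ℚ._≤_ (cancel (seq y m)) (cancel (seq x m)) (ℚ.+-monoˡ-≤ (ℚ.- (½ ℚ.* δ)) (begin
        seq y m ℚ.+ ½ ℚ.* δ
          ≤⟨ ℚ.+-monoˡ-≤ (½ ℚ.* δ) (close⇒≤ (seq y m) (seq y n) (proj₂ cy m n (ℕ.m⊔n≤o⇒n≤o (proj₁ cx) _ K≤m) (ℕ.m⊔n≤o⇒n≤o (proj₁ cx) _ K≤n))) ⟩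
        seq y n ℚ.+ ½ ℚ.* δ ℚ.+ ½ ℚ.* δ
          ≡⟨ trans (ℚ.+-assoc (seq y n) _ _) (cong (seq y n ℚ.+_) (half+half δ)) ⟩
        seq y n ℚ.+ δ
          ≤⟨ ℚ.<⇒≤ lt ⟩
        seq x n
          ≤⟨ close⇒≤ (seq x n) (seq x m) (proj₂ cx n m (ℕ.m⊔n≤o⇒m≤o _ (proj₁ cy) K≤n) (ℕ.m⊔n≤o⇒m≤o _ (proj₁ cy) K≤m)) ⟩
        seq x m ℚ.+ ½ ℚ.* δ ∎))
        where
        open ℚ.≤-Reasoning
        cancel : ∀ q → q ℚ.+ ½ ℚ.* δ ℚ.+ ℚ.- (½ ℚ.* δ) ≡ q
        cancel q = solve 2 (λ q d → q :+ d :+ :- d := q) refl q (½ ℚ.* δ)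
          where open +-*-Solver

  -- It suffices to compare up to an arbitrary positive rational.
  ≤-approx : (∀ ε → 0ℚ ℚ.< ε → x ≤ y + fromℚ ε) → x ≤ y
  ≤-approx {x} {y} h ε 0<ε =
    mapᵉ (λ n p → ℚ.≤-trans p (ℚ.≤-reflexive (trans (ℚ.+-assoc (seq y n) _ _) (cong (seq y n ℚ.+_) (half+half ε)))))
      (h (½ ℚ.* ε) (half-pos 0<ε) (½ ℚ.* ε) (half-pos 0<ε))

  fromℚ-mono : ∀ {p q} → p ℚ.≤ q → fromℚ p ≤ fromℚ q
  fromℚ-mono {p} {q} p≤q = pointwise-≤ {fromℚ p} {fromℚ q} (λ n → p≤q)

  fromℚ-cancel : ∀ {p q} → fromℚ p ≤ fromℚ q → p ℚ.≤ q
  fromℚ-cancel {p} {q} h = ℚ.≮⇒≥ λ q<p →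
    let 0<δ = subst (ℚ._< p ℚ.- q) (ℚ.+-inverseʳ q) (ℚ.+-monoˡ-< (ℚ.- q) q<p)
        N , k = h (½ ℚ.* (p ℚ.- q)) (half-pos 0<δ)
    in ℚ.<-irrefl refl (ℚ.<-≤-trans (ℚ.+-monoʳ-< q (strict 0<δ)) (subst (ℚ._≤ q ℚ.+ ½ ℚ.* (p ℚ.- q)) (sym (cancel p q)) (k N ℕ.≤-refl)))
    where
    strict : ∀ {δ} → 0ℚ ℚ.< δ → ½ ℚ.* δ ℚ.< δ
    strict {δ} 0<δ = subst₂ ℚ._<_ (ℚ.+-identityʳ (½ ℚ.* δ)) (half+half δ) (ℚ.+-monoʳ-< (½ ℚ.* δ) (half-pos 0<δ))
    cancel : ∀ p q → q ℚ.+ (p ℚ.- q) ≡ p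
    cancel = solve 2 (λ p q → q :+ (p :- q) := p) refl
      where open +-*-Solver

  fromℕ-mono : ∀ {m n} → m ℕ.≤ n → fromℕ m ≤ fromℕ n
  fromℕ-mono m≤n = fromℚ-mono (ι-mono m≤n)

  fromℕ-cancel : ∀ {m n} → fromℕ m ≤ fromℕ n → m ℕ.≤ n
  fromℕ-cancel h = ι-cancel (fromℚ-cancel h)

  +-mono-≤ : x ≤ y → z ≤ w → x + z ≤ y + w
  +-mono-≤ {x} {y} {z} {w} h k ε 0<ε =
    mapᵉ (λ n (p , q) → ℚ.≤-trans (ℚ.+-mono-≤ p q) (ℚ.≤-reflexive
           (trans (solve 3 (λ a b e → (a :+ e) :+ (b :+ e) := a :+ b :+ (e :+ e)) refl (seq y n) (seq w n) (½ ℚ.* ε))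
                  (cong (seq y n ℚ.+ seq w n ℚ.+_) (half+half ε)))))
      (h (½ ℚ.* ε) (half-pos 0<ε) ∧ᵉ k (½ ℚ.* ε) (half-pos 0<ε))
    where open +-*-Solver

  neg-antimono : x ≤ y → - y ≤ - x
  neg-antimono {x} {y} h ε 0<ε =
    mapᵉ (λ n p → subst₂ ℚ._≤_ (solve 3 (λ a b e → a :+ (:- a :+ :- b) := :- b) refl (seq x n) (seq y n) ε)
                    (solve 3 (λ a b e → b :+ e :+ (:- a :+ :- b) := :- a :+ e) refl (seq x n) (seq y n) ε)
                    (ℚ.+-monoˡ-≤ (ℚ.- seq x n ℚ.+ ℚ.- seq y n) p)) (h ε 0<ε)
    where open +-*-Solver

  -- ε / (k + 1)
  divide : ∀ k {ε} → 0ℚ ℚ.< ε → ∃ λ δ → (0ℚ ℚ.< δ) × (ι (suc k) ℚ.* δ ≡ ε)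
  divide k {ε} 0<ε =
    ℚ.1/ (ι (suc k)) ℚ.* ε ,
    subst (ℚ._< ℚ.1/ (ι (suc k)) ℚ.* ε) (ℚ.*-zeroʳ (ℚ.1/ (ι (suc k)))) (ℚ.*-monoʳ-<-pos (ℚ.1/ (ι (suc k))) 0<ε) ,
    trans (sym (ℚ.*-assoc (ι (suc k)) (ℚ.1/ (ι (suc k))) ε))
      (trans (cong (ℚ._* ε) (ℚ.*-inverseʳ (ι (suc k)))) (ℚ.*-identityˡ ε))

  -- Eventually |x| ≤ K + 1.
  Bounded : ℕ → ℝ → Set
  Bounded K x = Eventually λ n → ℚ.∣ seq x n ∣ ℚ.≤ ι (suc K)

  bounded : ∀ x → ∃ λ K → Bounded K x
  bounded x =
    let N , h = cauchy x 1ℚ (ℚ.positive⁻¹ 1ℚ)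
        K , le = archimedean ℚ.∣ seq x N ∣
    in K , N , λ n N≤n → begin
      ℚ.∣ seq x n ∣
        ≡⟨ cong ℚ.∣_∣ (solve 2 (λ a b → a := b :+ (a :- b)) refl (seq x n) (seq x N)) ⟩
      ℚ.∣ seq x N ℚ.+ (seq x n ℚ.- seq x N) ∣
        ≤⟨ ℚ.∣p+q∣≤∣p∣+∣q∣ (seq x N) (seq x n ℚ.- seq x N) ⟩
      ℚ.∣ seq x N ∣ ℚ.+ ℚ.∣ seq x n ℚ.- seq x N ∣
        ≤⟨ ℚ.+-mono-≤ le (h n N N≤n ℕ.≤-refl) ⟩
      ι K ℚ.+ 1ℚ
        ≡⟨ trans (sym (ι-+ K 1)) (cong ι (ℕ.+-comm K 1)) ⟩
      ι (suc K) ∎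
    where
    open ℚ.≤-Reasoning
    open +-*-Solver

  bounded₂ : ∀ x y → ∃ λ K → Bounded K x × Bounded K y
  bounded₂ x y =
    let K , h = bounded x
        L , k = bounded y
    in K ℕ.+ L ,
       mapᵉ (λ n p → ℚ.≤-trans p (ι-mono (ℕ.s≤s (ℕ.m≤m+n K L)))) h ,
       mapᵉ (λ n p → ℚ.≤-trans p (ι-mono (ℕ.s≤s (ℕ.m≤n+m L K)))) k

  *-cong : x ≃ y → z ≃ w → x * z ≃ y * w
  *-cong {x} {y} {z} {w} h k ε 0<ε =
    let K , bx , bw = bounded₂ x w
        δ , 0<δ , Kδ = divide K (half-pos 0<ε)
    in mapᵉ (λ n (((bx , bw) , h) , k) → begin
         ℚ.∣ seq x n ℚ.* seq z n ℚ.- seq y n ℚ.* seq w n ∣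
           ≡⟨ cong ℚ.∣_∣ (solve 4 (λ x y z w → x :* z :- y :* w := x :* (z :- w) :+ w :* (x :- y)) refl (seq x n) (seq y n) (seq z n) (seq w n)) ⟩
         ℚ.∣ seq x n ℚ.* (seq z n ℚ.- seq w n) ℚ.+ seq w n ℚ.* (seq x n ℚ.- seq y n) ∣
           ≤⟨ ℚ.∣p+q∣≤∣p∣+∣q∣ (seq x n ℚ.* (seq z n ℚ.- seq w n)) _ ⟩
         ℚ.∣ seq x n ℚ.* (seq z n ℚ.- seq w n) ∣ ℚ.+ ℚ.∣ seq w n ℚ.* (seq x n ℚ.- seq y n) ∣
           ≤⟨ ℚ.+-mono-≤ (∣p*q∣≤ {seq x n} bx k) (∣p*q∣≤ {seq w n} bw h) ⟩
         ι (suc K) ℚ.* δ ℚ.+ ι (suc K) ℚ.* δ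
           ≡⟨ trans (cong₂ ℚ._+_ Kδ Kδ) (half+half ε) ⟩
         ε ∎) (bx ∧ᵉ bw ∧ᵉ h δ 0<δ ∧ᵉ k δ 0<δ)
    where
    open ℚ.≤-Reasoning
    open +-*-Solver

  -- The positive part.
  pos : ℝ → ℝ
  pos x = mkℝ (λ n → 0ℚ ℚ.⊔ seq x n) λ ε 0<ε →
    let N , h = cauchy x ε 0<ε in N , λ m n m≥ n≥ →
    ≤⇒close (0ℚ ℚ.⊔ seq x m) (0ℚ ℚ.⊔ seq x n)
      (shift (seq x m) (seq x n) (ℚ.<⇒≤ 0<ε) (close⇒≤ (seq x m) (seq x n) (h m n m≥ n≥)))
      (shift (seq x n) (seq x m) (ℚ.<⇒≤ 0<ε) (close⇒≥ (seq x m) (seq x n) (h m n m≥ n≥)))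
    where
    shift : ∀ p q {ε} → 0ℚ ℚ.≤ ε → p ℚ.≤ q ℚ.+ ε → 0ℚ ℚ.⊔ p ℚ.≤ 0ℚ ℚ.⊔ q ℚ.+ ε
    shift p q {ε} 0≤ε h = ℚ.⊔-lub (0≤p+q (ℚ.p≤p⊔q 0ℚ q) 0≤ε) (ℚ.≤-trans h (ℚ.+-monoˡ-≤ ε (ℚ.p≤q⊔p 0ℚ q)))

  0≤pos : ∀ x n → 0ℚ ℚ.≤ seq (pos x) n
  0≤pos x n = ℚ.p≤p⊔q 0ℚ (seq x n)

  pos-≃ : fromℕ 0 ≤ x → x ≃ pos x
  pos-≃ {x} 0≤x ε 0<ε = mapᵉ (λ n h →
    ≤⇒close (seq x n) (0ℚ ℚ.⊔ seq x n) (ℚ.≤-trans (ℚ.p≤q⊔p 0ℚ (seq x n)) (p≤p+q _ (ℚ.<⇒≤ 0<ε)))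
            (ℚ.⊔-lub h (p≤p+q (seq x n) (ℚ.<⇒≤ 0<ε)))) (0≤x ε 0<ε)

  0≤x*y : fromℕ 0 ≤ x → fromℕ 0 ≤ y → fromℕ 0 ≤ x * y
  0≤x*y {x} {y} 0≤x 0≤y = ≤-trans {fromℕ 0} {pos x * pos y} {x * y}
    (pointwise-≤ {fromℕ 0} {pos x * pos y} (λ n → 0≤p*q (0≤pos x n) (0≤pos y n)))
    (≃⇒≥ {x * y} {pos x * pos y} (*-cong {x} {pos x} {y} {pos y} (pos-≃ {x} 0≤x) (pos-≃ {y} 0≤y)))

  0≤y-x : x ≤ y → fromℕ 0 ≤ y - x
  0≤y-x {x} {y} h = ≤-trans {fromℕ 0} {x - x} {y - x}
    (pointwise-≤ {fromℕ 0} {x - x} (λ n → ℚ.≤-reflexive (sym (ℚ.+-inverseʳ (seq x n)))))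
    (+-mono-≤ {x} {y} { - x} { - x} h (≤-refl (- x)))

  *-monoˡ-≤ : fromℕ 0 ≤ z → x ≤ y → z * x ≤ z * y
  *-monoˡ-≤ {z} {x} {y} 0≤z x≤y = ≤-trans {z * x} {z * x + z * (y - x)} {z * y}
    (≤-trans {z * x} {z * x + fromℕ 0} {z * x + z * (y - x)}
      (pointwise-≤ {z * x} {z * x + fromℕ 0} (λ n → ℚ.≤-reflexive (sym (ℚ.+-identityʳ _))))
      (+-mono-≤ {z * x} {z * x} {fromℕ 0} {z * (y - x)} (≤-refl (z * x)) (0≤x*y {z} {y - x} 0≤z (0≤y-x {x} {y} x≤y))))
    (pointwise-≤ {z * x + z * (y - x)} {z * y} (λ n → ℚ.≤-reflexive
      (solve 3 (λ x y z → z :* x :+ z :* (y :- x) := z :* y) refl (seq x n) (seq y n) (seq z n))))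
    where open +-*-Solver

  *-comm : ∀ x y → x * y ≃ y * x
  *-comm x y = pointwise-≃ {x * y} {y * x} (λ n → ℚ.*-comm (seq x n) (seq y n))

  *-mono-≤ : fromℕ 0 ≤ y → fromℕ 0 ≤ z → x ≤ y → z ≤ w → x * z ≤ y * w
  *-mono-≤ {y} {z} {x} {w} 0≤y 0≤z x≤y z≤w = ≤-trans {x * z} {y * z} {y * w}
    (≤-trans {x * z} {z * x} {y * z} (≃⇒≤ {x * z} {z * x} (*-comm x z))
      (≤-trans {z * x} {z * y} {y * z} (*-monoˡ-≤ {z} {x} {y} 0≤z x≤y) (≃⇒≤ {z * y} {y * z} (*-comm z y))))
    (*-monoˡ-≤ {y} {z} {w} 0≤y z≤w)

  *-identityˡ : ∀ x → fromℕ 1 * x ≃ x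
  *-identityˡ x = pointwise-≃ {fromℕ 1 * x} {x} (λ n → ℚ.*-identityˡ (seq x n))

  ^-cong : ∀ n → x ≃ y → x ^ n ≃ y ^ n
  ^-cong zero h = ≃-refl (fromℕ 1)
  ^-cong {x} {y} (suc n) h = *-cong {x} {y} {x ^ n} {y ^ n} h (^-cong {x} {y} n h)

  0≤x^n : fromℕ 0 ≤ x → ∀ n → fromℕ 0 ≤ x ^ n
  0≤x^n 0≤x zero = fromℕ-mono ℕ.z≤n
  0≤x^n {x} 0≤x (suc n) = 0≤x*y {x} {x ^ n} 0≤x (0≤x^n {x} 0≤x n)

  ^-mono : fromℕ 0 ≤ x → x ≤ y → ∀ n → x ^ n ≤ y ^ n
  ^-mono 0≤x x≤y zero = ≤-refl (fromℕ 1)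
  ^-mono {x} {y} 0≤x x≤y (suc n) =
    *-mono-≤ {y} {x ^ n} {x} {y ^ n} (≤-trans {fromℕ 0} {x} {y} 0≤x x≤y) (0≤x^n {x} 0≤x n) x≤y (^-mono {x} {y} 0≤x x≤y n)

  fromℕ-^ : ∀ m n → fromℕ (m ℕ.^ n) ≃ fromℕ m ^ n
  fromℕ-^ m zero = ≃-refl (fromℕ 1)
  fromℕ-^ m (suc n) = ≃-trans {fromℕ (m ℕ.* m ℕ.^ n)} {fromℕ m * fromℕ (m ℕ.^ n)} {fromℕ m * fromℕ m ^ n}
    (pointwise-≃ {fromℕ (m ℕ.* m ℕ.^ n)} {fromℕ m * fromℕ (m ℕ.^ n)} (λ _ → ι-* m (m ℕ.^ n)))
    (*-cong {fromℕ m} {fromℕ m} {fromℕ (m ℕ.^ n)} {fromℕ m ^ n} (≃-refl (fromℕ m)) (fromℕ-^ m n))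

  ≤-isPreorder : IsPreorder _≃_ _≤_
  ≤-isPreorder = record
    { isEquivalence = record
      { refl  = λ {x} → ≃-refl x
      ; sym   = λ {x} {y} → ≃-sym {x} {y}
      ; trans = λ {x} {y} {z} → ≃-trans {x} {y} {z}
      }
    ; reflexive = λ {x} {y} → ≃⇒≤ {x} {y}
    ; trans = λ {x} {y} {z} → ≤-trans {x} {y} {z}
    }

  module ≤-Reasoning = Relation.Binary.Reasoning.Base.Double ≤-isPreorder

-- The exponential function

module RealExponential where

  open import Defs
  open RationalSeries hiding (*-mono-≤)
  open ExponentialSums
  open RealOrder
  open import Axiom.ExcludedMiddle using (ExcludedMiddle)
  open import Data.Nat.Base as ℕ using (ℕ; zero; suc)
  import Data.Nat.Properties as ℕ
  open import Data.Product.Base using (∃; _×_; _,_)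
  open import Data.Rational.Base as ℚ using (ℚ; 0ℚ; 1ℚ; ½)
  import Data.Rational.Properties as ℚ
  open import Data.Rational.Solver using (module +-*-Solver)
  open import Data.Sum.Base using (inj₁; inj₂)
  open import Level using (0ℓ)
  open import Relation.Binary.PropositionalEquality
  open import Relation.Nullary using (yes; no; contradiction)
  open import Relation.Unary using (Pred)

  private variable
    x y z w L L′ : ℝ

  <⇒rational : fromℕ 0 < x → ∃ λ δ → (0ℚ ℚ.< δ) × Eventually λ n → δ ℚ.≤ seq x n
  <⇒rational {x} (δ , 0<δ , h) = δ , 0<δ , mapᵉ (λ n → subst (ℚ._≤ seq x n) (ℚ.+-identityˡ δ)) h

  0<fromℚ : ∀ {δ} → 0ℚ ℚ.< δ → fromℕ 0 < fromℚ δ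
  0<fromℚ {δ} 0<δ = δ , 0<δ , 0 , λ n _ → ℚ.≤-reflexive (ℚ.+-identityˡ δ)

  private
    -- Moving two quarters of ε across an inequality.
    quarters : ∀ p q ε → p ℚ.- ½ ℚ.* (½ ℚ.* ε) ℚ.≤ q ℚ.+ ½ ℚ.* (½ ℚ.* ε) ℚ.+ ½ ℚ.* ε → p ℚ.≤ q ℚ.+ ε
    quarters p q ε h = subst₂ ℚ._≤_
      (solve 2 (λ p h → p :- h :+ h := p) refl p (½ ℚ.* (½ ℚ.* ε)))
      (trans (solve 3 (λ q h e → q :+ h :+ e :+ h := q :+ (h :+ h :+ e)) refl q (½ ℚ.* (½ ℚ.* ε)) (½ ℚ.* ε))
        (cong (q ℚ.+_) (trans (cong (ℚ._+ ½ ℚ.* ε) (half+half (½ ℚ.* ε))) (half+half ε))))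
      (ℚ.+-monoˡ-≤ (½ ℚ.* (½ ℚ.* ε)) h)
      where open +-*-Solver

  ⟶-≤ : ∀ {s} → s ⟶ L → s ⟶ L′ → L ≤ L′
  ⟶-≤ {L} {L′} {s} h k ε 0<ε =
    let h′ = fromℚ (½ ℚ.* (½ ℚ.* ε))
        0<h′ = 0<fromℚ (half-pos (half-pos 0<ε))
        N , both = h h′ 0<h′ ∧ᵉ k h′ 0<h′
        (lower , _) , (_ , upper) = both N ℕ.≤-refl
    in mapᵉ (λ n → quarters (seq L n) (seq L′ n) ε)
         (≤-trans {L - h′} {s N} {L′ + h′} lower upper (½ ℚ.* ε) (half-pos 0<ε))

  ⟶-unique : ∀ {s} → s ⟶ L → s ⟶ L′ → L ≃ L′
  ⟶-unique {L} {L′} {s} h k = ≤-antisym {L} {L′} (⟶-≤ {L} {L′} {s} h k) (⟶-≤ {L′} {L} {s} k h)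

  the-spec : ∀ (em : ExcludedMiddle 0ℓ) {P : Pred ℝ 0ℓ} → ∃ P → P (the em P)
  the-spec em {P} ∃P with em {∃ P}
  ... | yes (_ , p) = p
  ... | no ¬∃P = contradiction ∃P ¬∃P

  expSum-uniform : ∀ K → ∃ λ U → ∀ n → expSum n (ι (suc K)) ℚ.≤ ι (suc U)
  expSum-uniform K =
    let U , _ , h = expSum-bounded (suc K)
        u , U≤u = archimedean U
    in u , λ n → ℚ.≤-trans (h n) (ℚ.≤-trans U≤u (ι-mono (ℕ.n≤1+n u)))

  -- The partial sums are uniformly continuous on bounded sets, uniformly in n.
  expSum-modulus : ∀ K ε → 0ℚ ℚ.< ε → ∃ λ δ → (0ℚ ℚ.< δ) ×
    (∀ n {p q} → ℚ.∣ p ∣ ℚ.≤ ι (suc K) → ℚ.∣ q ∣ ℚ.≤ ι (suc K) → ℚ.∣ p ℚ.- q ∣ ℚ.≤ δ →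
       ℚ.∣ expSum n p ℚ.- expSum n q ∣ ℚ.≤ ε)
  expSum-modulus K ε 0<ε =
    let U , h = expSum-uniform K
        δ , 0<δ , Uδ = divide U 0<ε
    in δ , 0<δ , λ n {p} {q} hp hq p-q≤δ → begin
      ℚ.∣ expSum n p ℚ.- expSum n q ∣         ≤⟨ expSum-lipschitz hp hq n ⟩
      ℚ.∣ p ℚ.- q ∣ ℚ.* expSum n (ι (suc K))  ≤⟨ RationalSeries.*-mono-≤ (ℚ.<⇒≤ 0<δ) (expSum-nonNeg (0≤ι (suc K)) n) p-q≤δ (h n) ⟩
      δ ℚ.* ι (suc U)                         ≡⟨ trans (ℚ.*-comm δ (ι (suc U))) Uδ ⟩
      ε                                       ∎
    where
    open ℚ.≤-Reasoning

  abstract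
    expSum-cauchy : ∀ x → IsCauchy (λ n → expSum n (seq x n))
    expSum-cauchy x ε 0<ε =
      let K , (N₁ , bx) = bounded x
          δ , 0<δ , lip = expSum-modulus K (½ ℚ.* ε) (half-pos 0<ε)
          N₂ , close = expSum-close (suc K) (½ ℚ.* ε) (half-pos 0<ε)
          N₃ , cx = cauchy x δ 0<δ
          N = N₁ ℕ.⊔ (N₂ ℕ.⊔ N₃)
          ge₁ = λ {k} (h : N ℕ.≤ k) → ℕ.m⊔n≤o⇒m≤o N₁ (N₂ ℕ.⊔ N₃) h
          ge₂ = λ {k} (h : N ℕ.≤ k) → ℕ.m⊔n≤o⇒m≤o N₂ N₃ (ℕ.m⊔n≤o⇒n≤o N₁ (N₂ ℕ.⊔ N₃) h)
          ge₃ = λ {k} (h : N ℕ.≤ k) → ℕ.m⊔n≤o⇒n≤o N₂ N₃ (ℕ.m⊔n≤o⇒n≤o N₁ (N₂ ℕ.⊔ N₃) h)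
      in N , λ m n m≥ n≥ → begin
        ℚ.∣ expSum m (seq x m) ℚ.- expSum n (seq x n) ∣
          ≤⟨ triangle (expSum m (seq x m)) (expSum m (seq x n)) (expSum n (seq x n)) ⟩
        ℚ.∣ expSum m (seq x m) ℚ.- expSum m (seq x n) ∣ ℚ.+ ℚ.∣ expSum m (seq x n) ℚ.- expSum n (seq x n) ∣
          ≤⟨ ℚ.+-mono-≤ (lip m (bx m (ge₁ m≥)) (bx n (ge₁ n≥)) (cx m n (ge₃ m≥) (ge₃ n≥)))
                        (close (bx n (ge₁ n≥)) m n (ge₂ m≥) (ge₂ n≥)) ⟩
        ½ ℚ.* ε ℚ.+ ½ ℚ.* ε
          ≡⟨ half+half ε ⟩
        ε ∎
      where open ℚ.≤-Reasoning

  -- The exponential function, as the diagonal sequence of the partial sums.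
  expR : ℝ → ℝ
  expR x = mkℝ (λ n → expSum n (seq x n)) (expSum-cauchy x)

  seq-^ : ∀ x k n → seq (x ^ k) n ≡ seq x n ^ℚ k
  seq-^ x zero n = refl
  seq-^ x (suc k) n = cong (seq x n ℚ.*_) (seq-^ x k n)

  private
    series : ℝ → ℕ → ℝ
    series x n = ∑ n λ k → x ^ k * fromℚ (1/! k)

    seq-series : ∀ x n m → seq (series x n) m ≡ expSum n (seq x m)
    seq-series x zero m = refl
    seq-series x (suc n) m = cong₂ ℚ._+_ (seq-series x n m) (cong (ℚ._* 1/! n) (seq-^ x n m))

    series-⟶ : ∀ x → series x ⟶ expR x
    series-⟶ x ε 0<ε =
      let δ , 0<δ , δ≤ε = <⇒rational {ε} 0<ε
          K , (N₁ , bx) = bounded x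
          N₂ , close = expSum-close (suc K) δ 0<δ
          near = λ n (n≥ : N₂ ℕ.≤ n) → mapᵉ {P = λ m → (N₁ ⊔ℕ N₂ ℕ.≤ m) × (δ ℚ.≤ seq ε m)}
                   {Q = λ m → (ℚ.∣ expSum m (seq x m) ℚ.- expSum n (seq x m) ∣ ℚ.≤ δ) × (δ ℚ.≤ seq ε m)}
                   (λ m (m≥ , δ≤) → close (bx m (ℕ.m⊔n≤o⇒m≤o N₁ N₂ m≥)) m n (ℕ.m⊔n≤o⇒n≤o N₁ N₂ m≥) n≥ , δ≤)
                   ((N₁ ⊔ℕ N₂ , λ m m≥ → m≥) ∧ᵉ δ≤ε)
      in N₂ , λ n n≥ →
        eventually-≤ {expR x - ε} {series x n} (mapᵉ (λ m (c , δ≤) →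
          p≤q+r⇒p-q≤r (subst (λ z → expSum m (seq x m) ℚ.≤ seq ε m ℚ.+ z) (sym (seq-series x n m))
            (ℚ.≤-trans (close⇒≤ (expSum m (seq x m)) (expSum n (seq x m)) c) (ℚ.≤-trans (ℚ.+-monoʳ-≤ (expSum n (seq x m)) δ≤) (ℚ.≤-reflexive (ℚ.+-comm (expSum n (seq x m)) (seq ε m))))))) (near n n≥)) ,
        eventually-≤ {series x n} {expR x + ε} (mapᵉ (λ m (c , δ≤) →
          subst (ℚ._≤ expSum m (seq x m) ℚ.+ seq ε m) (sym (seq-series x n m))
            (ℚ.≤-trans (close⇒≥ (expSum m (seq x m)) (expSum n (seq x m)) c) (ℚ.+-monoʳ-≤ (expSum m (seq x m)) δ≤))) (near n n≥))
      where
      infixl 6 _⊔ℕ_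
      _⊔ℕ_ : ℕ → ℕ → ℕ
      _⊔ℕ_ = ℕ._⊔_

  exp-≃ : ∀ (em : ExcludedMiddle 0ℓ) x → exp em x ≃ expR x
  exp-≃ em x = ⟶-unique {exp em x} {expR x} {series x} (the-spec em {P = series x ⟶_} (expR x , series-⟶ x)) (series-⟶ x)

  expR-cong : x ≃ y → expR x ≃ expR y
  expR-cong {x} {y} h ε 0<ε =
    let K , bx , by = bounded₂ x y
        δ , 0<δ , lip = expSum-modulus K ε 0<ε
    in mapᵉ (λ n ((bx , by) , h) → lip n bx by h) (bx ∧ᵉ by ∧ᵉ h δ 0<δ)

  expR-+ : ∀ x y → expR (x + y) ≃ expR x * expR y
  expR-+ x y ε 0<ε =
    let K , bx , by = bounded₂ x y
        M = suc K ℕ.+ suc K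
        N , tail = uniformTail M ε 0<ε
    in mapᵉ (λ n ((bx , by) , N≤n) → begin
         ℚ.∣ expSum n (seq x n ℚ.+ seq y n) ℚ.- expSum n (seq x n) ℚ.* expSum n (seq y n) ∣
           ≡⟨ close-sym (expSum n (seq x n ℚ.+ seq y n)) (expSum n (seq x n) ℚ.* expSum n (seq y n)) ⟩
         ℚ.∣ expSum n (seq x n) ℚ.* expSum n (seq y n) ℚ.- expSum n (seq x n ℚ.+ seq y n) ∣
           ≤⟨ expSum-+ bx by n ⟩
         expSum (n ℕ.+ n) (ι (suc K) ℚ.+ ι (suc K)) ℚ.- expSum n (ι (suc K) ℚ.+ ι (suc K))
           ≡⟨ cong (λ z → expSum (n ℕ.+ n) z ℚ.- expSum n z) (ι-+ (suc K) (suc K)) ⟨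
         expSum (n ℕ.+ n) (ι M) ℚ.- expSum n (ι M)
           ≤⟨ tail n n N≤n ⟩
         ε ∎) (bx ∧ᵉ by ∧ᵉ (N , λ n N≤n → N≤n))
    where open ℚ.≤-Reasoning

  1+x≤expR : fromℕ 0 ≤ x → fromℕ 1 + x ≤ expR x
  1+x≤expR {x} 0≤x = begin
    fromℕ 1 + x        ≲⟨ +-mono-≤ {fromℕ 1} {fromℕ 1} {x} {pos x} (≤-refl (fromℕ 1)) (≃⇒≤ {x} {pos x} (pos-≃ {x} 0≤x)) ⟩
    fromℕ 1 + pos x    ≲⟨ eventually-≤ {fromℕ 1 + pos x} {expR (pos x)} (2 , λ n 2≤n →
                            subst (λ k → 1ℚ ℚ.+ seq (pos x) n ℚ.≤ expSum k (seq (pos x) n)) (ℕ.m∸n+n≡m 2≤n)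
                              (1+q≤expSum (0≤pos x n) (n ℕ.∸ 2))) ⟩
    expR (pos x)       ≈⟨ expR-cong {x} {pos x} (pos-≃ {x} 0≤x) ⟨
    expR x             ∎
    where open ≤-Reasoning

  0≤expR : ∀ x → fromℕ 0 ≤ expR x
  0≤expR x = begin
    fromℕ 0               ≲⟨ pointwise-≤ {fromℕ 0} {expR h * expR h} (λ n → square-nonNeg (seq (expR h) n)) ⟩
    expR h * expR h       ≈⟨ expR-+ h h ⟨
    expR (h + h)          ≈⟨ expR-cong {h + h} {x} (pointwise-≃ {h + h} {x} (λ n → half+half (seq x n))) ⟩
    expR x                ∎
    where
    open ≤-Reasoning
    h : ℝ
    h = fromℚ ½ * x
    square-nonNeg : ∀ q → 0ℚ ℚ.≤ q ℚ.* q
    square-nonNeg q with ℚ.≤-total 0ℚ q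
    ... | inj₁ 0≤q = 0≤p*q 0≤q 0≤q
    ... | inj₂ q≤0 = subst (0ℚ ℚ.≤_) (solve 1 (λ q → :- q :* :- q := q :* q) refl q) (0≤p*q (ℚ.neg-antimono-≤ q≤0) (ℚ.neg-antimono-≤ q≤0))
      where open +-*-Solver

  expR-mono : x ≤ y → expR x ≤ expR y
  expR-mono {x} {y} x≤y = begin
    expR x                  ≈⟨ *-identityˡ (expR x) ⟨
    fromℕ 1 * expR x        ≈⟨ *-comm (fromℕ 1) (expR x) ⟩
    expR x * fromℕ 1        ≲⟨ *-monoˡ-≤ {expR x} {fromℕ 1} {expR d} (0≤expR x) 1≤expR-d ⟩
    expR x * expR d         ≈⟨ expR-+ x d ⟨
    expR (x + d)            ≈⟨ expR-cong {x + d} {y} (pointwise-≃ {x + d} {y} (λ n →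
                                 solve 2 (λ x y → x :+ (y :- x) := y) refl (seq x n) (seq y n))) ⟩
    expR y                  ∎
    where
    open ≤-Reasoning
    open +-*-Solver
    d : ℝ
    d = y - x
    0≤d : fromℕ 0 ≤ d
    0≤d = 0≤y-x {x} {y} x≤y
    1≤expR-d : fromℕ 1 ≤ expR d
    1≤expR-d = begin
      fromℕ 1            ≈⟨ pointwise-≃ {fromℕ 1} {fromℕ 1 + fromℕ 0} (λ n → sym (ℚ.+-identityʳ 1ℚ)) ⟩
      fromℕ 1 + fromℕ 0  ≲⟨ +-mono-≤ {fromℕ 1} {fromℕ 1} {fromℕ 0} {d} (≤-refl (fromℕ 1)) 0≤d ⟩
      fromℕ 1 + d        ≲⟨ 1+x≤expR {d} 0≤d ⟩
      expR d             ∎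

  expR-0 : expR (fromℕ 0) ≃ fromℕ 1
  expR-0 ε 0<ε = 1 , λ { (suc n) _ → subst (ℚ._≤ ε)
      (sym (cong ℚ.∣_∣ (trans (cong (ℚ._- 1ℚ) (expSum-0 n)) (ℚ.+-inverseʳ 1ℚ)))) (ℚ.<⇒≤ 0<ε) }
    where
    expSum-0 : ∀ n → expSum (suc n) 0ℚ ≡ 1ℚ
    expSum-0 zero = refl
    expSum-0 (suc n) = trans (cong₂ ℚ._+_ (expSum-0 n)
      (trans (cong (ℚ._* 1/! (suc n)) (ℚ.*-zeroˡ (0ℚ ^ℚ n))) (ℚ.*-zeroˡ (1/! (suc n))))) (ℚ.+-identityʳ 1ℚ)

  expR-* : ∀ n x → expR (fromℕ n * x) ≃ expR x ^ n
  expR-* zero x = begin-equality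
    expR (fromℕ 0 * x)   ≈⟨ expR-cong {fromℕ 0 * x} {fromℕ 0} (pointwise-≃ {fromℕ 0 * x} {fromℕ 0} (λ k → ℚ.*-zeroˡ (seq x k))) ⟩
    expR (fromℕ 0)       ≈⟨ expR-0 ⟩
    fromℕ 1              ∎
    where open ≤-Reasoning
  expR-* (suc n) x = begin-equality
    expR (fromℕ (suc n) * x)         ≈⟨ expR-cong {fromℕ (suc n) * x} {x + fromℕ n * x} (pointwise-≃ {fromℕ (suc n) * x} {x + fromℕ n * x} (λ k →
                                          trans (cong (ℚ._* seq x k) (ι-+ 1 n)) (trans (ℚ.*-distribʳ-+ (seq x k) 1ℚ (ι n))
                                            (cong (ℚ._+ ι n ℚ.* seq x k) (ℚ.*-identityˡ (seq x k)))))) ⟩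
    expR (x + fromℕ n * x)           ≈⟨ expR-+ x (fromℕ n * x) ⟩
    expR x * expR (fromℕ n * x)      ≈⟨ *-cong {expR x} {expR x} {expR (fromℕ n * x)} {expR x ^ n} (≃-refl (expR x)) (expR-* n x) ⟩
    expR x * expR x ^ n              ∎
    where open ≤-Reasoning

  expR-1≤4 : expR (fromℕ 1) ≤ fromℕ 4
  expR-1≤4 = pointwise-≤ {expR (fromℕ 1)} {fromℕ 4} expSum-1

  -- For x ≤ 0 one has exp x * exp (- x) = 1 and exp (- x) ≥ 1 - x.
  expR-reflects-0≤ : ExcludedMiddle 0ℓ → ∀ x → fromℕ 1 ≤ expR x → fromℕ 0 ≤ x
  expR-reflects-0≤ em x 1≤expR with ≤-total em (fromℕ 0) x
  ... | inj₁ 0≤x = 0≤x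
  ... | inj₂ x≤0 = begin
    fromℕ 0                        ≈⟨ pointwise-≃ {fromℕ 0} {fromℕ 1 - fromℕ 1} (λ n → sym (ℚ.+-inverseʳ 1ℚ)) ⟩
    fromℕ 1 - fromℕ 1              ≲⟨ +-mono-≤ {fromℕ 1} {fromℕ 1} { - fromℕ 1} { - (fromℕ 1 - x)} (≤-refl (fromℕ 1))
                                        (neg-antimono {fromℕ 1 - x} {fromℕ 1} 1-x≤1) ⟩
    fromℕ 1 - (fromℕ 1 - x)        ≈⟨ pointwise-≃ {fromℕ 1 - (fromℕ 1 - x)} {x} (λ n → solve 1 (λ x → con 1ℚ :- (con 1ℚ :- x) := x) refl (seq x n)) ⟩
    x                              ∎
    where
    open ≤-Reasoning
    open +-*-Solver
    0≤-x : fromℕ 0 ≤ - x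
    0≤-x = ≤-trans {fromℕ 0} { - fromℕ 0} { - x} (pointwise-≤ {fromℕ 0} { - fromℕ 0} (λ n → ℚ.≤-refl)) (neg-antimono {x} {fromℕ 0} x≤0)
    1-x≤1 : fromℕ 1 - x ≤ fromℕ 1
    1-x≤1 = begin
      fromℕ 1 - x              ≲⟨ 1+x≤expR { - x} 0≤-x ⟩
      expR (- x)               ≈⟨ *-identityˡ (expR (- x)) ⟨
      fromℕ 1 * expR (- x)     ≲⟨ *-mono-≤ {expR x} {expR (- x)} {fromℕ 1} {expR (- x)} (0≤expR x) (0≤expR (- x)) 1≤expR (≤-refl (expR (- x))) ⟩
      expR x * expR (- x)      ≈⟨ expR-+ x (- x) ⟨
      expR (x - x)             ≈⟨ expR-cong {x - x} {fromℕ 0} (pointwise-≃ {x - x} {fromℕ 0} (λ n → ℚ.+-inverseʳ (seq x n))) ⟩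
      expR (fromℕ 0)           ≈⟨ expR-0 ⟩
      fromℕ 1                  ∎

-- Logarithms, real powers and integer parts

module RealLogarithm where

  open import Defs
  open Chebyshev using (switch; n<p^n)
  open RationalSeries hiding (*-mono-≤)
  open ExponentialSums
  open RealOrder
  open RealExponential
  open import Axiom.ExcludedMiddle using (ExcludedMiddle)
  open import Data.Nat.Base as ℕ using (ℕ; zero; suc)
  import Data.Nat.Properties as ℕ
  open import Data.Product.Base using (∃; _×_; _,_; proj₁; proj₂)
  open import Data.Rational.Base as ℚ using (ℚ; 0ℚ; 1ℚ; ½)
  import Data.Rational.Properties as ℚ
  open import Data.Rational.Solver using (module +-*-Solver)
  open import Data.Sum.Base using (inj₁; inj₂)
  open import Level using (0ℓ)
  open import Relation.Binary.PropositionalEquality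
  open import Relation.Nullary using (¬_; contradiction)

  private variable
    x y : ℝ

  -- Existence of logarithms of reals x ≥ 1, by bisection of an interval [0, W]
  -- with x ≤ exp W.
  module Bisection (em : ExcludedMiddle 0ℓ) (x : ℝ) (1≤x : fromℕ 1 ≤ x) (K : ℕ) (x≤K : x ≤ fromℕ (suc K)) where

    W : ℚ
    W = ι (suc K)

    width : ℕ → ℚ
    width zero    = W
    width (suc n) = ½ ℚ.* width n

    width-nonNeg : ∀ n → 0ℚ ℚ.≤ width n
    width-nonNeg zero = 0≤ι (suc K)
    width-nonNeg (suc n) = 0≤p*q (ℚ.nonNegative⁻¹ ½) (width-nonNeg n)

    width-halves : ∀ n → width (suc n) ℚ.+ width (suc n) ≡ width n
    width-halves n = half+half (width n)

    width-decay : ∀ n → ι (suc n) ℚ.* width n ℚ.≤ W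
    width-decay zero = ℚ.≤-reflexive (ℚ.*-identityˡ W)
    width-decay (suc n) = begin
      ι (suc (suc n)) ℚ.* width (suc n)
        ≤⟨ ℚ.*-monoʳ-≤-nonNeg (width (suc n)) {{ℚ.nonNegative (width-nonNeg (suc n))}}
             (ι-mono (ℕ.s≤s (ℕ.m≤n+m (suc n) n))) ⟩
      ι (suc n ℕ.+ suc n) ℚ.* width (suc n)
        ≡⟨ trans (cong (ℚ._* width (suc n)) (ι-+ (suc n) (suc n)))
             (solve 2 (λ a w → (a :+ a) :* w := a :* (w :+ w)) refl (ι (suc n)) (width (suc n))) ⟩
      ι (suc n) ℚ.* (width (suc n) ℚ.+ width (suc n))
        ≡⟨ cong (ι (suc n) ℚ.*_) (width-halves n) ⟩
      ι (suc n) ℚ.* width n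
        ≤⟨ width-decay n ⟩
      W ∎
      where
      open ℚ.≤-Reasoning
      open +-*-Solver

    width-small : ∀ ε → 0ℚ ℚ.< ε → ∃ λ n → width n ℚ.≤ ε
    width-small ε 0<ε =
      let n , W≤nε = archimedean-* W 0<ε in n ,
      ℚ.*-cancelˡ-≤-pos (ι (suc n)) (ℚ.≤-trans (width-decay n) (ℚ.≤-trans W≤nε
        (ℚ.*-monoʳ-≤-nonNeg ε {{ℚ.nonNegative (ℚ.<⇒≤ 0<ε)}} (ι-mono (ℕ.n≤1+n n)))))

    -- The logarithm of x lies between q and q + width n.
    Bracket : ℕ → ℚ → Set
    Bracket n q = (expR (fromℚ q) ≤ x) × (x ≤ expR (fromℚ (q ℚ.+ width n)))

    start : Bracket 0 0ℚ
    start =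
      ≤-trans {expR (fromℕ 0)} {fromℕ 1} {x} (≃⇒≤ {expR (fromℕ 0)} {fromℕ 1} expR-0) 1≤x ,
      (begin
        x                                ≲⟨ x≤K ⟩
        fromℚ W                          ≲⟨ pointwise-≤ {fromℚ W} {fromℕ 1 + fromℚ (0ℚ ℚ.+ W)} (λ n →
                                              ℚ.≤-trans (p≤p+q W (0≤ι 1)) (ℚ.≤-reflexive (trans (ℚ.+-comm W 1ℚ) (cong (1ℚ ℚ.+_) (sym (ℚ.+-identityˡ W)))))) ⟩
        fromℕ 1 + fromℚ (0ℚ ℚ.+ W)       ≲⟨ 1+x≤expR {fromℚ (0ℚ ℚ.+ W)} (fromℚ-mono (0≤p+q ℚ.≤-refl (0≤ι (suc K)))) ⟩
        expR (fromℚ (0ℚ ℚ.+ W))          ∎)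
      where open ≤-Reasoning

    -- The bracket at q′ of level n + 1 is contained in that at q of level n.
    Refines : ℕ → ℚ → ℚ → Set
    Refines n q q′ = (q ℚ.≤ q′) × (q′ ℚ.+ width (suc n) ℚ.≤ q ℚ.+ width n)

    refine : ∀ n q → Bracket n q → ∃ λ q′ → Bracket (suc n) q′ × Refines n q q′
    refine n q (lower , upper) with ≤-total em (expR (fromℚ (q ℚ.+ width (suc n)))) x
    ... | inj₁ below =
      q ℚ.+ width (suc n) ,
      (below , subst (λ z → x ≤ expR (fromℚ z)) (sym two-halves) upper) ,
      p≤p+q q (width-nonNeg (suc n)) , ℚ.≤-reflexive two-halves
      where
      two-halves : q ℚ.+ width (suc n) ℚ.+ width (suc n) ≡ q ℚ.+ width n
      two-halves = trans (ℚ.+-assoc q _ _) (cong (q ℚ.+_) (width-halves n))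
    ... | inj₂ above =
      q , (lower , above) , ℚ.≤-refl ,
      ℚ.+-monoʳ-≤ q (ℚ.≤-trans (p≤p+q (width (suc n)) (width-nonNeg (suc n))) (ℚ.≤-reflexive (width-halves n)))

    search : ∀ n → ∃ (Bracket n)
    search zero = 0ℚ , start
    search (suc n) = let q , b = search n ; q′ , b′ , _ = refine n q b in q′ , b′

    lo : ℕ → ℚ
    lo n = proj₁ (search n)

    lo-step : ∀ n → Refines n (lo n) (lo (suc n))
    lo-step n = proj₂ (proj₂ (refine n (lo n) (proj₂ (search n))))

    lo-mono : ∀ n i → lo n ℚ.≤ lo (i ℕ.+ n)
    lo-mono n zero = ℚ.≤-refl
    lo-mono n (suc i) = ℚ.≤-trans (lo-mono n i) (proj₁ (lo-step (i ℕ.+ n)))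

    hi-antimono : ∀ n i → lo (i ℕ.+ n) ℚ.+ width (i ℕ.+ n) ℚ.≤ lo n ℚ.+ width n
    hi-antimono n zero = ℚ.≤-refl
    hi-antimono n (suc i) = ℚ.≤-trans (proj₂ (lo-step (i ℕ.+ n))) (hi-antimono n i)

    lo-≤ : ∀ {n m} → n ℕ.≤ m → lo n ℚ.≤ lo m
    lo-≤ {n} {m} n≤m = subst (λ k → lo n ℚ.≤ lo k) (ℕ.m∸n+n≡m n≤m) (lo-mono n (m ℕ.∸ n))

    lo-≤-hi : ∀ {n m} → n ℕ.≤ m → lo m ℚ.≤ lo n ℚ.+ width n
    lo-≤-hi {n} {m} n≤m = ℚ.≤-trans (p≤p+q (lo m) (width-nonNeg m))
      (subst (λ k → lo k ℚ.+ width k ℚ.≤ lo n ℚ.+ width n) (ℕ.m∸n+n≡m n≤m) (hi-antimono n (m ℕ.∸ n)))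

    abstract
      lo-cauchy : IsCauchy lo
      lo-cauchy ε 0<ε =
        let N , small = width-small ε 0<ε in N , λ m n N≤m N≤n →
        ≤⇒close (lo m) (lo n)
          (ℚ.≤-trans (lo-≤-hi N≤m) (ℚ.+-mono-≤ (lo-≤ N≤n) small))
          (ℚ.≤-trans (lo-≤-hi N≤n) (ℚ.+-mono-≤ (lo-≤ N≤m) small))

    logarithm : ℝ
    logarithm = mkℝ lo lo-cauchy

    -- The values of exp at the two ends of the n-th bracket are close.
    ends-close : ∀ ε → 0ℚ ℚ.< ε → ∃ λ n →
      expR (fromℚ (lo n ℚ.+ width n)) ≤ expR (fromℚ (lo n)) + fromℚ ε
    ends-close ε 0<ε =
      let δ , 0<δ , modulus = expSum-modulus K ε 0<ε
          n , small = width-small δ 0<δ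
      in n , pointwise-≤ {expR (fromℚ (lo n ℚ.+ width n))} {expR (fromℚ (lo n)) + fromℚ ε} (λ k →
        close⇒≤ (expSum k (lo n ℚ.+ width n)) (expSum k (lo n))
          (modulus k {lo n ℚ.+ width n} {lo n}
            (abs≤ (0≤p+q (0≤lo n) (width-nonNeg n)) (hi≤W n))
            (abs≤ (0≤lo n) (ℚ.≤-trans (p≤p+q (lo n) (width-nonNeg n)) (hi≤W n)))
            (abs≤ (0≤q-p (p≤p+q (lo n) (width-nonNeg n)))
              (p≤q+r⇒p-q≤r (ℚ.+-monoʳ-≤ (lo n) small)))))
      where
      abs≤ : ∀ {p q} → 0ℚ ℚ.≤ p → p ℚ.≤ q → ℚ.∣ p ∣ ℚ.≤ q
      abs≤ 0≤p p≤q = subst (ℚ._≤ _) (sym (ℚ.0≤p⇒∣p∣≡p 0≤p)) p≤q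
      0≤lo : ∀ n → 0ℚ ℚ.≤ lo n
      0≤lo n = lo-≤ {0} {n} ℕ.z≤n
      hi≤W : ∀ n → lo n ℚ.+ width n ℚ.≤ W
      hi≤W n = subst₂ ℚ._≤_ (cong (λ k → lo k ℚ.+ width k) (ℕ.+-identityʳ n)) (ℚ.+-identityˡ W) (hi-antimono 0 n)

    lo≤logarithm : ∀ n → fromℚ (lo n) ≤ logarithm
    lo≤logarithm n = eventually-≤ {fromℚ (lo n)} {logarithm} (n , λ m n≤m → lo-≤ n≤m)

    logarithm≤hi : ∀ n → logarithm ≤ fromℚ (lo n ℚ.+ width n)
    logarithm≤hi n = eventually-≤ {logarithm} {fromℚ (lo n ℚ.+ width n)} (n , λ m n≤m → lo-≤-hi n≤m)

    exp-logarithm : expR logarithm ≃ x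
    exp-logarithm = ≤-antisym {expR logarithm} {x}
      (≤-approx {expR logarithm} {x} λ ε 0<ε → let n , close = ends-close ε 0<ε in begin
        expR logarithm                         ≲⟨ expR-mono {logarithm} {fromℚ (lo n ℚ.+ width n)} (logarithm≤hi n) ⟩
        expR (fromℚ (lo n ℚ.+ width n))        ≲⟨ close ⟩
        expR (fromℚ (lo n)) + fromℚ ε          ≲⟨ +-mono-≤ {expR (fromℚ (lo n))} {x} {fromℚ ε} {fromℚ ε} (proj₁ (proj₂ (search n))) (≤-refl (fromℚ ε)) ⟩
        x + fromℚ ε                            ∎)
      (≤-approx {x} {expR logarithm} λ ε 0<ε → let n , close = ends-close ε 0<ε in begin
        x                                      ≲⟨ proj₂ (proj₂ (search n)) ⟩
        expR (fromℚ (lo n ℚ.+ width n))        ≲⟨ close ⟩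
        expR (fromℚ (lo n)) + fromℚ ε          ≲⟨ +-mono-≤ {expR (fromℚ (lo n))} {expR logarithm} {fromℚ ε} {fromℚ ε}
                                                    (expR-mono {fromℚ (lo n)} {logarithm} (lo≤logarithm n)) (≤-refl (fromℚ ε)) ⟩
        expR logarithm + fromℚ ε               ∎)
      where open ≤-Reasoning

  log-spec : (em : ExcludedMiddle 0ℓ) → fromℕ 1 ≤ x → (expR (log em x) ≃ x) × (fromℕ 0 ≤ log em x)
  log-spec {x} em 1≤x =
    exp-log , expR-reflects-0≤ em (log em x) (≤-trans {fromℕ 1} {x} {expR (log em x)} 1≤x (≃⇒≥ {expR (log em x)} {x} exp-log))
    where
    K : ℕ
    K = proj₁ (bounded x)
    x≤K : x ≤ fromℕ (suc K)
    x≤K = eventually-≤ {x} {fromℕ (suc K)} (mapᵉ (λ n → ℚ.≤-trans (p≤∣p∣ (seq x n))) (proj₂ (bounded x)))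
    open Bisection em x 1≤x K x≤K using (logarithm; exp-logarithm)
    exp-log : expR (log em x) ≃ x
    exp-log = ≃-trans {expR (log em x)} {exp em (log em x)} {x}
      (≃-sym {exp em (log em x)} {expR (log em x)} (exp-≃ em (log em x)))
      (the-spec em {P = λ l → exp em l ≃ x} (logarithm ,
        ≃-trans {exp em logarithm} {expR logarithm} {x} (exp-≃ em logarithm) exp-logarithm))

  -- From c log x ≤ y to x ^ c ≤ e ^ y ≤ 4 ^ (⌊y⌋ + 1).
  log-condition : (em : ExcludedMiddle 0ℓ) → ∀ c N Y → fromℕ 1 ≤ x → fromℕ N ≤ x → y ≤ fromℕ (suc Y) →
                  fromℕ c * log em x ≤ y → N ℕ.^ c ℕ.≤ 4 ℕ.^ suc Y
  log-condition {x} {y} em c N Y 1≤x N≤x y≤Y clog≤y = fromℕ-cancel (begin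
    fromℕ (N ℕ.^ c)                     ≈⟨ fromℕ-^ N c ⟩
    fromℕ N ^ c                         ≲⟨ ^-mono {fromℕ N} {x} (fromℕ-mono ℕ.z≤n) N≤x c ⟩
    x ^ c                               ≈⟨ ^-cong {expR l} {x} c (proj₁ (log-spec {x} em 1≤x)) ⟨
    expR l ^ c                          ≈⟨ expR-* c l ⟨
    expR (fromℕ c * l)                  ≲⟨ expR-mono {fromℕ c * l} {y} clog≤y ⟩
    expR y                              ≲⟨ expR-mono {y} {fromℕ (suc Y)} y≤Y ⟩
    expR (fromℕ (suc Y))                ≈⟨ expR-cong {fromℕ (suc Y)} {fromℕ (suc Y) * fromℕ 1}
                                             (pointwise-≃ {fromℕ (suc Y)} {fromℕ (suc Y) * fromℕ 1} (λ n → sym (ℚ.*-identityʳ (ι (suc Y))))) ⟩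
    expR (fromℕ (suc Y) * fromℕ 1)      ≈⟨ expR-* (suc Y) (fromℕ 1) ⟩
    expR (fromℕ 1) ^ suc Y              ≲⟨ ^-mono {expR (fromℕ 1)} {fromℕ 4} (0≤expR (fromℕ 1)) expR-1≤4 (suc Y) ⟩
    fromℕ 4 ^ suc Y                     ≈⟨ fromℕ-^ 4 (suc Y) ⟨
    fromℕ (4 ℕ.^ suc Y)                 ∎)
    where
    open ≤-Reasoning
    l : ℝ
    l = log em x

  ^ℚ-gap : ∀ {e q δ} → 0ℚ ℚ.≤ e → 0ℚ ℚ.≤ δ → 1ℚ ℚ.≤ q → e ℚ.+ δ ℚ.≤ q → ∀ n → e ^ℚ suc n ℚ.+ δ ℚ.≤ q ^ℚ suc n
  ^ℚ-gap {e} {q} {δ} 0≤e 0≤δ 1≤q e+δ≤q n = begin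
    e ℚ.* e ^ℚ n ℚ.+ δ                    ≡⟨ cong (e ℚ.* e ^ℚ n ℚ.+_) (sym (ℚ.*-identityʳ δ)) ⟩
    e ℚ.* e ^ℚ n ℚ.+ δ ℚ.* 1ℚ             ≤⟨ ℚ.+-mono-≤ (RationalSeries.*-mono-≤ 0≤e (^ℚ-nonNeg 0≤e n) ℚ.≤-refl (mono n)) (RationalSeries.*-mono-≤ 0≤δ (0≤ι 1) ℚ.≤-refl (one n)) ⟩
    e ℚ.* q ^ℚ n ℚ.+ δ ℚ.* q ^ℚ n         ≡⟨ ℚ.*-distribʳ-+ (q ^ℚ n) e δ ⟨
    (e ℚ.+ δ) ℚ.* q ^ℚ n                  ≤⟨ RationalSeries.*-mono-≤ 0≤q (^ℚ-nonNeg 0≤q n) e+δ≤q ℚ.≤-refl ⟩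
    q ℚ.* q ^ℚ n                          ∎
    where
    open ℚ.≤-Reasoning
    0≤q : 0ℚ ℚ.≤ q
    0≤q = ℚ.≤-trans (0≤ι 1) 1≤q
    e≤q : e ℚ.≤ q
    e≤q = ℚ.≤-trans (p≤p+q e 0≤δ) e+δ≤q
    mono : ∀ n → e ^ℚ n ℚ.≤ q ^ℚ n
    mono zero = ℚ.≤-refl
    mono (suc n) = RationalSeries.*-mono-≤ 0≤q (^ℚ-nonNeg 0≤e n) e≤q (mono n)
    one : ∀ n → 1ℚ ℚ.≤ q ^ℚ n
    one zero = ℚ.≤-refl
    one (suc n) = RationalSeries.*-mono-≤ 0≤q (0≤ι 1) 1≤q (one n)

  -- Roots may be taken in an inequality between non-negative reals, the smaller of
  -- which is a natural number.
  ^-cancel-≤ : ∀ k n → fromℕ 0 ≤ x → fromℕ k ^ suc n ≤ x ^ suc n → fromℕ k ≤ x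
  ^-cancel-≤ zero n 0≤x _ = 0≤x
  ^-cancel-≤ {x} (suc k) n 0≤x h = ≤-trans {fromℕ (suc k)} {pos x} {x} root (≃⇒≥ {x} {pos x} (pos-≃ {x} 0≤x))
    where
    h′ : fromℕ (suc k) ^ suc n ≤ pos x ^ suc n
    h′ = ≤-trans {fromℕ (suc k) ^ suc n} {x ^ suc n} {pos x ^ suc n} h
           (≃⇒≤ {x ^ suc n} {pos x ^ suc n} (^-cong {x} {pos x} (suc n) (pos-≃ {x} 0≤x)))
    root : fromℕ (suc k) ≤ pos x
    root ε 0<ε = mapᵉ (λ m le → ℚ.≮⇒≥ λ lt →
        ℚ.<-irrefl refl (ℚ.<-≤-trans (ℚ.+-monoʳ-< (seq (pos x) m ^ℚ suc n) (half< 0<ε))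
          (ℚ.≤-trans (^ℚ-gap (0≤pos x m) (ℚ.<⇒≤ 0<ε) (ι-mono {1} {suc k} (ℕ.s≤s ℕ.z≤n)) (ℚ.<⇒≤ lt) n)
            (subst₂ ℚ._≤_ (seq-^ (fromℕ (suc k)) (suc n) m) (cong (ℚ._+ ½ ℚ.* ε) (seq-^ (pos x) (suc n) m)) le))))
      (h′ (½ ℚ.* ε) (half-pos 0<ε))
      where
      half< : ∀ {δ} → 0ℚ ℚ.< δ → ½ ℚ.* δ ℚ.< δ
      half< {δ} 0<δ = subst₂ ℚ._<_ (ℚ.+-identityʳ (½ ℚ.* δ)) (half+half δ) (ℚ.+-monoʳ-< (½ ℚ.* δ) (half-pos 0<δ))

  -- The real power v ^ (1/2 + ε) of a natural number v ≥ 1.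
  module RealPower (em : ExcludedMiddle 0ℓ) (ε : ℝ) (0<ε : fromℕ 0 < ε) where

    -- A rational lower bound for ε.
    δ : ℚ
    δ = proj₁ (<⇒rational {ε} 0<ε)

    0<δ : 0ℚ ℚ.< δ
    0<δ = proj₁ (proj₂ (<⇒rational {ε} 0<ε))

    -- With k = 2 ^ r this gives k + 13 ≤ 2 k (1/2 + ε), because r ≤ 2 k.
    r : ℕ
    r = proj₁ (archimedean-* (ι 13) 0<δ)

    a : ℝ
    a = fromℚ ½ + ε

    exponent-≤ : fromℕ (2 ℕ.^ r ℕ.+ 13) ≤ fromℕ (2 ℕ.^ suc r) * a
    exponent-≤ = eventually-≤ {fromℕ (k ℕ.+ 13)} {fromℕ (2 ℕ.^ suc r) * a}
      (mapᵉ (λ n δ≤ε → begin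
        ι (k ℕ.+ 13)                          ≡⟨ ι-+ k 13 ⟩
        ι k ℚ.+ ι 13                          ≤⟨ ℚ.+-monoʳ-≤ (ι k) (proj₂ (archimedean-* (ι 13) 0<δ)) ⟩
        ι k ℚ.+ ι r ℚ.* δ                    ≤⟨ ℚ.+-monoʳ-≤ (ι k) (RationalSeries.*-mono-≤ (0≤ι (2 ℕ.^ suc r)) (ℚ.<⇒≤ 0<δ) (ι-mono r≤2k) δ≤ε) ⟩
        ι k ℚ.+ ι (2 ℕ.^ suc r) ℚ.* seq ε n  ≡⟨ cong (ℚ._+ ι (2 ℕ.^ suc r) ℚ.* seq ε n) halve ⟩
        ι (2 ℕ.^ suc r) ℚ.* ½ ℚ.+ ι (2 ℕ.^ suc r) ℚ.* seq ε n ≡⟨ ℚ.*-distribˡ-+ (ι (2 ℕ.^ suc r)) ½ (seq ε n) ⟨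
        ι (2 ℕ.^ suc r) ℚ.* (½ ℚ.+ seq ε n)  ∎) (proj₂ (proj₂ (<⇒rational {ε} 0<ε))))
      where
      open ℚ.≤-Reasoning
      k : ℕ
      k = 2 ℕ.^ r
      r≤2k : r ℕ.≤ 2 ℕ.^ suc r
      r≤2k = ℕ.≤-trans (ℕ.<⇒≤ (n<p^n r ℕ.≤-refl)) (ℕ.m≤m+n k (k ℕ.+ 0))
      halve : ι k ≡ ι (2 ℕ.^ suc r) ℚ.* ½
      halve = sym (trans (cong (ℚ._* ½) (ι-* 2 k)) (trans (solve 3 (λ t k h → t :* k :* h := (t :* h) :* k) refl (ι 2) (ι k) ½) (ℚ.*-identityˡ (ι k))))
        where open +-*-Solver

    module _ (v : ℕ) (1≤v : 1 ℕ.≤ v) where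

      private
        l : ℝ
        l = log em (fromℕ v)

        0≤l : fromℕ 0 ≤ l
        0≤l = proj₂ (log-spec {fromℕ v} em (fromℕ-mono 1≤v))

        E : ℝ
        E = fromℕ v ^[ em ] (fromℚ ½ + ε)

        E≃ : E ≃ expR (a * l)
        E≃ = exp-≃ em (a * l)

        0≤a : fromℕ 0 ≤ a
        0≤a = eventually-≤ {fromℕ 0} {a} (mapᵉ (λ n δ≤ε → 0≤p+q (ℚ.nonNegative⁻¹ ½) (ℚ.≤-trans (ℚ.<⇒≤ 0<δ) δ≤ε)) (proj₂ (proj₂ (<⇒rational {ε} 0<ε))))

      1≤power : fromℕ 1 ≤ fromℕ v ^[ em ] (fromℚ ½ + ε)
      1≤power = begin
        fromℕ 1              ≲⟨ pointwise-≤ {fromℕ 1} {fromℕ 1 + fromℕ 0} (λ n → ℚ.≤-reflexive (sym (ℚ.+-identityʳ 1ℚ))) ⟩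
        fromℕ 1 + fromℕ 0    ≲⟨ +-mono-≤ {fromℕ 1} {fromℕ 1} {fromℕ 0} {a * l} (≤-refl (fromℕ 1)) (0≤x*y {a} {l} 0≤a 0≤l) ⟩
        fromℕ 1 + a * l      ≲⟨ 1+x≤expR {a * l} (0≤x*y {a} {l} 0≤a 0≤l) ⟩
        expR (a * l)         ≈⟨ E≃ ⟨
        E                    ∎
        where open ≤-Reasoning

      ≤-power : ∀ q → q ℕ.^ (2 ℕ.^ suc r) ℕ.≤ v ℕ.^ (2 ℕ.^ r ℕ.+ 13) → fromℕ q ≤ fromℕ v ^[ em ] (fromℚ ½ + ε)
      ≤-power q h = root (2 ℕ.^ suc r) (ℕ.m^n>0 2 (suc r)) (begin
        fromℕ q ^ (2 ℕ.^ suc r)               ≈⟨ fromℕ-^ q (2 ℕ.^ suc r) ⟨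
        fromℕ (q ℕ.^ (2 ℕ.^ suc r))           ≲⟨ fromℕ-mono h ⟩
        fromℕ (v ℕ.^ (2 ℕ.^ r ℕ.+ 13))         ≈⟨ fromℕ-^ v (2 ℕ.^ r ℕ.+ 13) ⟩
        fromℕ v ^ (2 ℕ.^ r ℕ.+ 13)             ≈⟨ ^-cong {expR l} {fromℕ v} (2 ℕ.^ r ℕ.+ 13) (proj₁ (log-spec {fromℕ v} em (fromℕ-mono 1≤v))) ⟨
        expR l ^ (2 ℕ.^ r ℕ.+ 13)              ≈⟨ expR-* (2 ℕ.^ r ℕ.+ 13) l ⟨
        expR (fromℕ (2 ℕ.^ r ℕ.+ 13) * l)      ≲⟨ expR-mono {fromℕ (2 ℕ.^ r ℕ.+ 13) * l} {fromℕ (2 ℕ.^ suc r) * (a * l)} exponents ⟩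
        expR (fromℕ (2 ℕ.^ suc r) * (a * l))  ≈⟨ expR-* (2 ℕ.^ suc r) (a * l) ⟩
        expR (a * l) ^ (2 ℕ.^ suc r)          ≈⟨ ^-cong {E} {expR (a * l)} (2 ℕ.^ suc r) E≃ ⟨
        E ^ (2 ℕ.^ suc r)                     ∎)
        where
        open ≤-Reasoning
        0≤E : fromℕ 0 ≤ E
        0≤E = ≤-trans {fromℕ 0} {fromℕ 1} {E} (fromℕ-mono ℕ.z≤n) 1≤power
        root : ∀ n → 1 ℕ.≤ n → fromℕ q ^ n ≤ E ^ n → fromℕ q ≤ E
        root (suc n) _ = ^-cancel-≤ {E} q n 0≤E
        exponents : fromℕ (2 ℕ.^ r ℕ.+ 13) * l ≤ fromℕ (2 ℕ.^ suc r) * (a * l)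
        exponents = begin
          fromℕ (2 ℕ.^ r ℕ.+ 13) * l          ≈⟨ *-comm (fromℕ (2 ℕ.^ r ℕ.+ 13)) l ⟩
          l * fromℕ (2 ℕ.^ r ℕ.+ 13)          ≲⟨ *-monoˡ-≤ {l} {fromℕ (2 ℕ.^ r ℕ.+ 13)} {fromℕ (2 ℕ.^ suc r) * a} 0≤l exponent-≤ ⟩
          l * (fromℕ (2 ℕ.^ suc r) * a)      ≈⟨ pointwise-≃ {l * (fromℕ (2 ℕ.^ suc r) * a)} {fromℕ (2 ℕ.^ suc r) * (a * l)} (λ n →
                                                  solve 3 (λ l m a → l :* (m :* a) := m :* (a :* l)) refl (seq l n) (ι (2 ℕ.^ suc r)) (seq a n)) ⟩
          fromℕ (2 ℕ.^ suc r) * (a * l)      ∎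
          where open +-*-Solver

  -- The largest natural number N ≤ x.
  floor : ExcludedMiddle 0ℓ → ∀ x → fromℕ 0 ≤ x →
          ∃ λ N → (fromℕ N ≤ x) × (x ≤ fromℕ (suc N)) × (∀ n → fromℕ n ≤ x → n ℕ.≤ N)
  floor em x 0≤x =
    let N , N≤x , 1+N≰x = switch {P = λ n → fromℕ n ≤ x} (λ n → em) 0≤x (suc (bound x))
                            (λ h → ℕ.1+n≰n (≤-bound (suc (bound x)) x h))
    in N , N≤x , above 1+N≰x , λ n n≤x → largest 1+N≰x n n≤x
    where
    above : ∀ {N} → ¬ (fromℕ (suc N) ≤ x) → x ≤ fromℕ (suc N)
    above {N} 1+N≰x with ≤-total em x (fromℕ (suc N))
    ... | inj₁ le = le
    ... | inj₂ ge = contradiction ge 1+N≰x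
    largest : ∀ {N} → ¬ (fromℕ (suc N) ≤ x) → ∀ n → fromℕ n ≤ x → n ℕ.≤ N
    largest {N} 1+N≰x n n≤x = ℕ.≮⇒≥ λ N<n →
      1+N≰x (≤-trans {fromℕ (suc N)} {fromℕ n} {x} (fromℕ-mono N<n) n≤x)

-- Squarefree smooth integers

module SmoothNumbers where

  open import Defs using (ℝ; fromℕ; primeDivisors; P⁺; μ²; S; Ψ; Ψ*; wintner; bound; ≤-bound)
  import Defs
  open Hypercontractivity using (_·_)
  open RestrictedProducts
  open Chebyshev
  open import Axiom.ExcludedMiddle using (ExcludedMiddle)
  open import Relation.Binary.PropositionalEquality
  open import Data.Integer.Base as ℤ using (ℤ; +_; 0ℤ; 1ℤ; -1ℤ; _◃_)
  import Data.Integer.Properties as ℤ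
  open import Data.Integer.Solver using (module +-*-Solver)
  open import Data.List.Base using (List; []; _∷_; _++_; length; map; filter; foldr; upTo)
  open import Data.List.Membership.Propositional using (_∈_; lose; find)
  open import Data.List.Membership.Propositional.Properties
    using (∈-filter⁺; ∈-filter⁻; ∈-upTo⁺; ∈-map⁺; ∈-map⁻; ∈-++⁺ˡ; ∈-++⁺ʳ; ∈-++⁻)
  open import Data.List.Membership.Propositional.Properties.WithK using (unique∧set⇒bag)
  open import Data.List.Properties using (map-++; map-∘)
  open import Data.List.Relation.Binary.BagAndSetEquality using (∼bag⇒↭)
  open import Data.List.Relation.Binary.Permutation.Propositional using (_↭_; ↭⇒↭ₛ)
  open import Data.List.Relation.Binary.Permutation.Propositional.Properties using (map⁺)
  open import Data.List.Relation.Binary.Permutation.Setoid.Properties (setoid ℤ) using (foldr-commMonoid)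
  open import Data.List.Relation.Unary.All as All using (All; []; _∷_)
  import Data.List.Relation.Unary.AllPairs as AllPairs
  open import Data.List.Relation.Unary.Any using (any?; here; there)
  open import Data.List.Relation.Unary.Unique.Propositional using (Unique)
  import Data.List.Relation.Unary.Unique.Propositional.Properties as Unique
  open import Data.Nat.Base
  open import Data.Nat.Divisibility hiding (quotient)
  open import Data.Nat.Primality using (Prime; prime?; euclidsLemma; prime⇒irreducible; prime⇒nonZero)
  open import Data.Nat.Properties
  open import Data.Product.Base using (_×_; _,_; proj₁; proj₂)
  open import Data.Sign.Base using (Sign)
  open import Data.Sum.Base using (_⊎_; inj₁; inj₂)
  open import Data.Vec.Base using (Vec; []; _∷_)
  open import Function.Base using (_∘_)
  open import Function.Bundles using (mk⇔)
  open import Level using (0ℓ)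

  open import Relation.Nullary using (¬_; Dec; yes; no; contradiction)
  open import Relation.Nullary.Decidable using (_×-dec_)

  Squarefree : ℕ → Set
  Squarefree n = ∀ p → Prime p → ¬ (p * p ∣ n)

  prime∣prime : ∀ {p q} → Prime p → Prime q → q ∣ p → q ≡ p
  prime∣prime pr-p pr-q q∣p with prime⇒irreducible pr-p q∣p
  ... | inj₁ q≡1 = contradiction (subst (2 ≤_) q≡1 (2≤prime pr-q)) λ { (s≤s ()) }
  ... | inj₂ q≡p = q≡p

  1≤prime : ∀ {p} → Prime p → 1 ≤ p
  1≤prime pr = ≤-trans (s≤s z≤n) (2≤prime pr)

  squarefree-∣ : ∀ {m n} → m ∣ n → Squarefree n → Squarefree m
  squarefree-∣ m∣n sf p pr pp∣m = sf p pr (∣-trans pp∣m m∣n)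

  squarefree-* : ∀ {p m} → Prime p → ¬ p ∣ m → Squarefree m → Squarefree (p * m)
  squarefree-* {p} {m} pr-p p∤m sf q pr-q qq∣pm with euclidsLemma p m pr-q (∣-trans (m∣m*n q) qq∣pm)
  ... | inj₁ q∣p with refl ← prime∣prime pr-p pr-q q∣p =
    p∤m (*-cancelˡ-∣ p {{prime⇒nonZero pr-p}} qq∣pm)
  ... | inj₂ (divides k m≡kq) =
    sf q pr-q (subst (q * q ∣_) (trans (*-comm q k) (sym m≡kq)) (*-monoʳ-∣ q q∣k))
    where
    q∣pk : q ∣ p * k
    q∣pk = *-cancelˡ-∣ q {{prime⇒nonZero pr-q}} (subst (q * q ∣_) (trans (cong (p *_) (trans m≡kq (*-comm k q))) (swap p q k)) qq∣pm)
      where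
      swap : ∀ a b c → a * (b * c) ≡ b * (a * c)
      swap a b c = trans (sym (*-assoc a b c)) (trans (cong (_* c) (*-comm a b)) (*-assoc b a c))
    q∣k : q ∣ k
    q∣k with euclidsLemma p k pr-q q∣pk
    ... | inj₂ q∣k = q∣k
    ... | inj₁ q∣p with refl ← prime∣prime pr-p pr-q q∣p = contradiction (divides k m≡kq) p∤m

  -- The products, at most N, of distinct entries of ps.
  products : List ℕ → ℕ → List ℕ
  products []       zero    = []
  products []       (suc N) = 1 ∷ []
  products (p ∷ ps) N       = products ps N ++ map (p *_) (products ps (N ÷ p))

  -- The description of the products of distinct primes ps.
  record IsProduct (ps : List ℕ) (N n : ℕ) : Set where
    constructor isProduct
    field
      positive   : 1 ≤ n
      bounded    : n ≤ N
      squarefree : Squarefree n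
      divisors   : ∀ q → Prime q → q ∣ n → q ∈ ps

  open IsProduct

  -- For distinct primes ps, the products are the squarefree n ≤ N with all prime
  -- divisors in ps.
  ∈-products⁻ : ∀ {ps N n} → All Prime ps → Unique ps → n ∈ products ps N → IsProduct ps N n
  ∈-products⁻ {[]} {suc N} [] _ (here refl) =
    isProduct ≤-refl (s≤s z≤n)
      (λ p pr pp∣1 → contradiction (2≤prime pr) (<⇒≱ (s≤s (∣⇒≤ (∣-trans (m∣m*n p) pp∣1)))))
      (λ q pr q∣1 → contradiction (2≤prime pr) (<⇒≱ (s≤s (∣⇒≤ q∣1))))
  ∈-products⁻ {p ∷ ps} {N} (pr ∷ prs) (p∉ps AllPairs.∷ uniq) n∈ with ∈-++⁻ (products ps N) n∈
  ... | inj₁ n∈ =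
    let isProduct 1≤n n≤N sf divs = ∈-products⁻ prs uniq n∈
    in isProduct 1≤n n≤N sf (λ q prq q∣n → there (divs q prq q∣n))
  ... | inj₂ n∈ with ∈-map⁻ (p *_) n∈
  ...   | m , m∈ , refl =
    let isProduct 1≤m m≤N÷p sf divs = ∈-products⁻ prs uniq m∈
        p∤m = λ p∣m → All.lookup p∉ps (divs p pr p∣m) refl
    in isProduct (*-mono-≤ (1≤prime pr) 1≤m)
         (≤-trans (*-monoʳ-≤ p m≤N÷p) (÷-* N p))
         (squarefree-* pr p∤m sf)
         (λ q prq q∣pm → prime-factor q prq (euclidsLemma p m prq q∣pm) divs)
    where
    prime-factor : ∀ q → Prime q → q ∣ p ⊎ q ∣ m → (∀ q → Prime q → q ∣ m → q ∈ ps) → q ∈ p ∷ ps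
    prime-factor q prq (inj₁ q∣p) divs = here (prime∣prime pr prq q∣p)
    prime-factor q prq (inj₂ q∣m) divs = there (divs q prq q∣m)

  ∈-products⁺ : ∀ {ps N n} → All Prime ps → IsProduct ps N n → n ∈ products ps N
  ∈-products⁺ {[]} {suc N} [] (isProduct 1≤n _ _ divs) =
    here (noPrimeDivisor 1≤n (λ q prq q∣n → contradiction (divs q prq q∣n) λ ()))
  ∈-products⁺ {[]} {zero} [] (isProduct 1≤n n≤0 _ _) = contradiction (≤-trans 1≤n n≤0) λ ()
  ∈-products⁺ {p ∷ ps} {N} {n} (pr ∷ prs) (isProduct 1≤n n≤N sf divs) with p ∣? n
  ... | no p∤n = ∈-++⁺ˡ (∈-products⁺ prs (isProduct 1≤n n≤N sf (λ q prq q∣n → tail q∣n (divs q prq q∣n))))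
    where
    tail : ∀ {q} → q ∣ n → q ∈ p ∷ ps → q ∈ ps
    tail q∣n (here refl) = contradiction q∣n p∤n
    tail q∣n (there q∈) = q∈
  ... | yes (divides m n≡mp) with refl ← trans n≡mp (*-comm m p) =
    ∈-++⁺ʳ (products ps N) (∈-map⁺ (p *_) (∈-products⁺ prs
      (isProduct (positive-factor 1≤n) (*-≤-÷ (1≤prime pr) n≤N) (squarefree-∣ (n∣m*n p) sf)
        (λ q prq q∣m → tail q∣m (divs q prq (∣-trans q∣m (n∣m*n p)))))))
    where
    positive-factor : ∀ {m} → 1 ≤ p * m → 1 ≤ m
    positive-factor {zero} h = contradiction (subst (1 ≤_) (*-zeroʳ p) h) λ ()
    positive-factor {suc m} h = s≤s z≤n
    tail : ∀ {q} → q ∣ m → q ∈ p ∷ ps → q ∈ ps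
    tail q∣m (here refl) = contradiction (*-monoʳ-∣ p q∣m) (sf p pr)
    tail q∣m (there q∈) = q∈

  products-unique : ∀ {ps} N → All Prime ps → Unique ps → Unique (products ps N)
  products-unique {[]} zero _ _ = AllPairs.[]
  products-unique {[]} (suc N) _ _ = [] AllPairs.∷ AllPairs.[]
  products-unique {p ∷ ps} N (pr ∷ prs) (p∉ps AllPairs.∷ uniq) =
    Unique.++⁺ (products-unique N prs uniq)
      (Unique.map⁺ (λ {x} {y} → *-cancelˡ-≡ x y p {{prime⇒nonZero pr}}) (products-unique (N ÷ p) prs uniq))
      (λ (v∈ , v∈′) → let m , _ , v≡ = ∈-map⁻ (p *_) v∈′ in
        All.lookup p∉ps (divisors (∈-products⁻ prs uniq v∈) p pr (subst (p ∣_) (sym v≡) (m∣m*n m))) refl)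

  -- Sums and products of lists.
  ∑ᴸ ∏ᴸ : List ℤ → ℤ
  ∑ᴸ = foldr ℤ._+_ 0ℤ
  ∏ᴸ = foldr ℤ._*_ 1ℤ

  ∑ᴸ-++ : ∀ xs ys → ∑ᴸ (xs ++ ys) ≡ ∑ᴸ xs ℤ.+ ∑ᴸ ys
  ∑ᴸ-++ [] ys = sym (ℤ.+-identityˡ (∑ᴸ ys))
  ∑ᴸ-++ (x ∷ xs) ys = trans (cong (ℤ._+_ x) (∑ᴸ-++ xs ys)) (sym (ℤ.+-assoc x (∑ᴸ xs) (∑ᴸ ys)))

  ∑ᴸ-↭ : ∀ {xs ys} → xs ↭ ys → ∑ᴸ xs ≡ ∑ᴸ ys
  ∑ᴸ-↭ p = foldr-commMonoid ℤ.+-0-isCommutativeMonoid (↭⇒↭ₛ p)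

  ∏ᴸ-↭ : ∀ {xs ys} → xs ↭ ys → ∏ᴸ xs ≡ ∏ᴸ ys
  ∏ᴸ-↭ p = foldr-commMonoid ℤ.*-1-isCommutativeMonoid (↭⇒↭ₛ p)

  unique-↭ : ∀ {xs ys : List ℕ} → Unique xs → Unique ys → (∀ {n} → n ∈ xs → n ∈ ys) → (∀ {n} → n ∈ ys → n ∈ xs) → xs ↭ ys
  unique-↭ u v f g = ∼bag⇒↭ (unique∧set⇒bag u v (mk⇔ f g))

  ∈-primeDivisors⁺ : ∀ {p n} → 1 ≤ n → Prime p → p ∣ n → p ∈ primeDivisors n
  ∈-primeDivisors⁺ {p} {n} 1≤n pr p∣n =
    ∈-filter⁺ (λ p → prime? p ×-dec (p ∣? n)) (∈-upTo⁺ (s≤s (∣⇒≤ {{>-nonZero 1≤n}} p∣n))) (pr , p∣n)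

  ∈-primeDivisors⁻ : ∀ {p n} → p ∈ primeDivisors n → Prime p × p ∣ n
  ∈-primeDivisors⁻ {p} {n} p∈ = proj₂ (∈-filter⁻ (λ p → prime? p ×-dec (p ∣? n)) {xs = upTo (suc n)} p∈)

  primeDivisors-unique : ∀ n → Unique (primeDivisors n)
  primeDivisors-unique n = Unique.filter⁺ (λ p → prime? p ×-dec (p ∣? n)) (Unique.upTo⁺ (suc n))

  primeDivisors-* : ∀ {p m} → Prime p → ¬ p ∣ m → 1 ≤ m → primeDivisors (p * m) ↭ p ∷ primeDivisors m
  primeDivisors-* {p} {m} pr p∤m 1≤m =
    unique-↭ (primeDivisors-unique (p * m))
      (All.tabulate (λ q∈ p≡q → p∤m (subst (_∣ m) (sym p≡q) (proj₂ (∈-primeDivisors⁻ {n = m} q∈)))) AllPairs.∷ primeDivisors-unique m)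
      forward backward
    where
    1≤pm : 1 ≤ p * m
    1≤pm = *-mono-≤ (1≤prime pr) 1≤m
    forward : ∀ {q} → q ∈ primeDivisors (p * m) → q ∈ p ∷ primeDivisors m
    forward q∈ with ∈-primeDivisors⁻ q∈
    ... | prq , q∣pm with euclidsLemma p m prq q∣pm
    ...   | inj₁ q∣p = here (prime∣prime pr prq q∣p)
    ...   | inj₂ q∣m = there (∈-primeDivisors⁺ 1≤m prq q∣m)
    backward : ∀ {q} → q ∈ p ∷ primeDivisors m → q ∈ primeDivisors (p * m)
    backward (here refl) = ∈-primeDivisors⁺ 1≤pm pr (m∣m*n m)
    backward (there q∈) = let prq , q∣m = ∈-primeDivisors⁻ q∈ in ∈-primeDivisors⁺ 1≤pm prq (∣-trans q∣m (n∣m*n p))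

  -1^-square : ∀ l → (-1ℤ ℤ.^ l) ℤ.^ 2 ≡ 1ℤ
  -1^-square zero = refl
  -1^-square (suc l) = trans (solve 1 (λ x → (con -1ℤ :* x) :* ((con -1ℤ :* x) :* con 1ℤ) := x :* (x :* con 1ℤ)) refl (-1ℤ ℤ.^ l)) (-1^-square l)
    where open +-*-Solver

  μ²-spec : ∀ {n} → 1 ≤ n → (Squarefree n × μ² n ≡ 1ℤ) ⊎ (¬ Squarefree n × μ² n ≡ 0ℤ)
  μ²-spec {n} 1≤n with any? (λ p → (p * p) ∣? n) (primeDivisors n)
  ... | yes found = inj₂ ((λ sf → let p , p∈ , pp∣n = find found in sf p (proj₁ (∈-primeDivisors⁻ {n = n} p∈)) pp∣n) , refl)
  ... | no none = inj₁ ((λ p pr pp∣n → none (lose (∈-primeDivisors⁺ 1≤n pr (∣-trans (m∣m*n p) pp∣n)) pp∣n)) ,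
                        -1^-square (length (primeDivisors n)))

  μ²-squarefree : ∀ {n} → 1 ≤ n → Squarefree n → μ² n ≡ 1ℤ
  μ²-squarefree 1≤n sf with μ²-spec 1≤n
  ... | inj₁ (_ , e) = e
  ... | inj₂ (¬sf , _) = contradiction sf ¬sf

  -- The multiplicative function supported on squarefree integers with given signs at
  -- the primes.
  signed : (ℕ → Sign) → ℕ → ℤ
  signed s n = μ² n ℤ.* ∏ᴸ (map (λ p → s p ◃ 1) (primeDivisors n))

  signed-* : ∀ s {p m} → Prime p → ¬ p ∣ m → 1 ≤ m → Squarefree m → signed s (p * m) ≡ s p · signed s m
  signed-* s {p} {m} pr p∤m 1≤m sf = begin
    μ² (p * m) ℤ.* ∏ᴸ (map f (primeDivisors (p * m)))
      ≡⟨ cong₂ ℤ._*_ (μ²-squarefree (*-mono-≤ (1≤prime pr) 1≤m) (squarefree-* pr p∤m sf))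
           (∏ᴸ-↭ (map⁺ f (primeDivisors-* pr p∤m 1≤m))) ⟩
    1ℤ ℤ.* (f p ℤ.* rest)
      ≡⟨ solve 2 (λ a b → con 1ℤ :* (a :* b) := a :* (con 1ℤ :* b)) refl (f p) rest ⟩
    f p ℤ.* (1ℤ ℤ.* rest)
      ≡⟨ cong (λ z → f p ℤ.* (z ℤ.* rest)) (μ²-squarefree 1≤m sf) ⟨
    s p · signed s m ∎
    where
    open ≡-Reasoning
    open +-*-Solver
    f : ℕ → ℤ
    f p = s p ◃ 1
    rest : ℤ
    rest = ∏ᴸ (map f (primeDivisors m))

  -- The signs at the entries of ps.
  signs : (ℕ → Sign) → ∀ ps → Vec Sign (length ps)
  signs s []       = []
  signs s (p ∷ ps) = s p ∷ signs s ps

  ∑ᴸ-map-cong : ∀ {f g : ℕ → ℤ} xs → (∀ {n} → n ∈ xs → f n ≡ g n) → ∑ᴸ (map f xs) ≡ ∑ᴸ (map g xs)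
  ∑ᴸ-map-cong [] h = refl
  ∑ᴸ-map-cong (x ∷ xs) h = cong₂ ℤ._+_ (h (here refl)) (∑ᴸ-map-cong xs (h ∘ there))

  ∑ᴸ-map-* : ∀ c (f : ℕ → ℤ) xs → ∑ᴸ (map (λ n → c ℤ.* f n) xs) ≡ c ℤ.* ∑ᴸ (map f xs)
  ∑ᴸ-map-* c f [] = sym (ℤ.*-zeroʳ c)
  ∑ᴸ-map-* c f (x ∷ xs) = trans (cong (ℤ._+_ (c ℤ.* f x)) (∑ᴸ-map-* c f xs)) (sym (ℤ.*-distribˡ-+ c (f x) _))

  -- Splitting the sum over products according to divisibility by p.
  ∑-products : ∀ (g : ℕ → ℤ) {p ps} N c → All Prime (p ∷ ps) → Unique (p ∷ ps) →
    (∀ {m} → ¬ p ∣ m → 1 ≤ m → Squarefree m → g (p * m) ≡ c ℤ.* g m) →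
    ∑ᴸ (map g (products (p ∷ ps) N)) ≡ ∑ᴸ (map g (products ps N)) ℤ.+ c ℤ.* ∑ᴸ (map g (products ps (N ÷ p)))
  ∑-products g {p} {ps} N c (pr ∷ prs) (p∉ps AllPairs.∷ uniq) g-* = begin
    ∑ᴸ (map g (products ps N ++ map (p *_) qs))
      ≡⟨ cong ∑ᴸ (map-++ g (products ps N) (map (p *_) qs)) ⟩
    ∑ᴸ (map g (products ps N) ++ map g (map (p *_) qs))
      ≡⟨ ∑ᴸ-++ (map g (products ps N)) _ ⟩
    ∑ᴸ (map g (products ps N)) ℤ.+ ∑ᴸ (map g (map (p *_) qs))
      ≡⟨ cong (λ z → ∑ᴸ (map g (products ps N)) ℤ.+ ∑ᴸ z) (sym (map-∘ qs)) ⟩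
    ∑ᴸ (map g (products ps N)) ℤ.+ ∑ᴸ (map (λ m → g (p * m)) qs)
      ≡⟨ cong (ℤ._+_ (∑ᴸ (map g (products ps N)))) (trans (∑ᴸ-map-cong qs step) (∑ᴸ-map-* c g qs)) ⟩
    ∑ᴸ (map g (products ps N)) ℤ.+ c ℤ.* ∑ᴸ (map g qs) ∎
    where
    open ≡-Reasoning
    qs : List ℕ
    qs = products ps (N ÷ p)
    step : ∀ {m} → m ∈ qs → g (p * m) ≡ c ℤ.* g m
    step m∈ = let isProduct 1≤m _ sf divs = ∈-products⁻ prs uniq m∈
              in g-* (λ p∣m → All.lookup p∉ps (divs p pr p∣m) refl) 1≤m sf

  ∑-signed : ∀ s {ps} N → All Prime ps → Unique ps → ∑ᴸ (map (signed s) (products ps N)) ≡ signSum ps N (signs s ps)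
  ∑-signed s {[]} zero _ _ = refl
  ∑-signed s {[]} (suc N) _ _ = refl
  ∑-signed s {p ∷ ps} N prs@(pr ∷ prs′) uniq@(_ AllPairs.∷ uniq′) =
    trans (∑-products (signed s) N (s p ◃ 1) prs uniq (signed-* s pr))
      (cong₂ (λ a b → a ℤ.+ s p · b) (∑-signed s N prs′ uniq′) (∑-signed s (N ÷ p) prs′ uniq′))

  ∑-μ² : ∀ {ps} N → All Prime ps → Unique ps → ∑ᴸ (map μ² (products ps N)) ≡ + productCount ps N
  ∑-μ² {[]} zero _ _ = refl
  ∑-μ² {[]} (suc N) _ _ = refl
  ∑-μ² {p ∷ ps} N prs@(pr ∷ prs′) uniq@(_ AllPairs.∷ uniq′) =
    trans (∑-products μ² N 1ℤ prs uniq (λ {m} p∤m 1≤m sf →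
            trans (μ²-squarefree (*-mono-≤ (1≤prime pr) 1≤m) (squarefree-* pr p∤m sf))
                  (sym (trans (ℤ.*-identityˡ (μ² m)) (μ²-squarefree 1≤m sf)))))
      (trans (cong₂ (λ a b → a ℤ.+ b) (∑-μ² N prs′ uniq′) (trans (ℤ.*-identityˡ _) (∑-μ² (N ÷ p) prs′ uniq′)))
             (sym (ℤ.pos-+ (productCount ps N) (productCount ps (N ÷ p)))))

  ∑ᴸ-filter : ∀ {P : ℕ → Set} (P? : ∀ n → Dec (P n)) (g : ℕ → ℤ) xs → (∀ {n} → n ∈ xs → ¬ P n → g n ≡ 0ℤ) →
              ∑ᴸ (map g xs) ≡ ∑ᴸ (map g (filter P? xs))
  ∑ᴸ-filter P? g [] h = refl
  ∑ᴸ-filter P? g (x ∷ xs) h with P? x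
  ... | yes _ = cong (ℤ._+_ (g x)) (∑ᴸ-filter P? g xs (h ∘ there))
  ... | no ¬p = trans (cong₂ ℤ._+_ (h (here refl) ¬p) (∑ᴸ-filter P? g xs (h ∘ there))) (ℤ.+-identityˡ _)

  foldr-⊔-≤⁺ : ∀ {Z} xs → 1 ≤ Z → (∀ {n} → n ∈ xs → n ≤ Z) → foldr _⊔_ 1 xs ≤ Z
  foldr-⊔-≤⁺ [] 1≤Z h = 1≤Z
  foldr-⊔-≤⁺ (x ∷ xs) 1≤Z h = ⊔-lub (h (here refl)) (foldr-⊔-≤⁺ xs 1≤Z (h ∘ there))

  foldr-⊔-≤⁻ : ∀ {Z} xs → foldr _⊔_ 1 xs ≤ Z → ∀ {n} → n ∈ xs → n ≤ Z
  foldr-⊔-≤⁻ (x ∷ xs) h (here refl) = m⊔n≤o⇒m≤o x _ h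
  foldr-⊔-≤⁻ (x ∷ xs) h (there n∈) = foldr-⊔-≤⁻ xs (m⊔n≤o⇒n≤o x _ h) n∈

  -- S(x,y) depends only on the integer parts of x and y, and in it y may be
  -- replaced by min(x,y).
  module SmoothSum (em : ExcludedMiddle 0ℓ) (x y : ℝ) (N Z : ℕ)
    (N≤x : fromℕ N Defs.≤ x) (N-max : ∀ n → fromℕ n Defs.≤ x → n ≤ N)
    (Z≤y : fromℕ Z Defs.≤ y) (Z-max : ∀ n → fromℕ n Defs.≤ y → n ≤ Z) (1≤Z : 1 ≤ Z) where

    ps : List ℕ
    ps = primesUpTo (Z ⊓ N)

    ps-unique : Unique ps
    ps-unique = Unique.filter⁺ prime? (Unique.upTo⁺ (suc (Z ⊓ N)))

    S⇒IsProduct : ∀ {n} → S x y n → Squarefree n → IsProduct ps N n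
    S⇒IsProduct {n} (1≤n , n≤x , P⁺≤y) sf = isProduct 1≤n n≤N sf λ q pr q∣n →
      ∈-primesUpTo⁺ pr (⊓-glb (foldr-⊔-≤⁻ (primeDivisors n) (Z-max (P⁺ n) P⁺≤y) (∈-primeDivisors⁺ 1≤n pr q∣n))
                              (≤-trans (∣⇒≤ {{>-nonZero 1≤n}} q∣n) n≤N))
      where
      n≤N : n ≤ N
      n≤N = N-max n n≤x

    IsProduct⇒S : ∀ {n} → IsProduct ps N n → S x y n
    IsProduct⇒S {n} (isProduct 1≤n n≤N sf divs) =
      1≤n ,
      RealOrder.≤-trans {fromℕ n} {fromℕ N} {x} (RealOrder.fromℕ-mono n≤N) N≤x ,
      RealOrder.≤-trans {fromℕ (P⁺ n)} {fromℕ Z} {y} (RealOrder.fromℕ-mono (foldr-⊔-≤⁺ (primeDivisors n) 1≤Z (λ q∈ →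
        let pr , q∣n = ∈-primeDivisors⁻ q∈
        in ≤-trans (proj₂ (∈-primesUpTo⁻ (divs _ pr q∣n))) (m⊓n≤m Z N)))) Z≤y

    Ψ≡ : ∀ (g : ℕ → ℤ) → (∀ {n} → 1 ≤ n → ¬ Squarefree n → g n ≡ 0ℤ) → Ψ em g x y ≡ ∑ᴸ (map g (products ps N))
    Ψ≡ g g≡0 = trans (∑ᴸ-filter (λ n → em {Squarefree n}) g xs (λ n∈ → g≡0 (proj₁ (∈xs⇒S n∈))))
      (∑ᴸ-↭ (map⁺ g (unique-↭
        (Unique.filter⁺ (λ n → em {Squarefree n}) (Unique.filter⁺ (λ n → em {S x y n}) (Unique.upTo⁺ (suc (bound x)))))
        (products-unique N (primesUpTo-prime (Z ⊓ N)) ps-unique)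
        (λ n∈ → let n∈xs , sf = ∈-filter⁻ (λ n → em {Squarefree n}) {xs = xs} n∈
                in ∈-products⁺ (primesUpTo-prime (Z ⊓ N)) (S⇒IsProduct (∈xs⇒S n∈xs) sf))
        (λ n∈ → let P = ∈-products⁻ (primesUpTo-prime (Z ⊓ N)) ps-unique n∈
                    s = IsProduct⇒S P
                in ∈-filter⁺ (λ n → em {Squarefree n})
                     (∈-filter⁺ (λ n → em {S x y n}) (∈-upTo⁺ (s≤s (≤-bound _ x (proj₁ (proj₂ s))))) s) (squarefree P)))))
      where
      xs : List ℕ
      xs = filter (λ n → em {S x y n}) (upTo (suc (bound x)))
      ∈xs⇒S : ∀ {n} → n ∈ xs → S x y n
      ∈xs⇒S n∈ = proj₂ (∈-filter⁻ (λ n → em {S x y n}) {xs = upTo (suc (bound x))} n∈)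

    μ²-vanishes : ∀ {n} → 1 ≤ n → ¬ Squarefree n → μ² n ≡ 0ℤ
    μ²-vanishes 1≤n ¬sf with μ²-spec 1≤n
    ... | inj₁ (sf , _) = contradiction sf ¬sf
    ... | inj₂ (_ , e) = e

    Ψ*≡ : Ψ* em x y ≡ + productCount ps N
    Ψ*≡ = trans (Ψ≡ μ² μ²-vanishes) (∑-μ² N (primesUpTo-prime (Z ⊓ N)) ps-unique)

    Ψ-wintner : ∀ {Ω : Set} (X : ℕ → Ω → Sign) ω →
                Ψ em (wintner X ω) x y ≡ signSum ps N (signs (λ p → X p ω) ps)
    Ψ-wintner X ω = trans
      (Ψ≡ (wintner X ω) (λ {n} 1≤n ¬sf →
        cong (ℤ._* ∏ᴸ (map (λ p → X p ω ◃ 1) (primeDivisors n))) (μ²-vanishes 1≤n ¬sf)))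
      (∑-signed (λ p → X p ω) N (primesUpTo-prime (Z ⊓ N)) ps-unique)

-- Probability

module Probability where

  open import Defs
  open Hypercontractivity using (count)
  open RationalSeries hiding (*-mono-≤)
  open ExponentialSums using (_^ℚ_)
  open RealOrder
  open RealExponential
  open SmoothNumbers using (signs)
  open import Axiom.ExcludedMiddle using (ExcludedMiddle)
  open import Data.Empty using (⊥)
  open import Data.List.Base using ([]; _∷_; length; map)
  open import Data.List.Membership.Propositional using (_∈_)
  open import Data.List.Relation.Unary.All as All using (All; []; _∷_)
  import Data.List.Relation.Unary.AllPairs as AllPairs
  open import Data.List.Relation.Unary.Any using (here; there)
  open import Data.List.Relation.Unary.Unique.Propositional using (Unique)
  open import Data.Nat.Base as ℕ using (ℕ; zero; suc)
  open import Data.Nat.Primality using (Prime)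
  import Data.Nat.Properties as ℕ
  open import Data.Product.Base using (∃; _×_; _,_; proj₁; proj₂)
  open import Data.Rational.Base as ℚ using (ℚ; 0ℚ; ½)
  import Data.Rational.Properties as ℚ
  open import Data.Rational.Solver using (module +-*-Solver)
  open import Data.Sign.Base as Sign using (Sign)
  open import Data.Sum.Base using (inj₁; inj₂)
  open import Data.Unit.Base using (tt)
  open import Data.Vec.Base using (Vec; []; _∷_)
  open import Data.Vec.Properties using (∷-injective)
  open import Function.Base using (_∘_)
  open import Level using (0ℓ)
  open import Relation.Binary.Definitions using (tri<; tri≈; tri>)
  open import Relation.Binary.PropositionalEquality
  open import Relation.Nullary using (Dec; yes; no; ¬_; contradiction)
  open import Relation.Unary using (Pred; _⊆_; _≐_; U; ∁; _∪_; _∩_; Empty)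

  ⟶-lower : ∀ {s L a} → (∀ n → 1 ℕ.≤ n → a ≤ s n) → s ⟶ L → a ≤ L
  ⟶-lower {s} {L} {a} h lim = ≤-approx {a} {L} λ ε 0<ε →
    let N , near = lim (fromℚ ε) (0<fromℚ 0<ε)
    in ≤-trans {a} {s (suc N)} {L + fromℚ ε} (h (suc N) (ℕ.s≤s ℕ.z≤n)) (proj₂ (near (suc N) (ℕ.n≤1+n N)))

  ⟶-upper : ∀ {s L b} → (∀ n → s n ≤ b) → s ⟶ L → L ≤ b
  ⟶-upper {s} {L} {b} h lim = ≤-approx {L} {b} λ ε 0<ε →
    let N , near = lim (fromℚ ε) (0<fromℚ 0<ε)
    in begin
      L                            ≈⟨ pointwise-≃ {L} {(L - fromℚ ε) + fromℚ ε} (λ n →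
                                        solve 2 (λ l e → l := (l :- e) :+ e) refl (seq L n) ε) ⟩
      (L - fromℚ ε) + fromℚ ε      ≲⟨ +-mono-≤ {L - fromℚ ε} {b} {fromℚ ε} {fromℚ ε}
                                        (≤-trans {L - fromℚ ε} {s N} {b} (proj₁ (near N ℕ.≤-refl)) (h N)) (≤-refl (fromℚ ε)) ⟩
      b + fromℚ ε                  ∎
    where
    open ≤-Reasoning
    open +-*-Solver

  +-identityʳ : ∀ x → x + fromℕ 0 ≃ x
  +-identityʳ x = pointwise-≃ {x + fromℕ 0} {x} (λ n → ℚ.+-identityʳ (seq x n))

  +-identityˡ : ∀ x → fromℕ 0 + x ≃ x
  +-identityˡ x = pointwise-≃ {fromℕ 0 + x} {x} (λ n → ℚ.+-identityˡ (seq x n))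

  x≤x+y : ∀ x y → fromℕ 0 ≤ y → x ≤ x + y
  x≤x+y x y 0≤y = ≤-trans {x} {x + fromℕ 0} {x + y} (≃⇒≥ {x + fromℕ 0} {x} (+-identityʳ x)) (+-mono-≤ {x} {x} {fromℕ 0} {y} (≤-refl x) 0≤y)

  ∑-mono : ∀ {s t} n → (∀ k → s k ≤ t k) → ∑ n s ≤ ∑ n t
  ∑-mono zero h = ≤-refl (fromℕ 0)
  ∑-mono {s} {t} (suc n) h = +-mono-≤ {∑ n s} {∑ n t} {s n} {t n} (∑-mono {s} {t} n h) (h n)

  head≤∑ : ∀ {s} → (∀ k → fromℕ 0 ≤ s k) → ∀ n → 1 ℕ.≤ n → s 0 ≤ ∑ n s
  head≤∑ {s} h (suc zero) _ = ≃⇒≥ {fromℕ 0 + s 0} {s 0} (+-identityˡ (s 0))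
  head≤∑ {s} h (suc n@(suc _)) _ = ≤-trans {s 0} {∑ n s} {∑ n s + s n} (head≤∑ {s} h n (ℕ.s≤s ℕ.z≤n)) (x≤x+y (∑ n s) (s n) (h n))

  module Measure (em : ExcludedMiddle 0ℓ) (𝒫 : ProbabilitySpace) where

    open ProbabilitySpace 𝒫

    ∅ : Pred Ω 0ℓ
    ∅ _ = ⊥

    -- A followed by B and empty sets.
    pair : Pred Ω 0ℓ → Pred Ω 0ℓ → ℕ → Pred Ω 0ℓ
    pair A B zero          = A
    pair A B (suc zero)    = B
    pair A B (suc (suc _)) = ∅

    measurable-∅ : Measurable ∅
    measurable-∅ = measurable-resp ((λ ¬tt → ¬tt tt) , λ ()) (measurable-∁ measurable-U)

    pair-measurable : ∀ {A B} → Measurable A → Measurable B → ∀ i → Measurable (pair A B i)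
    pair-measurable mA mB zero = mA
    pair-measurable mA mB (suc zero) = mB
    pair-measurable mA mB (suc (suc _)) = measurable-∅

    ⋃pair : ∀ A B → (λ ω → ∃ λ i → pair A B i ω) ≐ (A ∪ B)
    ⋃pair A B = (λ { (zero , a) → inj₁ a ; (suc zero , b) → inj₂ b }) ,
                (λ { (inj₁ a) → 0 , a ; (inj₂ b) → 1 , b })

    measurable-∪ : ∀ {A B} → Measurable A → Measurable B → Measurable (A ∪ B)
    measurable-∪ {A} {B} mA mB = measurable-resp (⋃pair A B) (measurable-⋃ (pair A B) (pair-measurable mA mB))

    dne : ∀ {P : Set} → ¬ ¬ P → P
    dne {P} ¬¬p with em {P}
    ... | yes p = p
    ... | no ¬p = contradiction ¬p ¬¬p

    measurable-∩ : ∀ {A B} → Measurable A → Measurable B → Measurable (A ∩ B)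
    measurable-∩ {A} {B} mA mB = measurable-resp
      ((λ h → dne (h ∘ inj₁) , dne (h ∘ inj₂)) , λ (a , b) → λ { (inj₁ ¬a) → ¬a a ; (inj₂ ¬b) → ¬b b })
      (measurable-∁ (measurable-∪ (measurable-∁ mA) (measurable-∁ mB)))

    -- The probability of B is the limit of the partial sums for the sequence
    -- A, B - A, ∅, ∅, ..., all of which, from the first on, are at least ℙ A.
    ℙ-mono : ∀ {A B} → Measurable A → Measurable B → A ⊆ B → ℙ A ≤ ℙ B
    ℙ-mono {A} {B} mA mB A⊆B =
      ≤-trans {ℙ A} {ℙ (λ ω → ∃ λ i → C i ω)} {ℙ B}
        (⟶-lower {λ n → ∑ n λ k → ℙ (C k)} {ℙ (λ ω → ∃ λ i → C i ω)} {ℙ A}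
          (head≤∑ {λ k → ℙ (C k)} (λ k → ℙ-nonneg (mC k))) (ℙ-⋃ C mC disjoint))
        (≃⇒≤ {ℙ (λ ω → ∃ λ i → C i ω)} {ℙ B} (ℙ-resp (⊆B , B⊆) (measurable-⋃ C mC)))
      where
      C : ℕ → Pred Ω 0ℓ
      C = pair A (B ∩ ∁ A)
      mC : ∀ i → Measurable (C i)
      mC = pair-measurable mA (measurable-∩ mB (measurable-∁ mA))
      disjoint : ∀ i j → i ≢ j → Empty (C i ∩ C j)
      disjoint zero zero i≢j ω _ = i≢j refl
      disjoint zero (suc zero) _ ω (a , _ , ¬a) = ¬a a
      disjoint (suc zero) zero _ ω ((_ , ¬a) , a) = ¬a a
      disjoint (suc zero) (suc zero) i≢j ω _ = i≢j refl
      disjoint (suc (suc _)) _ _ ω (() , _)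
      disjoint zero (suc (suc _)) _ ω (_ , ())
      disjoint (suc zero) (suc (suc _)) _ ω (_ , ())
      ⊆B : ∀ {ω} → (∃ λ i → C i ω) → B ω
      ⊆B (zero , a) = A⊆B a
      ⊆B (suc zero , b , _) = b
      B⊆ : ∀ {ω} → B ω → ∃ λ i → C i ω
      B⊆ {ω} b with em {A ω}
      ... | yes a = 0 , a
      ... | no ¬a = 1 , b , ¬a

    -- The partial sums n * ℙ ∅ converge, so their increments tend to 0.
    ℙ∅≤0 : ℙ ∅ ≤ fromℕ 0
    ℙ∅≤0 = ≤-approx {ℙ ∅} {fromℕ 0} λ ε 0<ε →
      let h = fromℚ (½ ℚ.* ε)
          N , near = ℙ-⋃ (λ _ → ∅) (λ _ → measurable-∅) (λ _ _ _ _ ()) h (0<fromℚ (half-pos 0<ε))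
          s = ∑ N λ _ → ℙ ∅
          L = ℙ (λ ω → ℕ × ⊥)
      in begin
        ℙ ∅                                  ≈⟨ pointwise-≃ {ℙ ∅} {((L - h) + ℙ ∅) - (L - h)} (λ n →
                                                  solve 3 (λ l h p → p := (l :- h :+ p) :- (l :- h)) refl (seq L n) (½ ℚ.* ε) (seq (ℙ ∅) n)) ⟩
        ((L - h) + ℙ ∅) - (L - h)            ≲⟨ +-mono-≤ {(L - h) + ℙ ∅} {s + ℙ ∅} { - (L - h)} { - (L - h)}
                                                  (+-mono-≤ {L - h} {s} {ℙ ∅} {ℙ ∅} (proj₁ (near N ℕ.≤-refl)) (≤-refl (ℙ ∅))) (≤-refl (- (L - h))) ⟩
        (s + ℙ ∅) - (L - h)                  ≲⟨ +-mono-≤ {s + ℙ ∅} {L + h} { - (L - h)} { - (L - h)} (proj₂ (near (suc N) (ℕ.n≤1+n N))) (≤-refl (- (L - h))) ⟩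
        (L + h) - (L - h)                    ≈⟨ pointwise-≃ {(L + h) - (L - h)} {fromℕ 0 + fromℚ ε} (λ n →
                                                  trans (solve 2 (λ l h → (l :+ h) :- (l :- h) := h :+ h) refl (seq L n) (½ ℚ.* ε))
                                                        (trans (half+half ε) (sym (ℚ.+-identityˡ ε)))) ⟩
        fromℕ 0 + fromℚ ε                    ∎
      where
      open ≤-Reasoning
      open +-*-Solver using (solve; _:=_; _:+_; _:-_)

    -- A is measurable, with probability at most a.
    record AtMost (A : Pred Ω 0ℓ) (a : ℝ) : Set₁ where
      constructor atMost
      field
        isMeasurable : Measurable A
        ℙ≤           : ℙ A ≤ a

    open AtMost

    atMost-resp : ∀ {A B a} → A ≐ B → AtMost A a → AtMost B a
    atMost-resp {A} {B} {a} e (atMost mA h) = atMost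
      (measurable-resp e mA) (≤-trans {ℙ B} {ℙ A} {a} (≃⇒≥ {ℙ A} {ℙ B} (ℙ-resp e mA)) h)

    atMost-weaken : ∀ {A a b} → a ≤ b → AtMost A a → AtMost A b
    atMost-weaken {A} {a} {b} a≤b (atMost mA h) = atMost mA (≤-trans {ℙ A} {a} {b} h a≤b)

    atMost-∅ : AtMost ∅ (fromℕ 0)
    atMost-∅ = atMost measurable-∅ ℙ∅≤0

    atMost-nonNeg : ∀ {A a} → AtMost A a → fromℕ 0 ≤ a
    atMost-nonNeg {A} {a} (atMost mA h) = ≤-trans {fromℕ 0} {ℙ A} {a} (ℙ-nonneg mA) h

    -- Countable subadditivity, by making the sets disjoint.
    atMost-⋃ : ∀ (A : ℕ → Pred Ω 0ℓ) (a : ℕ → ℝ) Q → (∀ i → AtMost (A i) (a i)) → (∀ n → ∑ n a ≤ Q) →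
               AtMost (λ ω → ∃ λ i → A i ω) Q
    atMost-⋃ A a Q bounds total = atMost
      (measurable-⋃ A mA)
      (≤-trans {ℙ (λ ω → ∃ λ i → A i ω)} {ℙ (λ ω → ∃ λ i → D i ω)} {Q}
        (≃⇒≥ {ℙ (λ ω → ∃ λ i → D i ω)} {ℙ (λ ω → ∃ λ i → A i ω)} (ℙ-resp (D⊆A , A⊆D) (measurable-⋃ D mD)))
        (⟶-upper {λ n → ∑ n λ k → ℙ (D k)} {ℙ (λ ω → ∃ λ i → D i ω)} {Q} (λ n →
           ≤-trans {∑ n λ k → ℙ (D k)} {∑ n a} {Q}
             (∑-mono {λ k → ℙ (D k)} {a} n (λ k → ≤-trans {ℙ (D k)} {ℙ (A k)} {a k} (ℙ-mono (mD k) (mA k) proj₁) (ℙ≤ (bounds k))))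
             (total n))
           (ℙ-⋃ D mD disjoint)))
      where
      mA : ∀ i → Measurable (A i)
      mA i = isMeasurable (bounds i)
      before : ℕ → ℕ → Pred Ω 0ℓ
      before i j ω = (j ℕ.< i) × A j ω
      D : ℕ → Pred Ω 0ℓ
      D i ω = A i ω × ¬ (∃ λ j → before i j ω)
      m-before : ∀ i j → Measurable (before i j)
      m-before i j with j ℕ.<? i
      ... | yes j<i = measurable-resp ((λ a → j<i , a) , proj₂) (mA j)
      ... | no j≮i = measurable-resp ((λ ()) , λ (j<i , _) → j≮i j<i) measurable-∅
      mD : ∀ i → Measurable (D i)
      mD i = measurable-∩ (mA i) (measurable-∁ (measurable-⋃ (before i) (m-before i)))
      disjoint : ∀ i j → i ≢ j → Empty (D i ∩ D j)
      disjoint i j i≢j ω ((aᵢ , ¬beforeᵢ) , (aⱼ , ¬beforeⱼ)) with ℕ.<-cmp i j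
      ... | tri< i<j _ _ = ¬beforeⱼ (i , i<j , aᵢ)
      ... | tri≈ _ i≡j _ = i≢j i≡j
      ... | tri> _ _ j<i = ¬beforeᵢ (j , j<i , aⱼ)
      D⊆A : ∀ {ω} → (∃ λ i → D i ω) → ∃ λ i → A i ω
      D⊆A (i , a , _) = i , a
      least : ∀ {ω} n i → i ℕ.≤ n → A i ω → ∃ λ i → D i ω
      least {ω} n i i≤n a with em {∃ λ j → before i j ω}
      ... | no none = i , a , none
      least zero zero _ a | yes (j , () , _)
      least (suc n) i i≤n a | yes (j , j<i , aⱼ) = least n j (ℕ.s≤s⁻¹ (ℕ.≤-trans j<i i≤n)) aⱼ
      A⊆D : ∀ {ω} → (∃ λ i → A i ω) → ∃ λ i → D i ω
      A⊆D (i , a) = least i i ℕ.≤-refl a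

    atMost-∪ : ∀ {A B a b} → AtMost A a → AtMost B b → AtMost (A ∪ B) (a + b)
    atMost-∪ {A} {B} {a} {b} hA hB = atMost-resp (⋃pair A B) (atMost-⋃ (pair A B) c (a + b) bounds total)
      where
      c : ℕ → ℝ
      c zero          = a
      c (suc zero)    = b
      c (suc (suc _)) = fromℕ 0
      bounds : ∀ i → AtMost (pair A B i) (c i)
      bounds zero = hA
      bounds (suc zero) = hB
      bounds (suc (suc _)) = atMost-∅
      0≤a : fromℕ 0 ≤ a
      0≤a = atMost-nonNeg hA
      0≤b : fromℕ 0 ≤ b
      0≤b = atMost-nonNeg hB
      total : ∀ n → ∑ n c ≤ a + b
      total zero = ≤-trans {fromℕ 0} {a} {a + b} 0≤a (x≤x+y a b 0≤b)
      total (suc zero) = ≤-trans {fromℕ 0 + a} {a} {a + b} (≃⇒≤ {fromℕ 0 + a} {a} (+-identityˡ a)) (x≤x+y a b 0≤b)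
      total (suc (suc zero)) = +-mono-≤ {fromℕ 0 + a} {a} {b} {b} (≃⇒≤ {fromℕ 0 + a} {a} (+-identityˡ a)) (≤-refl b)
      total (suc (suc (suc n))) = ≤-trans {∑ (suc (suc n)) c + fromℕ 0} {∑ (suc (suc n)) c} {a + b}
        (≃⇒≤ {∑ (suc (suc n)) c + fromℕ 0} {∑ (suc (suc n)) c} (+-identityʳ (∑ (suc (suc n)) c))) (total (suc (suc n)))

    private
      fromℕ-+-* : ∀ m n a → fromℕ (m ℕ.+ n) * a ≃ fromℕ m * a + fromℕ n * a
      fromℕ-+-* m n a = pointwise-≃ {fromℕ (m ℕ.+ n) * a} {fromℕ m * a + fromℕ n * a} (λ k →
        trans (cong (ℚ._* seq a k) (ι-+ m n)) (ℚ.*-distribʳ-+ (seq a k) (ι m) (ι n)))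

      atMost-+ : ∀ {A B} m n a → AtMost A (fromℕ m * a) → AtMost B (fromℕ n * a) → AtMost (A ∪ B) (fromℕ (m ℕ.+ n) * a)
      atMost-+ m n a hA hB = atMost-weaken {a = fromℕ m * a + fromℕ n * a} {fromℕ (m ℕ.+ n) * a}
        (≃⇒≥ {fromℕ (m ℕ.+ n) * a} {fromℕ m * a + fromℕ n * a} (fromℕ-+-* m n a)) (atMost-∪ hA hB)

      atMost-∅* : ∀ a → AtMost ∅ (fromℕ 0 * a)
      atMost-∅* a = atMost-weaken {a = fromℕ 0} {fromℕ 0 * a}
        (≃⇒≥ {fromℕ 0 * a} {fromℕ 0} (pointwise-≃ {fromℕ 0 * a} {fromℕ 0} (λ k → ℚ.*-zeroˡ (seq a k)))) atMost-∅

      atMost-1* : ∀ {A} a → AtMost A a → AtMost A (fromℕ 1 * a)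
      atMost-1* a = atMost-weaken {a = a} {fromℕ 1 * a} (≃⇒≥ {fromℕ 1 * a} {a} (*-identityˡ a))

    atMost-⋃< : ∀ l (A : ℕ → Pred Ω 0ℓ) a → (∀ i → AtMost (A i) a) →
                AtMost (λ ω → ∃ λ i → (i ℕ.< l) × A i ω) (fromℕ l * a)
    atMost-⋃< zero A a h = atMost-resp ((λ ()) , λ ()) (atMost-∅* a)
    atMost-⋃< (suc l) A a h =
      atMost-resp (join , split) (atMost-+ 1 l a (atMost-1* a (h l)) (atMost-⋃< l A a h))
      where
      join : ∀ {ω} → (A l ∪ (λ ω → ∃ λ i → (i ℕ.< l) × A i ω)) ω → ∃ λ i → (i ℕ.< suc l) × A i ω
      join (inj₁ a) = l , ℕ.≤-refl , a
      join (inj₂ (i , i<l , a)) = i , ℕ.≤-trans i<l (ℕ.n≤1+n l) , a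
      split : ∀ {ω} → (∃ λ i → (i ℕ.< suc l) × A i ω) → (A l ∪ (λ ω → ∃ λ i → (i ℕ.< l) × A i ω)) ω
      split (i , i<1+l , a) with i ℕ.≟ l
      ... | yes refl = inj₁ a
      ... | no i≢l = inj₂ (i , ℕ.≤∧≢⇒< (ℕ.s≤s⁻¹ i<1+l) i≢l , a)

    atMost-⋃± : ∀ m {P : Vec Sign m → Set} (P? : ∀ σ → Dec (P σ)) (A : Vec Sign m → Pred Ω 0ℓ) a →
                (∀ σ → AtMost (A σ) a) → AtMost (λ ω → ∃ λ σ → P σ × A σ ω) (fromℕ (count m P?) * a)
    atMost-⋃± zero P? A a h with P? []
    ... | yes p = atMost-resp ((λ x → [] , p , x) , λ { ([] , _ , x) → x }) (atMost-1* a (h []))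
    ... | no ¬p = atMost-resp ((λ ()) , λ { ([] , p , _) → ¬p p }) (atMost-∅* a)
    atMost-⋃± (suc m) P? A a h =
      atMost-resp ((λ { (inj₁ (σ , p , x)) → (Sign.+ ∷ σ) , p , x ; (inj₂ (σ , p , x)) → (Sign.- ∷ σ) , p , x }) ,
                   (λ { ((Sign.+ ∷ σ) , p , x) → inj₁ (σ , p , x) ; ((Sign.- ∷ σ) , p , x) → inj₂ (σ , p , x) }))
        (atMost-+ (count m _) (count m _) a
          (atMost-⋃± m (λ σ → P? (Sign.+ ∷ σ)) (λ σ → A (Sign.+ ∷ σ)) a (λ σ → h (Sign.+ ∷ σ)))
          (atMost-⋃± m (λ σ → P? (Sign.- ∷ σ)) (λ σ → A (Sign.- ∷ σ)) a (λ σ → h (Sign.- ∷ σ))))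

    -- The Borel-Cantelli lemma, for probabilities bounded by the differences of a
    -- null sequence.
    module BorelCantelli (B : ℕ → Pred Ω 0ℓ) (t : ℕ → ℚ) (t≥0 : ∀ n → 0ℚ ℚ.≤ t n)
      (t-null : ∀ ε → 0ℚ ℚ.< ε → ∃ λ n → t n ℚ.≤ ε)
      (bounds : ∀ n → AtMost (B n) (fromℚ (t n ℚ.- t (suc n)))) where

      -- One of the events with index at least n occurs.
      Tail : ℕ → Pred Ω 0ℓ
      Tail n ω = ∃ λ k → B (k ℕ.+ n) ω

      private
        partial : ∀ n j i → seq (∑ j λ k → fromℚ (t (k ℕ.+ n) ℚ.- t (suc (k ℕ.+ n)))) i ≡ t n ℚ.- t (j ℕ.+ n)
        partial n zero i = sym (ℚ.+-inverseʳ (t n))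
        partial n (suc j) i = trans (cong (ℚ._+ (t (j ℕ.+ n) ℚ.- t (suc (j ℕ.+ n)))) (partial n j i))
          (solve 3 (λ a b c → (a :- b) :+ (b :- c) := a :- c) refl (t n) (t (j ℕ.+ n)) (t (suc (j ℕ.+ n))))
          where open +-*-Solver

      tail-atMost : ∀ n → AtMost (Tail n) (fromℚ (t n))
      tail-atMost n = atMost-⋃ (λ k → B (k ℕ.+ n)) (λ k → fromℚ (t (k ℕ.+ n) ℚ.- t (suc (k ℕ.+ n)))) (fromℚ (t n))
        (λ k → bounds (k ℕ.+ n))
        (λ j → pointwise-≤ {∑ j λ k → fromℚ (t (k ℕ.+ n) ℚ.- t (suc (k ℕ.+ n)))} {fromℚ (t n)} (λ i →
          ℚ.≤-trans (ℚ.≤-reflexive (partial n j i)) (p≤q+r⇒p-q≤r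
            (ℚ.≤-trans (p≤p+q (t n) (t≥0 (j ℕ.+ n))) (ℚ.≤-reflexive (ℚ.+-comm (t n) (t (j ℕ.+ n))))))))

      -- Only finitely many of the events occur.
      FinitelyMany : Pred Ω 0ℓ
      FinitelyMany ω = ∃ λ n → ¬ Tail n ω

      measurable-finitelyMany : Measurable FinitelyMany
      measurable-finitelyMany = measurable-⋃ (λ n → ∁ (Tail n)) (λ n → measurable-∁ (isMeasurable (tail-atMost n)))

      finitelyMany-certain : ℙ FinitelyMany ≃ fromℕ 1
      finitelyMany-certain = ≤-antisym {ℙ FinitelyMany} {fromℕ 1}
        (≤-trans {ℙ FinitelyMany} {ℙ U} {fromℕ 1} (ℙ-mono measurable-finitelyMany measurable-U (λ _ → tt)) (≃⇒≤ {ℙ U} {fromℕ 1} ℙ-U))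
        (≤-approx {fromℕ 1} {ℙ FinitelyMany} λ ε 0<ε → let n , tn≤ε = t-null ε 0<ε in begin
          fromℕ 1                               ≈⟨ ℙ-U ⟨
          ℙ U                                   ≲⟨ ℙ-mono measurable-U (isMeasurable (cover n)) (λ {ω} _ → covers n ω) ⟩
          ℙ (FinitelyMany ∪ Tail n)             ≲⟨ ℙ≤ (cover n) ⟩
          ℙ FinitelyMany + fromℚ (t n)          ≲⟨ +-mono-≤ {ℙ FinitelyMany} {ℙ FinitelyMany} {fromℚ (t n)} {fromℚ ε}
                                                     (≤-refl (ℙ FinitelyMany)) (fromℚ-mono tn≤ε) ⟩
          ℙ FinitelyMany + fromℚ ε              ∎)
        where
        open ≤-Reasoning
        cover : ∀ n → AtMost (FinitelyMany ∪ Tail n) (ℙ FinitelyMany + fromℚ (t n))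
        cover n = atMost-∪ (atMost measurable-finitelyMany (≤-refl (ℙ FinitelyMany))) (tail-atMost n)
        covers : ∀ n ω → (FinitelyMany ∪ Tail n) ω
        covers n ω with em {Tail n ω}
        ... | yes b = inj₂ b
        ... | no ¬b = inj₁ (n , ¬b)

    module Rademacher (X : ℕ → Ω → Sign) (rademacher : IsRademacher 𝒫 X) where

      open IsRademacher rademacher

      signs-cong : ∀ {s s′ : ℕ → Sign} ps → (∀ {p} → p ∈ ps → s p ≡ s′ p) → signs s ps ≡ signs s′ ps
      signs-cong [] h = refl
      signs-cong (p ∷ ps) h = cong₂ _∷_ (h (here refl)) (signs-cong ps (h ∘ there))

      -- Distinct primes can be given arbitrary signs.
      prescribe : ∀ ps → Unique ps → (σ : Vec Sign (length ps)) → ∃ λ s → signs s ps ≡ σ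
      prescribe [] _ [] = (λ _ → Sign.+) , refl
      prescribe (p ∷ ps) (p∉ps AllPairs.∷ uniq) (b ∷ σ) =
        let s , e = prescribe ps uniq σ
        in update s , cong₂ _∷_ (update-≡ s) (trans (signs-cong ps (λ q∈ → update-≢ s (All.lookup p∉ps q∈))) e)
        where
        update : (ℕ → Sign) → ℕ → Sign
        update s q with p ℕ.≟ q
        ... | yes _ = b
        ... | no _ = s q
        update-≡ : ∀ (s : ℕ → Sign) → update s p ≡ b
        update-≡ s with p ℕ.≟ p
        ... | yes _ = refl
        ... | no p≢p = contradiction refl p≢p
        update-≢ : ∀ (s : ℕ → Sign) {q} → p ≢ q → update s q ≡ s q
        update-≢ s {q} p≢q with p ℕ.≟ q
        ... | yes p≡q = contradiction p≡q p≢q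
        ... | no _ = refl

      -- The values of X at the entries of ps.
      signsAt : Ω → ∀ ps → Vec Sign (length ps)
      signsAt ω = signs (λ p → X p ω)

      agree : ∀ (s : ℕ → Sign) ps → (λ ω → All (λ p → X p ω ≡ s p) ps) ≐ (λ ω → signsAt ω ps ≡ signs s ps)
      agree s ps = to ps , from ps
        where
        to : ∀ ps {ω} → All (λ p → X p ω ≡ s p) ps → signsAt ω ps ≡ signs s ps
        to [] [] = refl
        to (p ∷ ps) (h ∷ hs) = cong₂ _∷_ h (to ps hs)
        from : ∀ ps {ω} → signsAt ω ps ≡ signs s ps → All (λ p → X p ω ≡ s p) ps
        from [] _ = []
        from (p ∷ ps) e = let h , hs = ∷-injective e in h ∷ from ps hs

      measurable-agree : ∀ (s : ℕ → Sign) {ps} → All Prime ps → Measurable (λ ω → All (λ p → X p ω ≡ s p) ps)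
      measurable-agree s [] = measurable-resp ((λ _ → []) , λ _ → tt) measurable-U
      measurable-agree s (pr ∷ prs) = measurable-resp ((λ (h , hs) → h ∷ hs) , λ { (h ∷ hs) → h , hs })
        (measurable-∩ (measurable pr (s _)) (measurable-agree s prs))

      ∏-half : ∀ (s : ℕ → Sign) {ps} → All Prime ps → ∏ (map (λ p → ℙ (λ ω → X p ω ≡ s p)) ps) ≃ fromℚ (½ ^ℚ length ps)
      ∏-half s [] = ≃-refl (fromℕ 1)
      ∏-half s {p ∷ ps} (pr ∷ prs) = ≃-trans {ℙ (λ ω → X p ω ≡ s p) * rest} {fromℚ ½ * fromℚ h} {fromℚ (½ ^ℚ suc (length ps))}
        (*-cong {ℙ (λ ω → X p ω ≡ s p)} {fromℚ ½} {rest} {fromℚ h} (fair pr (s p)) (∏-half s prs))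
        (pointwise-≃ {fromℚ ½ * fromℚ h} {fromℚ (½ ^ℚ suc (length ps))} (λ _ → refl))
        where
        rest : ℝ
        rest = ∏ (map (λ p → ℙ (λ ω → X p ω ≡ s p)) ps)
        h : ℚ
        h = ½ ^ℚ length ps

      -- Each sign vector at m distinct primes has probability 2 ^ (- m).
      cylinder : ∀ {ps} → All Prime ps → Unique ps → ∀ σ → AtMost (λ ω → signsAt ω ps ≡ σ) (fromℚ (½ ^ℚ length ps))
      cylinder {ps} prs uniq σ with prescribe ps uniq σ
      ... | s , refl = atMost-resp (agree s ps)
        (atMost (measurable-agree s prs)
         (≃⇒≤ {ℙ C} {fromℚ (½ ^ℚ length ps)} (≃-trans {ℙ C} {∏ (map (λ p → ℙ (λ ω → X p ω ≡ s p)) ps)} {fromℚ (½ ^ℚ length ps)}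
           (independent ps prs uniq s) (∏-half s prs))))
        where
        C : Pred Ω 0ℓ
        C ω = All (λ p → X p ω ≡ s p) ps

      signs-atMost : ∀ {ps} → All Prime ps → Unique ps → {P : Vec Sign (length ps) → Set} (P? : ∀ σ → Dec (P σ)) →
        AtMost (λ ω → P (signsAt ω ps)) (fromℕ (count (length ps) P?) * fromℚ (½ ^ℚ length ps))
      signs-atMost {ps} prs uniq {P} P? =
        atMost-resp ((λ (σ , p , e) → subst P (sym e) p) , (λ {ω} p → signsAt ω ps , p , refl))
          (atMost-⋃± (length ps) P? (λ σ ω → signsAt ω ps ≡ σ) (fromℚ (½ ^ℚ length ps)) (cylinder prs uniq))

-- The almost sure bound

open import Defs
open Hypercontractivity using (momentConstant; moment-bound; count; count-*; power; power-abs; ∑±-0; square-nonNeg; Deg<)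
open RestrictedProducts
open Chebyshev using (primesUpTo; primesUpTo-prime; primesUpTo-length; ^-cancelʳ-≤)
open Counting
open RationalSeries hiding (*-mono-≤)
open ExponentialSums using (_^ℚ_)
open RealOrder
open RealExponential
open RealLogarithm
open SmoothNumbers
open Probability
open import Axiom.ExcludedMiddle using (ExcludedMiddle)
open import Data.Integer.Base as ℤ using (ℤ; +_; 0ℤ)
import Data.Integer.Properties as ℤ
open import Data.List.Base using (List; length)
import Data.List.Relation.Unary.Unique.Propositional.Properties as Unique
open import Data.List.Relation.Unary.Unique.Propositional using (Unique)
open import Data.Nat.Base as ℕ using (ℕ; zero; suc)
open import Data.Nat.Primality using (prime?)
import Data.Nat.Properties as ℕ
open import Data.Nat.Solver using (module +-*-Solver)
open import Data.Product.Base using (∃; _×_; _,_; proj₁; proj₂)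
open import Data.Rational.Base as ℚ using (ℚ; 0ℚ; 1ℚ; ½)
import Data.Rational.Properties as ℚ
import Data.Rational.Solver
module QS = Data.Rational.Solver.+-*-Solver
open import Data.Sign.Base using (Sign)
open import Data.Sum.Base using (inj₁; inj₂)
open import Data.Vec.Base using (Vec)
open import Level using (0ℓ)
open import Relation.Binary.PropositionalEquality
open import Relation.Nullary using (Dec; yes; no; ¬_; contradiction)
open import Relation.Unary using (Pred)

momentConstant-pos : ∀ r → 1 ℕ.≤ momentConstant r
momentConstant-pos zero = ℕ.≤-refl
momentConstant-pos (suc r) = ℕ.*-mono-≤ (ℕ.m^n>0 9 (2 ℕ.^ r)) (ℕ.*-mono-≤ (momentConstant-pos r) (momentConstant-pos r))

0<fromℕ : ∀ {n} → 1 ℕ.≤ n → fromℕ 0 < fromℕ n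
0<fromℕ 1≤n = 0<fromℚ (ℚ.<-≤-trans (ℚ.positive⁻¹ 1ℚ) (ι-mono 1≤n))

-- 1 / (n + 1)
recip : ℕ → ℚ
recip n = ℚ.1/ (ι (suc n))

ι*recip : ∀ n → ι (suc n) ℚ.* recip n ≡ 1ℚ
ι*recip n = ℚ.*-inverseʳ (ι (suc n))

recip-pos : ∀ n → 0ℚ ℚ.< recip n
recip-pos n = ℚ.positive⁻¹ (recip n) {{ℚ.1/pos⇒pos (ι (suc n))}}

recip-null : ∀ ε → 0ℚ ℚ.< ε → ∃ λ n → recip n ℚ.≤ ε
recip-null ε 0<ε =
  let n , 1≤nε = archimedean-* 1ℚ 0<ε in n ,
  ℚ.*-cancelˡ-≤-pos (ι (suc n)) (ℚ.≤-trans (ℚ.≤-reflexive (ι*recip n)) (ℚ.≤-trans 1≤nε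
    (ℚ.*-monoʳ-≤-nonNeg ε {{ℚ.nonNegative (ℚ.<⇒≤ 0<ε)}} (ι-mono (ℕ.n≤1+n n)))))

-- 1 / ((n + 1) (n + 2))
gap : ℕ → ℚ
gap n = recip n ℚ.- recip (suc n)

ι*gap : ∀ n → ι (suc n ℕ.* suc (suc n)) ℚ.* gap n ≡ 1ℚ
ι*gap n = begin
  ι (suc n ℕ.* suc (suc n)) ℚ.* gap n
    ≡⟨ cong (ℚ._* gap n) (ι-* (suc n) (suc (suc n))) ⟩
  a ℚ.* b ℚ.* (recip n ℚ.- recip (suc n))
    ≡⟨ QS.solve 4 (λ a b x y → a QS.:* b QS.:* (x QS.:- y) QS.:= (a QS.:* x) QS.:* b QS.:- a QS.:* (b QS.:* y)) refl a b (recip n) (recip (suc n)) ⟩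
  a ℚ.* recip n ℚ.* b ℚ.- a ℚ.* (b ℚ.* recip (suc n))
    ≡⟨ cong₂ (λ x y → x ℚ.* b ℚ.- a ℚ.* y) (ι*recip n) (ι*recip (suc n)) ⟩
  1ℚ ℚ.* b ℚ.- a ℚ.* 1ℚ
    ≡⟨ cong (λ z → 1ℚ ℚ.* z ℚ.- a ℚ.* 1ℚ) (ι-+ 1 (suc n)) ⟩
  1ℚ ℚ.* (1ℚ ℚ.+ a) ℚ.- a ℚ.* 1ℚ
    ≡⟨ QS.solve 1 (λ a → QS.con 1ℚ QS.:* (QS.con 1ℚ QS.:+ a) QS.:- a QS.:* QS.con 1ℚ QS.:= QS.con 1ℚ) refl a ⟩
  1ℚ ∎
  where
  open ≡-Reasoning
  a b : ℚ
  a = ι (suc n)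
  b = ι (suc (suc n))

gap-pos : ∀ n → 0ℚ ℚ.< gap n
gap-pos n = ℚ.*-cancelˡ-<-nonNeg (ι (suc n ℕ.* suc (suc n)))
  (subst₂ ℚ._<_ (sym (ℚ.*-zeroʳ (ι (suc n ℕ.* suc (suc n))))) (sym (ι*gap n)) (ℚ.positive⁻¹ 1ℚ))

½^-* : ∀ m → ι (2 ℕ.^ m) ℚ.* ½ ^ℚ m ≡ 1ℚ
½^-* zero = refl
½^-* (suc m) = begin
  ι (2 ℕ.* 2 ℕ.^ m) ℚ.* (½ ℚ.* ½ ^ℚ m)
    ≡⟨ cong (ℚ._* (½ ℚ.* ½ ^ℚ m)) (ι-* 2 (2 ℕ.^ m)) ⟩
  ι 2 ℚ.* ι (2 ℕ.^ m) ℚ.* (½ ℚ.* ½ ^ℚ m)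
    ≡⟨ QS.solve 4 (λ a b c d → a QS.:* b QS.:* (c QS.:* d) QS.:= (a QS.:* c) QS.:* (b QS.:* d)) refl (ι 2) (ι (2 ℕ.^ m)) ½ (½ ^ℚ m) ⟩
  1ℚ ℚ.* (ι (2 ℕ.^ m) ℚ.* ½ ^ℚ m)
    ≡⟨ trans (ℚ.*-identityˡ _) (½^-* m) ⟩
  1ℚ ∎
  where open ≡-Reasoning

private
  cancel-scale : ∀ c r n h g δ .{{_ : ℚ.Positive c}} .{{_ : ℚ.Positive r}} → r ℚ.* δ ≡ g → c ℚ.* g ≡ 1ℚ →
                 n ℚ.* (r ℚ.* c) ℚ.* h ℚ.≤ 1ℚ → n ℚ.* h ℚ.≤ δ
  cancel-scale c r n h g δ rδ≡g cg≡1 le = ℚ.*-cancelˡ-≤-pos r (ℚ.*-cancelˡ-≤-pos c (begin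
    c ℚ.* (r ℚ.* (n ℚ.* h))    ≡⟨ QS.solve 4 (λ c r n h → c QS.:* (r QS.:* (n QS.:* h)) QS.:= n QS.:* (r QS.:* c) QS.:* h) refl c r n h ⟩
    n ℚ.* (r ℚ.* c) ℚ.* h      ≤⟨ le ⟩
    1ℚ                         ≡⟨ cg≡1 ⟨
    c ℚ.* g                    ≡⟨ cong (c ℚ.*_) rδ≡g ⟨
    c ℚ.* (r ℚ.* δ)            ∎))
    where open ℚ.≤-Reasoning

module AlmostSure (em : ExcludedMiddle 0ℓ) (ε : ℝ) (0<ε : fromℕ 0 < ε) where

  open RealPower em ε 0<ε using (r; 1≤power; ≤-power)
  open Admissible (momentConstant r) (momentConstant-pos r)

  -- The order of the moment, and the exponent of the threshold for it.  The summand 13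
  -- makes the probability at most v ^ (-12), which is still summable over v after
  -- multiplication by the number range v of possible values of Y.
  order threshold : ℕ
  order     = 2 ℕ.^ suc r
  threshold = 2 ℕ.^ r ℕ.+ 13

  -- Y and N are in the range considered, and the sum for them has v terms.
  record Scale (v Y N : ℕ) : Set where
    field
      Y≤N       : Y ℕ.≤ N
      condition : Condition N Y
      Y₀≤Y      : Y₀ ℕ.≤ Y
      size      : productCount (primesUpTo Y) N ≡ v

  open Scale

  -- A sum over Y-smooth integers with v terms exceeds the threshold.
  Large : ∀ v Y → Vec Sign (length (primesUpTo Y)) → Set
  Large v Y σ = ∃ λ N → Scale v Y N × v ℕ.^ threshold ℕ.< ℤ.∣ signSum (primesUpTo Y) N σ ∣ ℕ.^ order

  Large? : ∀ v Y σ → Dec (Large v Y σ)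
  Large? v Y σ = em

  scale-pos : ∀ {v Y N} → Scale v Y N → 1 ℕ.≤ v
  scale-pos {Y = Y} {N} sc = subst (1 ℕ.≤_) (size sc)
    (productCount-pos (primesUpTo Y) (ℕ.≤-trans (ℕ.s≤s ℕ.z≤n) (ℕ.≤-trans 625≤Y₀ (ℕ.≤-trans (Y₀≤Y sc) (Y≤N sc)))))

  -- All N with the same v give the same sum, so Markov's inequality is
  -- applied to just one of them.
  count-Large : ∀ v Y → count _ (Large? v Y) ℕ.* v ℕ.^ 12 ℕ.≤ 2 ℕ.^ length (primesUpTo Y)
  count-Large v Y with em {∃ (Scale v Y)}
  ... | no none = ℕ.≤-trans (ℤ.drop‿+≤+ (ℤ.≤-trans
          (count-* m (Large? v Y) (v ℕ.^ 12) {λ _ → 0ℤ} (λ σ → ℤ.≤-refl) (λ σ (N , sc , _) → contradiction (N , sc) none))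
          (ℤ.≤-reflexive (∑±-0 m)))) ℕ.z≤n
    where
    m : ℕ
    m = length (primesUpTo Y)
  ... | yes (N , sc) with K^degree≤ (Y≤N sc) (condition sc) (Y₀≤Y sc)
  ...   | d , degree , K^d≤ = ℕ.*-cancelʳ-≤ (c ℕ.* v ℕ.^ 12) (2 ℕ.^ m) (v ℕ.^ (k ℕ.+ 1)) {{ℕ.>-nonZero (ℕ.m^n>0 v {{ℕ.>-nonZero (scale-pos sc)}} (k ℕ.+ 1))}} (begin
      c ℕ.* v ℕ.^ 12 ℕ.* v ℕ.^ (k ℕ.+ 1)
        ≡⟨ trans (ℕ.*-assoc c (v ℕ.^ 12) (v ℕ.^ (k ℕ.+ 1))) (cong (c ℕ.*_) (trans (sym (ℕ.^-distribˡ-+-* v 12 (k ℕ.+ 1)))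
             (cong (v ℕ.^_) (solve 1 (λ k → con 12 :+ (k :+ con 1) := k :+ con 13) refl k)))) ⟩
      c ℕ.* v ℕ.^ threshold
        ≤⟨ ℤ.drop‿+≤+ (ℤ.≤-trans
             (count-* m (Large? v Y) (v ℕ.^ threshold) {power (suc r) g} (λ σ → square-nonNeg (power r g σ)) exceeds)
             (moment-bound m r d v g (subst (λ e → Deg< e g) degree (deg-signSum ps N))
               (trans (signSum-second-moment ps N) (cong (λ w → + (2 ℕ.^ m ℕ.* w)) (size sc))))) ⟩
      momentConstant r ℕ.^ d ℕ.* (2 ℕ.^ m ℕ.* v ℕ.^ k)
        ≤⟨ ℕ.*-monoˡ-≤ (2 ℕ.^ m ℕ.* v ℕ.^ k) (subst (momentConstant r ℕ.^ d ℕ.≤_) (size sc) K^d≤) ⟩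
      v ℕ.* (2 ℕ.^ m ℕ.* v ℕ.^ k)
        ≡⟨ trans (solve 3 (λ v M x → v :* (M :* x) := M :* (x :* (v :* con 1))) refl v (2 ℕ.^ m) (v ℕ.^ k))
             (cong (2 ℕ.^ m ℕ.*_) (sym (ℕ.^-distribˡ-+-* v k 1))) ⟩
      2 ℕ.^ m ℕ.* v ℕ.^ (k ℕ.+ 1) ∎)
    where
    open ℕ.≤-Reasoning
    open +-*-Solver
    ps : List ℕ
    ps = primesUpTo Y
    m c k : ℕ
    m = length ps
    c = count m (Large? v Y)
    k = 2 ℕ.^ r
    g : Vec Sign m → ℤ
    g = signSum ps N
    exceeds : ∀ σ → Large v Y σ → + (v ℕ.^ threshold) ℤ.≤ power (suc r) g σ
    exceeds σ (N′ , sc′ , lt) = subst (+ (v ℕ.^ threshold) ℤ.≤_) (sym (power-abs r g σ))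
      (ℤ.+≤+ (ℕ.≤-trans (ℕ.<⇒≤ lt) (ℕ.≤-reflexive (cong (λ z → ℤ.∣ z ∣ ℕ.^ order)
        (signSum-cong ps N′ N (trans (size sc′) (sym (size sc))) σ)))))

  -- Y < range v whenever some sum over Y-smooth integers has v terms; a successor, so
  -- that division by it is possible.
  range : ℕ → ℕ
  range v = suc (suc v ℕ.^ 4)

  range-bound : ∀ v → 2 ℕ.≤ v → range v ℕ.* (suc v ℕ.* suc (suc v)) ℕ.≤ v ℕ.^ 12
  range-bound v 2≤v = ℕ.≤-trans
    (ℕ.*-mono-≤ {range v} {w ℕ.^ 4} {suc v ℕ.* w} {w ℕ.* w} (ℕ.^-monoˡ-< 4 (ℕ.n<1+n (suc v))) (ℕ.*-monoˡ-≤ w (ℕ.n≤1+n (suc v))))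
    (generic w v 2+v≤v²)
    where
    w : ℕ
    w = suc (suc v)
    generic : ∀ w v → w ℕ.≤ v ℕ.^ 2 → w ℕ.^ 4 ℕ.* (w ℕ.* w) ℕ.≤ v ℕ.^ 12
    generic w v w≤v² = begin
      w ℕ.^ 4 ℕ.* (w ℕ.* w)    ≡⟨ cong (λ z → w ℕ.^ 4 ℕ.* (w ℕ.* z)) (sym (ℕ.*-identityʳ w)) ⟩
      w ℕ.^ 4 ℕ.* w ℕ.^ 2      ≡⟨ ℕ.^-distribˡ-+-* w 4 2 ⟨
      w ℕ.^ 6                  ≤⟨ ℕ.^-monoˡ-≤ 6 w≤v² ⟩
      (v ℕ.^ 2) ℕ.^ 6          ≡⟨ ℕ.^-*-assoc v 2 6 ⟩
      v ℕ.^ 12                 ∎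
      where open ℕ.≤-Reasoning
    2+v≤v² : suc (suc v) ℕ.≤ v ℕ.^ 2
    2+v≤v² = begin
      2 ℕ.+ v       ≤⟨ ℕ.+-monoˡ-≤ v 2≤v ⟩
      v ℕ.+ v       ≡⟨ cong (v ℕ.+_) (sym (ℕ.+-identityʳ v)) ⟩
      2 ℕ.* v       ≤⟨ ℕ.*-monoˡ-≤ v 2≤v ⟩
      v ℕ.* v       ≡⟨ cong (v ℕ.*_) (sym (ℕ.*-identityʳ v)) ⟩
      v ℕ.^ 2       ∎
      where open ℕ.≤-Reasoning

  -- A sum over Y-smooth integers with at least v₀ terms has Y ≥ Y₀.
  v₀ : ℕ
  v₀ = 2 ℕ.^ suc Y₀

  2≤v₀ : 2 ℕ.≤ v₀
  2≤v₀ = ℕ.^-monoʳ-≤ 2 {1} {suc Y₀} (ℕ.s≤s ℕ.z≤n)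

  module _ (𝒫 : ProbabilitySpace) (X : ℕ → ProbabilitySpace.Ω 𝒫 → Sign) (rademacher : IsRademacher 𝒫 X) where

    open ProbabilitySpace 𝒫
    open Measure em 𝒫
    open Rademacher X rademacher

    -- For some Y a sum over Y-smooth integers with v ≥ v₀ terms is too large.
    Bad : ℕ → Pred Ω 0ℓ
    Bad v ω = ∃ λ Y → (Y ℕ.< range v) × (v₀ ℕ.≤ v) × Large v Y (signsAt ω (primesUpTo Y))

    bad-atMost : ∀ v → AtMost (Bad v) (fromℚ (gap v))
    bad-atMost v with v₀ ℕ.≤? v
    ... | no v₀≰v = atMost-resp ((λ ()) , λ (_ , _ , v₀≤v , _) → v₀≰v v₀≤v)
                      (atMost-weaken {a = fromℕ 0} {fromℚ (gap v)} (fromℚ-mono (ℚ.<⇒≤ (gap-pos v))) atMost-∅)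
    ... | yes v₀≤v = atMost-weaken {a = fromℕ (range v) * fromℚ δ} {fromℚ (gap v)}
        (pointwise-≤ {fromℕ (range v) * fromℚ δ} {fromℚ (gap v)} (λ _ → ℚ.≤-reflexive rangeδ))
        (atMost-resp ((λ (Y , Y< , large) → Y , Y< , v₀≤v , large) , λ (Y , Y< , _ , large) → Y , Y< , large)
          (atMost-⋃< (range v) (λ Y ω → Large v Y (signsAt ω (primesUpTo Y))) (fromℚ δ) each))
      where
      δ : ℚ
      δ = proj₁ (divide (suc v ℕ.^ 4) (gap-pos v))
      rangeδ : ι (range v) ℚ.* δ ≡ gap v
      rangeδ = proj₂ (proj₂ (divide (suc v ℕ.^ 4) (gap-pos v)))
      c : ℕ
      c = suc v ℕ.* suc (suc v)
      each : ∀ Y → AtMost (λ ω → Large v Y (signsAt ω (primesUpTo Y))) (fromℚ δ)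
      each Y = atMost-weaken {a = fromℕ n * fromℚ h} {fromℚ δ}
        (pointwise-≤ {fromℕ n * fromℚ h} {fromℚ δ} (λ _ → small))
        (signs-atMost (primesUpTo-prime Y) (Unique.filter⁺ prime? (Unique.upTo⁺ (suc Y))) (Large? v Y))
        where
        m n : ℕ
        m = length (primesUpTo Y)
        n = count m (Large? v Y)
        h : ℚ
        h = ½ ^ℚ m
        0≤h : ∀ m → 0ℚ ℚ.≤ ½ ^ℚ m
        0≤h zero = ℚ.nonNegative⁻¹ 1ℚ
        0≤h (suc m) = 0≤p*q (ℚ.nonNegative⁻¹ ½) (0≤h m)
        total : n ℕ.* (range v ℕ.* c) ℕ.≤ 2 ℕ.^ m
        total = ℕ.≤-trans (ℕ.*-monoʳ-≤ n (range-bound v (ℕ.≤-trans 2≤v₀ v₀≤v))) (count-Large v Y)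
        small : ι n ℚ.* h ℚ.≤ δ
        small = cancel-scale (ι c) (ι (range v)) (ι n) h (gap v) δ rangeδ (ι*gap v)
          (ℚ.≤-trans (ℚ.≤-reflexive (cong (ℚ._* h) (trans (cong (ι n ℚ.*_) (sym (ι-* (range v) c))) (sym (ι-* n (range v ℕ.* c))))))
            (ℚ.≤-trans (ℚ.*-monoʳ-≤-nonNeg h {{ℚ.nonNegative (0≤h m)}} (ι-mono total)) (ℚ.≤-reflexive (½^-* m))))

    open BorelCantelli Bad recip (λ n → ℚ.<⇒≤ (recip-pos n)) recip-null bad-atMost public

    -- Outside the bad events the bound holds, with a constant exceeding every v
    -- that is not covered.
    bound-at-integers : ∀ {ω} n → ¬ Tail n ω → ∀ x y N Z →
      fromℕ N ≤ x → (∀ n → fromℕ n ≤ x → n ℕ.≤ N) →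
      fromℕ Z ≤ y → (∀ n → fromℕ n ≤ y → n ℕ.≤ Z) → y ≤ fromℕ (suc Z) →
      fromℕ 2 ≤ x → fromℕ 2 ≤ y → fromℕ A * log em x ≤ y →
      fromℕ ℤ.∣ Ψ em (wintner X ω) x y ∣ ≤ fromℕ (suc (n ℕ.+ v₀)) * (fromℤ (Ψ* em x y) ^[ em ] (fromℚ ½ + ε))
    bound-at-integers {ω} n ¬tail x y N Z N≤x N-max Z≤y Z-max y<Z+1 2≤x 2≤y Alog≤y = conclude (suc (n ℕ.+ v₀) ℕ.≤? v)
      where
      C : ℕ
      C = suc (n ℕ.+ v₀)
      2≤N : 2 ℕ.≤ N
      2≤N = N-max 2 2≤x
      2≤Z : 2 ℕ.≤ Z
      2≤Z = Z-max 2 2≤y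
      open SmoothSum em x y N Z N≤x N-max Z≤y Z-max (ℕ.≤-trans (ℕ.s≤s ℕ.z≤n) 2≤Z)
      Y v q : ℕ
      Y = Z ℕ.⊓ N
      v = productCount ps N
      q = ℤ.∣ signSum ps N (signsAt ω ps) ∣
      E : ℝ
      E = fromℕ v ^[ em ] (fromℚ ½ + ε)
      1≤v : 1 ℕ.≤ v
      1≤v = productCount-pos ps (ℕ.≤-trans (ℕ.s≤s ℕ.z≤n) 2≤N)
      reduce : fromℕ q ≤ fromℕ C * E →
               fromℕ ℤ.∣ Ψ em (wintner X ω) x y ∣ ≤ fromℕ C * (fromℤ (Ψ* em x y) ^[ em ] (fromℚ ½ + ε))
      reduce = subst₂ (λ i j → fromℕ ℤ.∣ i ∣ ≤ fromℕ C * (fromℤ j ^[ em ] (fromℚ ½ + ε))) (sym (Ψ-wintner X ω)) (sym Ψ*≡)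
      0≤E : fromℕ 0 ≤ E
      0≤E = ≤-trans {fromℕ 0} {fromℕ 1} {E} (fromℕ-mono ℕ.z≤n) (1≤power v 1≤v)
      -- The case y ≤ x uses the hypothesis; otherwise y is replaced by x.
      condition′ : Condition N Y
      condition′ with ℕ.≤-total Z N
      ... | inj₁ Z≤N = subst (Condition N) (sym (ℕ.m≤n⇒m⊓n≡m Z≤N)) (inj₁ (log-condition {x} {y} em A N Z
              (≤-trans {fromℕ 1} {fromℕ 2} {x} (fromℕ-mono (ℕ.s≤s ℕ.z≤n)) 2≤x) N≤x y<Z+1 Alog≤y))
      ... | inj₂ N≤Z = inj₂ (ℕ.m≥n⇒m⊓n≡n N≤Z)
      conclude : Dec (C ℕ.≤ v) → fromℕ ℤ.∣ Ψ em (wintner X ω) x y ∣ ≤ fromℕ C * (fromℤ (Ψ* em x y) ^[ em ] (fromℚ ½ + ε))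
      conclude (no C≰v) = reduce (begin
        fromℕ q             ≲⟨ fromℕ-mono (ℕ.≤-trans (∣signSum∣≤ ps N (signsAt ω ps)) (ℕ.<⇒≤ (ℕ.≰⇒> C≰v))) ⟩
        fromℕ C             ≈⟨ ≃-trans {fromℕ C} {fromℕ 1 * fromℕ C} {fromℕ C * fromℕ 1}
                                 (≃-sym {fromℕ 1 * fromℕ C} {fromℕ C} (*-identityˡ (fromℕ C))) (*-comm (fromℕ 1) (fromℕ C)) ⟩
        fromℕ C * fromℕ 1   ≲⟨ *-monoˡ-≤ {fromℕ C} {fromℕ 1} {E} (fromℕ-mono ℕ.z≤n) (1≤power v 1≤v) ⟩
        fromℕ C * E         ∎)
        where open ≤-Reasoning
      conclude (yes C≤v) = reduce (begin
        fromℕ q             ≲⟨ ≤-power v 1≤v q (ℕ.≮⇒≥ λ lt → ¬tail (v ℕ.∸ n , subst (λ w → Bad w ω) (sym (ℕ.m∸n+n≡m n≤v)) (Y , Y<range , v₀≤v , N , scale , lt))) ⟩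
        E                   ≈⟨ *-identityˡ E ⟨
        fromℕ 1 * E         ≲⟨ *-mono-≤ {fromℕ C} {E} {fromℕ 1} {E} (fromℕ-mono ℕ.z≤n) 0≤E (fromℕ-mono (ℕ.s≤s ℕ.z≤n)) (≤-refl E) ⟩
        fromℕ C * E         ∎)
        where
        open ≤-Reasoning
        n≤v : n ℕ.≤ v
        n≤v = ℕ.≤-trans (ℕ.m≤m+n n v₀) (ℕ.≤-trans (ℕ.n≤1+n (n ℕ.+ v₀)) C≤v)
        v₀≤v : v₀ ℕ.≤ v
        v₀≤v = ℕ.≤-trans (ℕ.m≤n+m v₀ n) (ℕ.≤-trans (ℕ.n≤1+n (n ℕ.+ v₀)) C≤v)
        -- A sum over y-smooth numbers has at most 2 ^ (y + 1) terms.
        large-Y : Y₀ ℕ.≤ Y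
        large-Y = ℕ.s≤s⁻¹ (^-cancelʳ-≤ (suc Y₀) (suc Y) ℕ.≤-refl
          (ℕ.≤-trans v₀≤v (ℕ.≤-trans (productCount-≤ ps N) (ℕ.^-monoʳ-≤ 2 (primesUpTo-length Y)))))
        scale : Scale v Y N
        scale = record { Y≤N = ℕ.m⊓n≤n Z N ; condition = condition′ ; Y₀≤Y = large-Y ; size = refl }
        Y<range : Y ℕ.< range v
        Y<range = ℕ.≤-trans (Y<productCount^4 (Y≤N scale) condition′ large-Y) (ℕ.n≤1+n (suc v ℕ.^ 4))

    bound-holds : ∀ {ω} n → ¬ Tail n ω → ∀ x y → fromℕ 2 ≤ x → fromℕ 2 ≤ y → fromℕ A * log em x ≤ y →
      fromℕ ℤ.∣ Ψ em (wintner X ω) x y ∣ ≤ fromℕ (suc (n ℕ.+ v₀)) * (fromℤ (Ψ* em x y) ^[ em ] (fromℚ ½ + ε))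
    bound-holds {ω} n ¬tail x y 2≤x 2≤y Alog≤y =
      let N , N≤x , _ , N-max = floor em x (0≤ x 2≤x)
          Z , Z≤y , y<Z+1 , Z-max = floor em y (0≤ y 2≤y)
      in bound-at-integers n ¬tail x y N Z N≤x N-max Z≤y Z-max y<Z+1 2≤x 2≤y Alog≤y
      where
      0≤ : ∀ z → fromℕ 2 ≤ z → fromℕ 0 ≤ z
      0≤ z 2≤z = ≤-trans {fromℕ 0} {fromℕ 2} {z} (fromℕ-mono ℕ.z≤n) 2≤z

mainTheorem2 : (em : ExcludedMiddle 0ℓ) →
    (ε : ℝ) → fromℕ 0 < ε →
    ∃ λ (Cε : ℝ) → (fromℕ 0 < Cε) ×
    ((𝒫 : ProbabilitySpace) (X : ℕ → ProbabilitySpace.Ω 𝒫 → Sign) → IsRademacher 𝒫 X →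
    AlmostSurely 𝒫 λ ω →
    ∃ λ (C : ℝ) → (fromℕ 0 < C) ×
    (∀ (x y : ℝ) → fromℕ 2 ≤ x → fromℕ 2 ≤ y → Cε * log em x ≤ y →
    fromℕ ℤ.∣ Ψ em (wintner X ω) x y ∣
    ≤ C * (fromℤ (Ψ* em x y) ^[ em ] (fromℚ ½ + ε))))
mainTheorem2 em ε 0<ε =
  fromℕ A , 0<fromℕ 1≤A , λ 𝒫 X rademacher →
    FinitelyMany 𝒫 X rademacher ,
    measurable-finitelyMany 𝒫 X rademacher ,
    finitelyMany-certain 𝒫 X rademacher ,
    λ {ω} (n , ¬tail) → fromℕ (suc (n ℕ.+ v₀)) , 0<fromℕ (ℕ.s≤s ℕ.z≤n) ,
      bound-holds 𝒫 X rademacher n ¬tail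
  where
  open AlmostSure em ε 0<ε
  open RealPower em ε 0<ε using (r)
  open Admissible (momentConstant r) (momentConstant-pos r) using (A; 1≤A)
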